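{- There is an algorithm that, given an instance of the Vehicle Routing Problem (VRP) and $r\in\mathbb N$, decides whether there exists a VRP routing of weight at most $r$ in $f(r)\cdot n^{O(1)}$ steps, for some computable function $f$, where $n=|V(G)|$ is the number of vertices of the input graph.
   Context: All graphs are finite and undirected, and $\mathbb N = \{0,1,2,\dots\}$. A walk in $G$ is a sequence of vertices $(v_1,\dots,v_m)$ with consecutive vertices adjacent; vertices and edges may be repeated. It is closed if $v_1 = v_m$. For edge weights $w\colon E(G)\to\mathbb N$ (weight zero is allowed), the weight of a walk is $w(p)=\sum_{i=1}^{m-1} w(v_i,v_{i+1})$. VRP: The input consists of a graph $G$ with edge weights $w\colon E(G)\to\mathbb N$, a nonempty set of depots $D\subseteq V(G)$, a set of clients $C\subseteq V(G)$, and a number of vehicles $k\in\mathbb N$. A routing is a set of $k'$ walks $R=\{p_1,\dots,p_{k'}\}$ (one walk per vehicle) together with an assignment $A\colon C\to[k']$ such that $k'\le k$, every walk starts at a vertex of $D$, every client $c\in C$ is a vertex of $p_{A(c)}$, and every walk in $R$ is closed. Its weight is $w(R)=\sum_{p\in R}w(p)$. -}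

module Defs where

open import Data.Bool using (Bool; true; false; T; if_then_else_)
open import Data.Fin using (Fin; zero; suc; remQuot)
open import Data.Fin.Subset using (Subset; Nonempty; _∈_)
open import Data.List using (List; []; _∷_)
open import Data.List.NonEmpty as List⁺ using (List⁺)
import Data.List.Membership.Propositional as Mem
open import Data.List.Relation.Unary.Linked using (Linked)
open import Data.Nat using (ℕ; zero; suc; _+_; _∸_; _≤_; _≡ᵇ_)
open import Data.Product using (Σ-syntax; ∃-syntax; _×_; _,_; uncurry)
open import Data.Vec using (Vec; lookup; map; sum)
open import Relation.Nullary using (¬_)
open import Relation.Binary.PropositionalEquality using (_≡_; _≢_)

------------------------------------------------------------------------
-- Finite simple undirected graphs on the vertex set Fin n

record Graph (n : ℕ) : Set where
  field
    adj    : Fin n → Fin n → Bool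
    sym    : ∀ u v → T (adj u v) → T (adj v u)
    irrefl : ∀ v → ¬ T (adj v v)

  Adj : Fin n → Fin n → Set
  Adj u v = T (adj u v)

-- w is an edge weighting represented by a symmetric function on all pairs;
-- its values on non-adjacent pairs are irrelevant.

record Instance : Set where
  field
    n        : ℕ
    G        : Graph n
    w        : Fin n → Fin n → ℕ
    w-sym    : ∀ u v → w u v ≡ w v u
    D        : Subset n
    nonempty : Nonempty D
    C        : Subset n
    k        : ℕ

  open Graph G public

  record Walk : Set where
    field
      vertices    : List⁺ (Fin n)
      consecutive : Linked Adj (List⁺.toList vertices)

    start end : Fin n
    start = List⁺.head vertices
    end   = List⁺.last vertices

  open Walk public

  Closed : Walk → Set
  Closed p = start p ≡ end p

  _∈ʷ_ : Fin n → Walk → Set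
  v ∈ʷ p = v Mem.∈ List⁺.toList (vertices p)

  listWeight : List (Fin n) → ℕ
  listWeight []           = 0
  listWeight (u ∷ [])     = 0
  listWeight (u ∷ v ∷ vs) = w u v + listWeight (v ∷ vs)

  walkWeight : Walk → ℕ
  walkWeight p = listWeight (List⁺.toList (vertices p))

  -- The walks form an indexed family, one per vehicle, so that two
  -- vehicles may use the same walk.
  record Routing : Set where
    field
      k′     : ℕ
      k′≤k   : k′ ≤ k
      walks  : Vec Walk k′
      assign : ∀ c → c ∈ C → Fin k′
      depots : ∀ i → start (lookup walks i) ∈ D
      served : ∀ c (c∈C : c ∈ C) → c ∈ʷ lookup walks (assign c c∈C)
      closed : ∀ i → Closed (lookup walks i)

  weight : Routing → ℕ
  weight R = sum (map walkWeight (Routing.walks R))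

------------------------------------------------------------------------
-- Random access machines, as structured programs.  A program uses
-- registers and arrays of unbounded length, both named by fixed numbers;
-- every cell holds a natural number.  Steps are counted with unit cost.
-- Multiplication is not primitive: with unit-cost multiplication, a step
-- count would no longer be polynomially related to Turing machine time.

infixr 4 _⨾_
infix  5 _≔_ _[_]≔_
infixl 6 _⊕_ _⊖_

data Exp : Set where
  num  : ℕ → Exp
  reg  : ℕ → Exp
  read : ℕ → Exp → Exp  -- the cell a[e]
  _⊕_  : Exp → Exp → Exp
  _⊖_  : Exp → Exp → Exp

data Program : Set where
  skip   : Program
  _≔_    : ℕ → Exp → Program
  _[_]≔_ : ℕ → Exp → Exp → Program
  _⨾_    : Program → Program → Program
  cond   : Exp → Program → Program → Program
  while  : Exp → Program → Program

record State : Set where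
  constructor state
  field
    register : ℕ → ℕ
    array    : ℕ → ℕ → ℕ

open State public

_[_↦_] : ∀ {A : Set} → (ℕ → A) → ℕ → A → ℕ → A
(f [ i ↦ x ]) j = if i ≡ᵇ j then x else f j

⟦_⟧ : Exp → State → ℕ
⟦ num m ⟧    s = m
⟦ reg i ⟧    s = register s i
⟦ read a e ⟧ s = array s a (⟦ e ⟧ s)
⟦ e ⊕ e′ ⟧   s = ⟦ e ⟧ s + ⟦ e′ ⟧ s
⟦ e ⊖ e′ ⟧   s = ⟦ e ⟧ s ∸ ⟦ e′ ⟧ s

cost : Exp → ℕ
cost (num m)    = 1
cost (reg i)    = 1
cost (read a e) = 1 + cost e
cost (e ⊕ e′)   = 1 + cost e + cost e′
cost (e ⊖ e′)   = 1 + cost e + cost e′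

setRegister : ℕ → ℕ → State → State
setRegister i x s = state (register s [ i ↦ x ]) (array s)

setCell : ℕ → ℕ → ℕ → State → State
setCell a i x s = state (register s) (array s [ a ↦ array s a [ i ↦ x ] ])

-- ⟨ P , s ⟩⇓⟨ s′ , t ⟩: started in s, the program P halts in s′ after
-- exactly t steps.  Conditions are true when nonzero.

data ⟨_,_⟩⇓⟨_,_⟩ : Program → State → State → ℕ → Set where
  skip : ∀ {s} → ⟨ skip , s ⟩⇓⟨ s , 1 ⟩
  assign : ∀ {i e s} →
    ⟨ i ≔ e , s ⟩⇓⟨ setRegister i (⟦ e ⟧ s) s , 1 + cost e ⟩
  store : ∀ {a e e′ s} →
    ⟨ a [ e ]≔ e′ , s ⟩⇓⟨ setCell a (⟦ e ⟧ s) (⟦ e′ ⟧ s) s , 1 + cost e + cost e′ ⟩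
  seq : ∀ {P Q s s′ s″ t t′} →
    ⟨ P , s ⟩⇓⟨ s′ , t ⟩ → ⟨ Q , s′ ⟩⇓⟨ s″ , t′ ⟩ →
    ⟨ P ⨾ Q , s ⟩⇓⟨ s″ , t + t′ ⟩
  cond-true : ∀ {e P Q s s′ t} →
    ⟦ e ⟧ s ≢ 0 → ⟨ P , s ⟩⇓⟨ s′ , t ⟩ →
    ⟨ cond e P Q , s ⟩⇓⟨ s′ , 1 + cost e + t ⟩
  cond-false : ∀ {e P Q s s′ t} →
    ⟦ e ⟧ s ≡ 0 → ⟨ Q , s ⟩⇓⟨ s′ , t ⟩ →
    ⟨ cond e P Q , s ⟩⇓⟨ s′ , 1 + cost e + t ⟩
  while-true : ∀ {e P s s′ s″ t t′} →
    ⟦ e ⟧ s ≢ 0 → ⟨ P , s ⟩⇓⟨ s′ , t ⟩ → ⟨ while e P , s′ ⟩⇓⟨ s″ , t′ ⟩ →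
    ⟨ while e P , s ⟩⇓⟨ s″ , 1 + cost e + t + t′ ⟩
  while-false : ∀ {e P s} →
    ⟦ e ⟧ s ≡ 0 → ⟨ while e P , s ⟩⇓⟨ s , 1 + cost e ⟩

output : State → ℕ
output s = register s 0

-- A finite list of values followed by zeros.
initial : List ℕ → ℕ → ℕ
initial []       i       = 0
initial (x ∷ xs) zero    = x
initial (x ∷ xs) (suc i) = initial xs i

Computable : (ℕ → ℕ) → Set
Computable f = Σ[ P ∈ Program ] (∀ m → ∃[ s ] ∃[ t ]
  ⟨ P , state (initial (m ∷ [])) (λ _ _ → 0) ⟩⇓⟨ s , t ⟩ × output s ≡ f m)

------------------------------------------------------------------------
-- Encoding of the input

bit : Bool → ℕ
bit false = 0
bit true  = 1

vector : ∀ {m} → (Fin m → ℕ) → ℕ → ℕ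
vector {zero}  f i       = 0
vector {suc m} f zero    = f zero
vector {suc m} f (suc i) = vector (λ j → f (suc j)) i

-- Row-major: entry (u , v) is stored in the cell n · u + v.
matrix : ∀ {n} → (Fin n → Fin n → ℕ) → ℕ → ℕ
matrix {n} f = vector (λ i → uncurry f (remQuot {n} n i))

-- Registers 0, 1, 2 hold n, k, r; arrays 0, 1, 2, 3 hold the depots, the
-- clients, the adjacency matrix and the weights.
load : Instance → ℕ → State
load I r = state (initial (n ∷ k ∷ r ∷ [])) arrays
  where
  open Instance I
  arrays : ℕ → ℕ → ℕ
  arrays 0 = vector (λ v → bit (lookup D v))
  arrays 1 = vector (λ v → bit (lookup C v))
  arrays 2 = matrix (λ u v → bit (adj u v))
  arrays 3 = matrix w
  arrays _ = λ _ → 0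

{-# OPTIONS --safe #-}
-- Call two vertices equivalent if a walk of weight zero joins them, and let
-- the leader of a class be its least client.  A closed walk of weight w meets
-- at most w + 1 classes, so the walks of positive weight serve at most 2r
-- leaders.  Every other walk stays in one class, which contains a depot, and
-- costs one vehicle.  Hence it suffices to find closed walks of total weight
-- at most r that serve all leaders without a depot in their class, and as many
-- of the others as needed to get by with k vehicles.  Distinct leaders are
-- counted by colour coding: the colour of a leader is what remains of the
-- binary digits of its number after masking.  Any 2r numbers are told apart by
-- fewer than 2r digits, and a mask is itself a number below 2n, so all masks
-- can be tried.  What remains is reachability between configurations (mask,
-- colours seen, first and current vertex, weight, walks and leaders counted),
-- of which there are f(r) · n^O(1).
module Submission where

open import Defs
open import Data.Bool using (Bool; true; false; T)
open import Data.Empty using (⊥; ⊥-elim)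
open import Data.Fin using (Fin; zero; suc; toℕ; fromℕ<; combine; #_)
open import Data.Fin.Properties using (toℕ<n; toℕ-fromℕ<; toℕ-combine; remQuot-combine; toℕ-injective)
open import Data.Fin.Subset using (Subset) renaming (_∈_ to _∈ₛ_)
open import Data.List as List using (List; []; _∷_; length; _++_)
open import Data.List.Membership.Propositional using (_∈_; _∉_; find; lose)
open import Data.List.Membership.Propositional.Properties using (∈-∃++; ∈-++⁺ˡ; ∈-++⁺ʳ; ∈-++⁻)
open import Data.List.NonEmpty as List⁺ using (_∷_)
open import Data.List.Properties using (length-++; length-tabulate)
open import Data.List.Relation.Binary.Pointwise using (Pointwise; []; _∷_)
open import Data.List.Relation.Unary.All as All using (All; []; _∷_)
open import Data.List.Relation.Unary.All.Properties using () renaming (++⁺ to All-++⁺)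
open import Data.List.Relation.Unary.AllPairs using ([]; _∷_)
open import Data.List.Relation.Unary.Any as Any using (Any; here; there; any?)
open import Data.List.Relation.Unary.Any.Properties using (tabulate⁺; lookup-index; ++⁺ˡ; ++⁺ʳ)
open import Data.List.Relation.Unary.Linked using (Linked; []; [-]; _∷_)
open import Data.List.Relation.Unary.Unique.Propositional using (Unique)
open import Data.Nat
open import Data.Nat.Properties
open import Data.Product using (Σ-syntax; ∃-syntax; _×_; _,_; proj₁; proj₂; uncurry)
open import Data.Sum using (_⊎_; inj₁; inj₂; [_,_]′)
open import Data.Unit using (⊤; tt)
open import Data.Vec as Vec using (Vec; []; _∷_)
open import Data.Vec.Properties using (lookup∘tabulate; lookup⇒[]=; []=⇒lookup)
open import Function using (_∘_; id)
open import Function.Bundles using (_⇔_; mk⇔; Equivalence)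
open import Function.Properties.Equivalence using () renaming (refl to ⇔-refl; sym to ⇔-sym; trans to ⇔-trans)
open import Relation.Binary.Construct.Closure.ReflexiveTransitive using (Star; ε; _◅_; _◅◅_; gmap)
open import Relation.Binary.Definitions using (tri<; tri≈; tri>)
open import Relation.Binary.PropositionalEquality
open import Relation.Nullary using (¬_; Dec; yes; no; ¬?; _×-dec_)
open import Relation.Nullary.Decidable using (decidable-stable) renaming (map to Dec-map)

open Equivalence using (to; from)

-- A functional language on top of the machine

-- The obstacle is the running time, which has to be established on a concrete machine. Apart from a
-- prelude that computes the bounds, every loop therefore makes the same number `B` of rounds, where
-- `B` is the square of the number of configuration codes; a program of fixed shape then takes at
-- most a fixed power of `B` steps, and no loop needs an analysis of its own. As a loop carries a
-- single number, colour sets and whole reachability matrices are packed into the binary digits of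
-- one cell. The function f is doubly exponential because colours run up to `2 ^ (r + r)` and a set
-- of colours is a number with that many digits. The two directions of correctness use colours
-- differently. An accepted run yields a routing under every mask: a fresh colour proves a fresh
-- leader, and a collision only loses runs. For the converse some mask must be injective, but merely
-- on the leaders met by one given solution. Deciding which vertices are equivalent, on which the
-- existence of leaders rests, is done by the verified program itself.

upd-same : ∀ {A : Set} (f : ℕ → A) i {x} → (f [ i ↦ x ]) i ≡ x
upd-same f i with i ≡ᵇ i in eq
... | true  = refl
... | false = ⊥-elim (subst T eq (≡⇒≡ᵇ i i refl))

upd-other : ∀ {A : Set} (f : ℕ → A) i {x} j → i ≢ j → (f [ i ↦ x ]) j ≡ f j
upd-other f i j i≢j with i ≡ᵇ j in eq
... | true  = ⊥-elim (i≢j (≡ᵇ⇒≡ i j (subst T (sym eq) tt)))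
... | false = refl

infixl 6 _⊕_ _⊖_

-- Variables are de Bruijn indices, the globals are the registers below 6, and
-- a fold always makes as many rounds as register 5 says; its body sees the
-- round at index 0 and the accumulator at index 1.  The body of a call sees
-- the arguments only.
data Tm : Set where
  num  : ℕ → Tm
  var  : ℕ → Tm
  glob : Fin 6 → Tm
  read : ℕ → Tm → Tm
  _⊕_ _⊖_ : Tm → Tm → Tm
  ite  : Tm → Tm → Tm → Tm
  fold : Tm → Tm → Tm
  call : Tm → List Tm → Tm

nth : List ℕ → ℕ → ℕ
nth []       i       = 0
nth (x ∷ xs) zero    = x
nth (x ∷ xs) (suc i) = nth xs i

choose : ℕ → ℕ → ℕ → ℕ
choose zero    a b = b
choose (suc _) a b = a

iterate : ℕ → (ℕ → ℕ → ℕ) → ℕ → ℕ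
iterate zero    f a = a
iterate (suc m) f a = f m (iterate m f a)

module Eval (g : ℕ → ℕ) (α : ℕ → ℕ → ℕ) where

  eval : Tm → List ℕ → ℕ
  evals : List Tm → List ℕ → List ℕ
  eval (num c)     ρ = c
  eval (var i)     ρ = nth ρ i
  eval (glob i)    ρ = g (toℕ i)
  eval (read a e)  ρ = α a (eval e ρ)
  eval (e ⊕ e₁)    ρ = eval e ρ + eval e₁ ρ
  eval (e ⊖ e₁)    ρ = eval e ρ ∸ eval e₁ ρ
  eval (ite c a b) ρ = choose (eval c ρ) (eval a ρ) (eval b ρ)
  eval (fold e b)  ρ = iterate (g 5) (λ i a → eval b (i ∷ a ∷ ρ)) (eval e ρ)
  eval (call f es) ρ = eval f (evals es ρ)
  evals []       ρ = []
  evals (e ∷ es) ρ = eval e ρ ∷ evals es ρ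

slot : List ℕ → ℕ → Exp
slot []      i       = num 0
slot (x ∷ Γ) zero    = reg x
slot (x ∷ Γ) (suc i) = slot Γ i

consecutiveFrom : ℕ → List Tm → List ℕ
consecutiveFrom t []       = []
consecutiveFrom t (_ ∷ es) = t ∷ consecutiveFrom (suc t) es

-- compile e Γ t leaves the value of e in register t and only changes
-- registers from t on; Γ lists the registers that hold the variables.
compile  : Tm → List ℕ → ℕ → Program
compiles : List Tm → List ℕ → ℕ → Program
compile (num c)     Γ t = t ≔ num c
compile (var i)     Γ t = t ≔ slot Γ i
compile (glob i)    Γ t = t ≔ reg (toℕ i)
compile (read a e)  Γ t = compile e Γ t ⨾ t ≔ read a (reg t)
compile (e ⊕ e₁)    Γ t = compile e Γ t ⨾ compile e₁ Γ (suc t) ⨾ t ≔ reg t ⊕ reg (suc t)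
compile (e ⊖ e₁)    Γ t = compile e Γ t ⨾ compile e₁ Γ (suc t) ⨾ t ≔ reg t ⊖ reg (suc t)
compile (ite c a b) Γ t = compile c Γ t ⨾ cond (reg t) (compile a Γ t) (compile b Γ t)
compile (fold e b)  Γ t =
  compile e Γ t ⨾ suc t ≔ num 0 ⨾
  while (reg 5 ⊖ reg (suc t))
    (compile b (suc t ∷ t ∷ Γ) (2 + t) ⨾ t ≔ reg (2 + t) ⨾ suc t ≔ reg (suc t) ⊕ num 1)
compile (call f es) Γ t =
  compiles es Γ t ⨾
  compile f (consecutiveFrom t es) (length es + t) ⨾ t ≔ reg (length es + t)
compiles []       Γ t = skip
compiles (e ∷ es) Γ t = compile e Γ t ⨾ compiles es Γ (suc t)

-- Exponent of the time bound `B ^ κ e`, with `B` the common number of rounds. Running two parts in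
-- sequence adds their exponents and one more, so the exponent is read off the syntax and is the
-- same for all inputs.
κ  : Tm → ℕ
κs : List Tm → ℕ
κ (num c)     = 1
κ (var i)     = 1
κ (glob i)    = 1
κ (read a e)  = suc (κ e + 2)
κ (e ⊕ e₁)    = suc (κ e + suc (κ e₁ + 2))
κ (e ⊖ e₁)    = suc (κ e + suc (κ e₁ + 2))
κ (ite c a b) = suc (κ c + suc (1 + suc (κ a + κ b)))
-- A round takes `B ^ κ b + 10` steps, and 10 ≤ 2 ^ 4 gives the 4. One `suc` stands for the
-- multiplication by `B`, the 2 for the 4 steps of the last test, and the 1 for clearing the
-- counter.
κ (fold e b)  = suc (κ e + suc (1 + suc (suc (suc (κ b + 4)) + 2)))
κ (call f es) = suc (κs es + suc (κ f + 1))
κs []       = 1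
κs (e ∷ es) = suc (κ e + κs es)

-- Correctness and cost of compiled terms

module Compile (g : ℕ → ℕ) (α : ℕ → ℕ → ℕ) (2≤B : 2 ≤ g 5) where

  open Eval g α

  B : ℕ
  B = g 5

  instance
    B≢0 : NonZero B
    B≢0 = >-nonZero (≤-trans (s≤s z≤n) 2≤B)

  1≤B^ : ∀ a → 1 ≤ B ^ a
  1≤B^ a = m^n>0 B a

  -- Both powers are at least 1, so each is at most their product; the resulting factor 2 is paid
  -- for by one more `B`.
  +-bound : ∀ {x y} a b → x ≤ B ^ a → y ≤ B ^ b → x + y ≤ B ^ suc (a + b)
  +-bound {x} {y} a b p q = begin
    x + y                        ≤⟨ +-mono-≤ p q ⟩
    B ^ a + B ^ b                ≤⟨ +-mono-≤ (m≤m*n (B ^ a) (B ^ b) {{>-nonZero (1≤B^ b)}})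
                                             (m≤n*m (B ^ b) (B ^ a) {{>-nonZero (1≤B^ a)}}) ⟩
    B ^ a * B ^ b + B ^ a * B ^ b ≡⟨ cong (B ^ a * B ^ b +_) (sym (+-identityʳ _)) ⟩
    2 * (B ^ a * B ^ b)          ≤⟨ *-monoˡ-≤ _ 2≤B ⟩
    B * (B ^ a * B ^ b)          ≡⟨ cong (B *_) (sym (^-distribˡ-+-* B a b)) ⟩
    B ^ suc (a + b)              ∎
    where open ≤-Reasoning

  2^≤ : ∀ a → 2 ^ a ≤ B ^ a
  2^≤ a = ^-monoˡ-≤ a 2≤B

  widen : ∀ {x a b} → a ≤ b → x ≤ B ^ a → x ≤ B ^ b
  widen a≤b p = ≤-trans p (^-monoʳ-≤ B a≤b)

  record Ok (s : State) : Set where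
    constructor ok
    field
      globals : ∀ i → i < 6 → register s i ≡ g i
      arrays  : array s ≡ α
  open Ok

  -- Variables live strictly below the target register `t`. Code compiled at `t` leaves exactly this
  -- region alone, so the variables survive the evaluation of subterms.
  Env : List ℕ → List ℕ → ℕ → State → Set
  Env Γ ρ t s = Pointwise (λ i x → i < t × register s i ≡ x) Γ ρ

  record Frame (t : ℕ) (s s′ : State) : Set where
    constructor frame
    field
      regs : ∀ i → i < t → register s′ i ≡ register s i
      arrs : array s′ ≡ array s
  open Frame

  record Exec (P : Program) (s : State) (t v c : ℕ) : Set where
    constructor exec
    field
      {after} : State
      {time}  : ℕ
      run     : ⟨ P , s ⟩⇓⟨ after , time ⟩
      time≤   : time ≤ B ^ c
      value   : register after t ≡ v
      framed  : Frame t s after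

  ok-after : ∀ {t s s′} → 6 ≤ t → Frame t s s′ → Ok s → Ok s′
  ok-after 6≤t m o =
    ok (λ i i<6 → trans (regs m i (≤-trans i<6 6≤t)) (globals o i i<6)) (trans (arrs m) (arrays o))

  env-after : ∀ {Γ ρ t u s s′} → t ≤ u → Frame t s s′ → Env Γ ρ t s → Env Γ ρ u s′
  env-after t≤u m []               = []
  env-after t≤u m ((i<t , e) ∷ es) =
    (≤-trans i<t t≤u , trans (regs m _ i<t) e) ∷ env-after t≤u m es

  frame-refl : ∀ {t s} → Frame t s s
  frame-refl = frame (λ _ _ → refl) refl

  frame-set : ∀ {t} u {s x} → t ≤ u → Frame t s (setRegister u x s)
  frame-set u {s} t≤u = frame (λ i i<t → upd-other (register s) u i λ { refl → <⇒≱ i<t t≤u }) refl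

  frame-trans : ∀ {t u s s′ s″} → t ≤ u → Frame t s s′ → Frame u s′ s″ → Frame t s s″
  frame-trans t≤u p q =
    frame (λ i i<t → trans (regs q i (≤-trans i<t t≤u)) (regs p i i<t)) (trans (arrs q) (arrs p))

  frame-narrow : ∀ {t u s s′} → t ≤ u → Frame u s s′ → Frame t s s′
  frame-narrow t≤u p = frame (λ i i<t → regs p i (≤-trans i<t t≤u)) (arrs p)

  slot-value : ∀ {Γ ρ t s} i → Env Γ ρ t s → ⟦ slot Γ i ⟧ s ≡ nth ρ i
  slot-value i       []             = refl
  slot-value zero    ((_ , e) ∷ es) = e
  slot-value (suc i) (_ ∷ es)       = slot-value i es

  slot-cost : ∀ Γ i → 1 + cost (slot Γ i) ≤ 2
  slot-cost []      i       = ≤-refl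
  slot-cost (x ∷ Γ) zero    = ≤-refl
  slot-cost (x ∷ Γ) (suc i) = slot-cost Γ i

  assign-exec : ∀ {t e s v} c → 1 + cost e ≤ 2 ^ c → ⟦ e ⟧ s ≡ v → Exec (t ≔ e) s t v c
  assign-exec {t} {s = s} c q p =
    exec assign (≤-trans q (2^≤ c)) (trans (upd-same (register s) t) p) (frame-set t ≤-refl)

  seq-exec : ∀ {P Q s t u v v′ a b} → t ≤ u → (e : Exec P s u v a) →
    Exec Q (Exec.after e) t v′ b → Exec (P ⨾ Q) s t v′ (suc (a + b))
  seq-exec {a = a} {b} t≤u (exec r c v m) (exec r′ c′ v′ m′) =
    exec (seq r r′) (+-bound a b c c′) v′ (frame-trans ≤-refl (frame-narrow t≤u m) m′)

  module Loop (step : ℕ → ℕ → ℕ) (a₀ : ℕ) (body : Program) (t c : ℕ)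
              (Inv : State → Set)
              (inv : ∀ {s s′} → Frame t s s′ → Inv s → Inv s′)
              (inv-ok : ∀ {s} → Inv s → Ok s)
              (body-exec : ∀ s i a → Inv s → register s t ≡ a → register s (suc t) ≡ i →
                 Exec body s (2 + t) (step i a) c) where

    P : Program
    P = body ⨾ t ≔ reg (2 + t) ⨾ suc t ≔ reg (suc t) ⊕ num 1

    -- Induction on the `d` rounds that remain, while `i` counts the finished ones. A round adds to
    -- its body 4 steps for the test and 6 for the two assignments; the final 4 is the failing test.
    loop : ∀ d i s → Inv s → d + i ≡ B → register s (suc t) ≡ i →
      register s t ≡ iterate i step a₀ →
      Σ[ s′ ∈ State ] Σ[ τ ∈ ℕ ] ⟨ while (reg 5 ⊖ reg (suc t)) P , s ⟩⇓⟨ s′ , τ ⟩ ×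
        τ ≤ d * (B ^ c + 10) + 4 ×
        register s′ t ≡ iterate B step a₀ × Frame t s s′
    loop zero i s I refl p q =
      s , _ , while-false z , ≤-refl , q , frame-refl
      where
      z : register s 5 ∸ register s (suc t) ≡ 0
      z rewrite p | globals (inv-ok I) 5 ≤-refl = n∸n≡0 B
    loop (suc d) i s I d+i p q with body-exec s i (iterate i step a₀) I q p
    ... | exec {s₁} {τ₁} r₁ τ₁≤ v₁ m₁ = continue
      where
      s₂ s₃ : State
      s₂ = setRegister t (register s₁ (2 + t)) s₁
      s₃ = setRegister (suc t) (register s₂ (suc t) + 1) s₂
      t≢st : t ≢ suc t
      t≢st ()
      frame₃ : Frame t s s₃
      frame₃ = frame-trans ≤-refl (frame-narrow (m≤n+m t 2) m₁)
        (frame-trans ≤-refl (frame-set t ≤-refl) (frame-set (suc t) (n≤1+n t)))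
      p₃ : register s₃ (suc t) ≡ suc i
      p₃ = trans (upd-same (register s₂) (suc t))
             (trans (cong (_+ 1) (trans (upd-other (register s₁) t (suc t) t≢st)
                                        (trans (regs m₁ (suc t) ≤-refl) p)))
                    (+-comm i 1))
      q₃ : register s₃ t ≡ iterate (suc i) step a₀
      q₃ = trans (upd-other (register s₂) (suc t) t (λ e → t≢st (sym e)))
             (trans (upd-same (register s₁) t) v₁)
      nz : register s 5 ∸ register s (suc t) ≢ 0
      nz z = <⇒≱ (subst (i <_) d+i (s≤s (m≤n+m i d)))
        (m∸n≡0⇒m≤n (trans (sym (cong₂ _∸_ (globals (inv-ok I) 5 ≤-refl) p)) z))
      continue : _
      continue with loop d (suc i) s₃ (inv frame₃ I) (trans (+-suc d i) d+i) p₃ q₃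
      ... | s′ , τ , r , τ≤ , v , m =
        s′ , _ , while-true nz (seq r₁ (seq assign assign)) r , bound , v , frame-trans ≤-refl frame₃ m
        where
        open ≤-Reasoning
        bound : 1 + 3 + (τ₁ + (2 + 4)) + τ ≤ suc d * (B ^ c + 10) + 4
        bound = begin
          4 + (τ₁ + 6) + τ                    ≤⟨ +-mono-≤ (+-monoʳ-≤ 4 (+-monoˡ-≤ 6 τ₁≤)) τ≤ ⟩
          4 + (B ^ c + 6) + (d * (B ^ c + 10) + 4) ≡⟨ cong (_+ (d * (B ^ c + 10) + 4)) (lem (B ^ c)) ⟩
          (B ^ c + 10) + (d * (B ^ c + 10) + 4) ≡⟨ sym (+-assoc (B ^ c + 10) _ 4) ⟩
          suc d * (B ^ c + 10) + 4            ∎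
          where
          lem : ∀ x → 4 + (x + 6) ≡ x + 10
          lem x = trans (+-comm 4 (x + 6)) (+-assoc x 6 4)

  correct  : ∀ e {Γ ρ t s} → Ok s → 6 ≤ t → Env Γ ρ t s →
    Exec (compile e Γ t) s t (eval e ρ) (κ e)
  corrects : ∀ es {Γ ρ t s} → Ok s → 6 ≤ t → Env Γ ρ t s →
    Σ[ s′ ∈ State ] Σ[ τ ∈ ℕ ] ⟨ compiles es Γ t , s ⟩⇓⟨ s′ , τ ⟩ × τ ≤ B ^ κs es ×
      Env (consecutiveFrom t es) (evals es ρ) (length es + t) s′ × Frame t s s′
  correct (num c) o l E = assign-exec 1 ≤-refl refl
  correct (var i) {Γ} o l E = assign-exec 1 (slot-cost Γ i) (slot-value i E)
  correct (glob i) o l E = assign-exec 1 ≤-refl (globals o (toℕ i) (toℕ<n i))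
  correct (read a e) {t = t} {s} o l E with correct e o l E
  ... | x@(exec r c v m) = seq-exec ≤-refl x
    (assign-exec 2 (s≤s (s≤s (s≤s z≤n))) (cong₂ (λ f → f a) (trans (arrs m) (arrays o)) v))
  correct (e ⊕ e₁) {t = t} {s} o l E with correct e o l E
  ... | x@(exec r c v m)
    with correct e₁ {t = suc t} (ok-after l m o) (m≤n⇒m≤1+n l) (env-after (n≤1+n t) m E)
  ... | y@(exec r₂ c₂ v₂ m₂) = seq-exec ≤-refl x (seq-exec (n≤1+n t) y
    (assign-exec 2 ≤-refl (cong₂ _+_ (trans (regs m₂ t ≤-refl) v) v₂)))
  correct (e ⊖ e₁) {t = t} {s} o l E with correct e o l E
  ... | x@(exec r c v m)
    with correct e₁ {t = suc t} (ok-after l m o) (m≤n⇒m≤1+n l) (env-after (n≤1+n t) m E)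
  ... | y@(exec r₂ c₂ v₂ m₂) = seq-exec ≤-refl x (seq-exec (n≤1+n t) y
    (assign-exec 2 ≤-refl (cong₂ _∸_ (trans (regs m₂ t ≤-refl) v) v₂)))
  correct (ite c a b) {ρ = ρ} {t} {s} o l E with correct c o l E
  ... | x@(exec {s₁} r cc v m) = seq-exec ≤-refl x (branch (eval c ρ) v)
    where
    branch : ∀ z → register s₁ t ≡ z →
      Exec _ s₁ t (choose z (eval a ρ) (eval b ρ)) (suc (1 + suc (κ a + κ b)))
    branch zero z with correct b {t = t} (ok-after l m o) l (env-after ≤-refl m E)
    ... | exec r₂ c₂ v₂ m₂ = exec (cond-false z r₂)
      (+-bound 1 (suc (κ a + κ b)) (2^≤ 1) (widen (m≤n⇒m≤1+n (m≤n+m (κ b) (κ a))) c₂)) v₂ m₂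
    branch (suc _) z with correct a {t = t} (ok-after l m o) l (env-after ≤-refl m E)
    ... | exec r₂ c₂ v₂ m₂ = exec (cond-true (λ z′ → 0≢1+n (trans (sym z′) z)) r₂)
      (+-bound 1 (suc (κ a + κ b)) (2^≤ 1) (widen (m≤n⇒m≤1+n (m≤m+n (κ a) (κ b))) c₂)) v₂ m₂
  correct (fold e b) {Γ} {ρ} {t} {s} o l E with correct e o l E
  ... | x@(exec {s₁} r c v m) = seq-exec ≤-refl x rest
    where
    Inv : State → Set
    Inv s = Ok s × Env Γ ρ t s
    bodyOk : ∀ s i a → Inv s → register s t ≡ a → register s (suc t) ≡ i →
      Exec (compile b (suc t ∷ t ∷ Γ) (2 + t)) s (2 + t) (eval b (i ∷ a ∷ ρ)) (κ b)
    bodyOk s i a (o , E) p q = correct b o (≤-trans l (m≤n+m t 2))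
      ((≤-refl , q) ∷ (m≤n+m (suc t) 1 , p) ∷ env-after (m≤n+m t 2) (frame-refl {s = s}) E)
    open Loop (λ i a → eval b (i ∷ a ∷ ρ)) (eval e ρ) (compile b (suc t ∷ t ∷ Γ) (2 + t)) t (κ b)
      Inv (λ m → λ (o , E) → ok-after l m o , env-after ≤-refl m E) proj₁ bodyOk
    s₂ : State
    s₂ = setRegister (suc t) 0 s₁
    frame₂ : Frame t s₁ s₂
    frame₂ = frame-set (suc t) (n≤1+n t)
    rest : Exec _ s₁ t _ (suc (1 + suc (suc (suc (κ b + 4)) + 2)))
    rest with loop B 0 s₂
                (ok-after l frame₂ (ok-after l m o) , env-after ≤-refl frame₂ (env-after ≤-refl m E))
                (+-identityʳ B) (upd-same (register s₁) (suc t))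
                (trans (upd-other (register s₁) (suc t) t (λ ())) v)
    ... | s′ , τ , run , τ≤ , val , m′ =
      exec (seq assign run)
        (+-bound 1 (suc (suc (suc (κ b + 4)) + 2)) (2^≤ 1) (≤-trans τ≤ (+-bound (suc (suc (κ b + 4))) 2 (*-monoʳ-≤ B
          (+-bound (κ b) 4 ≤-refl (≤-trans (m≤m+n 10 6) (2^≤ 4)))) (2^≤ 2)))) val
        (frame-trans ≤-refl frame₂ m′)
  correct (call f es) {Γ} {ρ} {t} {s} o l E with corrects es o l E
  ... | s₁ , τ , r , τ≤ , E₁ , m
    with correct f {t = length es + t} (ok-after l m o) (≤-trans l (m≤n+m t _)) E₁
  ... | y@(exec r₂ c₂ v₂ m₂)
    with seq-exec (m≤n+m t (length es)) y (assign-exec 1 ≤-refl v₂)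
  ... | exec r₃ c₃ v₃ m₃ = exec (seq r r₃) (+-bound (κs es) _ τ≤ c₃) v₃ (frame-trans ≤-refl m m₃)
  corrects [] {s = s} o l E = s , _ , skip , 1≤B^ 1 , [] , frame-refl
  corrects (e ∷ es) {ρ = ρ} {t} {s} o l E with correct e o l E
  ... | exec r c v m
    with corrects es {t = suc t} (ok-after l m o) (m≤n⇒m≤1+n l) (env-after (n≤1+n t) m E)
  ... | s₂ , τ , r₂ , τ≤ , E₂ , m₂ =
    s₂ , _ , seq r r₂ , +-bound (κ e) (κs es) c τ≤ ,
    (s≤s (m≤n+m t (length es)) , trans (regs m₂ t ≤-refl) v)
      ∷ subst (λ u → Env (consecutiveFrom (suc t) es) (evals es ρ) u s₂) (+-suc (length es) t) E₂ ,
    frame-trans (n≤1+n t) m m₂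

-- Loop bounds

-- Colours are below `2 ^ (r + r)`, so a set of colours is a number below `2 ^ (2 ^ (r + r))`. The
-- parameter `a` leaves room for constant factors and constant powers.
tower : ℕ → ℕ → ℕ
tower a r = 2 ^ (2 ^ (r + r + a))

countdown : ℕ → Program → Program
countdown c P = while (reg c) (P ⨾ c ≔ reg c ⊖ num 1)

-- The body takes the same number `p` of steps in every round and preserves the counter, so the time
-- is exact: the 6 is a test and a decrement, the 2 the last test. The invariant `I` is indexed by
-- the rounds that remain.
countdown-runs : ∀ c P p (I : ℕ → State → Set) →
  (∀ m s → I (suc m) s → register s c ≡ suc m →
    ∃[ s′ ] ⟨ P , s ⟩⇓⟨ s′ , p ⟩ × register s′ c ≡ register s c × I m (setRegister c (register s′ c ∸ 1) s′)) →
  ∀ m s → register s c ≡ m → I m s →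
  ∃[ s′ ] ⟨ countdown c P , s ⟩⇓⟨ s′ , m * (p + 6) + 2 ⟩ × I 0 s′
countdown-runs c P p I body zero s e i = s , while-false e , i
countdown-runs c P p I body (suc m) s e i with body m s i e
... | s′ , run , e′ , i′
  with countdown-runs c P p I body m (setRegister c (register s′ c ∸ 1) s′)
         (trans (upd-same (register s′) c) (cong (_∸ 1) (trans e′ e))) i′
... | s″ , run′ , i″ =
  s″ , subst (λ t → ⟨ countdown c P , s ⟩⇓⟨ s″ , t ⟩) time
         (while-true (λ z → 0≢1+n (trans (sym z) e)) (seq run assign) run′) , i″
  where
  time : 2 + (p + 4) + (m * (p + 6) + 2) ≡ suc m * (p + 6) + 2
  time = trans (sym (+-assoc (2 + (p + 4)) (m * (p + 6)) 2))
    (cong (λ x → x + m * (p + 6) + 2) (trans (+-comm 2 (p + 4)) (+-assoc p 4 2)))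

towerP : ℕ → Program
towerP a =
  6 ≔ reg 2 ⊕ reg 2 ⊕ num a ⨾ 7 ≔ num 1 ⨾ countdown 6 (7 ≔ reg 7 ⊕ reg 7) ⨾
  8 ≔ num 1 ⨾ countdown 7 (8 ≔ reg 8 ⊕ reg 8)

Inputs : State → State → Set
Inputs s s′ = register s′ 0 ≡ register s 0 × register s′ 1 ≡ register s 1 × register s′ 2 ≡ register s 2 ×
  array s′ ≡ array s

double-^ : ∀ x m y → x * 2 ^ suc m ≡ y → (x + x) * 2 ^ m ≡ y
double-^ x m y e = trans (cong (λ z → (x + z) * 2 ^ m) (sym (+-identityʳ x)))
  (trans (cong (_* 2 ^ m) (*-comm 2 x)) (trans (*-assoc x 2 (2 ^ m)) e))

opaque
  towerP-runs : ∀ a s → let e = register s 2 + register s 2 + a in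
    ∃[ s′ ] ⟨ towerP a , s ⟩⇓⟨ s′ , 6 + (2 + (e * 10 + 2 + (2 + (2 ^ e * 10 + 2)))) ⟩ ×
      register s′ 8 ≡ tower a (register s 2) × Inputs s s′
  towerP-runs a s with countdown-runs 6 (7 ≔ reg 7 ⊕ reg 7) 4
      -- With `m` doublings to go, the register times `2 ^ m` already equals the result.
      (λ m s₁ → register s₁ 7 * 2 ^ m ≡ 2 ^ (register s 2 + register s 2 + a) × Inputs s s₁)
      (λ m s₁ (i , k) _ → _ , assign , refl , double-^ (register s₁ 7) m _ i , k)
      (register s 2 + register s 2 + a)
      (setRegister 7 1 (setRegister 6 (register s 2 + register s 2 + a) s)) refl
      (+-identityʳ _ , refl , refl , refl , refl)
  ... | s₁ , run₁ , e₁ , k₁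
    with countdown-runs 7 (8 ≔ reg 8 ⊕ reg 8) 4
      (λ m s₂ → register s₂ 8 * 2 ^ m ≡ tower a (register s 2) × Inputs s s₂)
      (λ m s₂ (i , k) _ → _ , assign , refl , double-^ (register s₂ 8) m _ i , k)
      (2 ^ (register s 2 + register s 2 + a)) (setRegister 8 1 s₁) (trans (sym (*-identityʳ _)) e₁)
      (+-identityʳ _ , k₁)
  ... | s₂ , run₂ , e₂ , k₂ =
    s₂ , seq assign (seq assign (seq run₁ (seq assign run₂))) , trans (sym (*-identityʳ _)) e₂ , k₂

tower-computable : ∀ a → Computable (tower a)
tower-computable a = (2 ≔ reg 0 ⨾ towerP a ⨾ 0 ≔ reg 8) , λ m → go m
  where
  go : ∀ m → ∃[ s ] ∃[ t ] ⟨ 2 ≔ reg 0 ⨾ towerP a ⨾ 0 ≔ reg 8 ,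
    state (initial (m ∷ [])) (λ _ _ → 0) ⟩⇓⟨ s , t ⟩ × output s ≡ tower a m
  go m with towerP-runs a (setRegister 2 m (state (initial (m ∷ [])) (λ _ _ → 0)))
  ... | s , run , e , k = _ , _ , seq assign (seq run assign) , e

multiply : ℕ → Program
multiply j =
  9 ≔ num 0 ⨾ 10 ≔ reg j ⨾ countdown 10 (9 ≔ reg 9 ⊕ reg 8) ⨾ 8 ≔ reg 9

Keep : State → State → Set
Keep s s′ = Inputs s s′ × register s′ 3 ≡ register s 3 × register s′ 4 ≡ register s 4

Multiplies : ℕ → State → ℕ → Set
Multiplies j s x = ∃[ s′ ] ⟨ multiply j , s ⟩⇓⟨ s′ , 2 + (2 + (x * 10 + 2 + 2)) ⟩ ×
    register s′ 8 ≡ x * register s 8 × Keep s s′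

opaque
  multiply-runs : ∀ j s → j < 9 → Multiplies j s (register s j)
  multiply-runs j s j<9 with countdown-runs 10 (9 ≔ reg 9 ⊕ reg 8) 4
      (λ m s₁ → register s₁ 9 + m * register s 8 ≡ register s j * register s 8 × register s₁ 8 ≡ register s 8 × Keep s s₁)
      (λ m s₁ (i , e , k) _ → _ , assign , refl ,
        trans (cong (λ z → register s₁ 9 + z + m * register s 8) e)
          (trans (+-assoc (register s₁ 9) (register s 8) _) i) , e , k)
      (register s j) (setRegister 10 (register s j) (setRegister 9 0 s)) refl
      (refl , refl , (refl , refl , refl , refl) , refl , refl)
  ... | s₁ , run , e , _ , k =
    _ , seq assign (seq (subst (λ v → ⟨ 10 ≔ reg j , setRegister 9 0 s ⟩⇓⟨ setRegister 10 v (setRegister 9 0 s) , 2 ⟩) same assign) (seq run assign)) ,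
    trans (sym (+-identityʳ _)) e , k
    where
    -- Register 9 is cleared before register `j` is read; `j < 9` keeps the two apart.
    same : register (setRegister 9 0 s) j ≡ register s j
    same = upd-other (register s) 9 j λ { refl → <-irrefl refl j<9 }

multiply³ : ℕ → Program
multiply³ zero    = skip
multiply³ (suc m) = multiply 3 ⨾ multiply³ m

opaque
  multiply³-runs : ∀ m s → ∃[ s′ ] ⟨ multiply³ m , s ⟩⇓⟨ s′ , m * (8 + register s 3 * 10) + 1 ⟩ ×
    register s′ 8 ≡ register s 3 ^ m * register s 8 × Keep s s′
  multiply³-runs zero s = s , skip , sym (+-identityʳ _) , (refl , refl , refl , refl) , refl , refl
  multiply³-runs (suc m) s with multiply-runs 3 s (s≤s (s≤s (s≤s (s≤s z≤n))))
  ... | s₁ , r₁ , e₁ , (a₁ , b₁ , c₁ , d₁) , q₁ , n₁ with multiply³-runs m s₁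
  ... | s₂ , r₂ , e₂ , (a₂ , b₂ , c₂ , d₂) , q₂ , n₂ =
    s₂ , subst (λ t → ⟨ multiply³ (suc m) , s ⟩⇓⟨ s₂ , t ⟩) time (seq r₁ r₂) ,
    trans e₂ (trans (cong₂ (λ a b → a ^ m * b) q₁ e₁)
      (trans (sym (*-assoc (Q ^ m) Q _)) (cong (_* register s 8) (*-comm (Q ^ m) Q)))) ,
    (trans a₂ a₁ , trans b₂ b₁ , trans c₂ c₁ , trans d₂ d₁) , trans q₂ q₁ , trans n₂ n₁
    where
    Q : ℕ
    Q = register s 3
    time : 2 + (2 + (Q * 10 + 2 + 2)) + (m * (8 + register s₁ 3 * 10) + 1) ≡ suc m * (8 + Q * 10) + 1
    time = trans (cong (λ x → 4 + (Q * 10 + 2 + 2) + (m * (8 + x * 10) + 1)) q₁)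
      (trans (cong (λ z → 4 + z + (m * (8 + Q * 10) + 1))
        (trans (+-assoc (Q * 10) 2 2) (+-comm (Q * 10) 4)))
      (sym (+-assoc (8 + Q * 10) (m * (8 + Q * 10)) 1)))

-- Registers 3, 4, 5 receive Q = n · tower a r, the number Q ^ 8 of codes of
-- configurations, and the size Q ^ 16 of their adjacency matrix.
prelude : ℕ → Program
prelude a =
  towerP a ⨾ multiply 0 ⨾ 3 ≔ reg 8 ⨾
  multiply³ 7 ⨾ 4 ≔ reg 8 ⨾ multiply³ 8 ⨾ 5 ≔ reg 8

n<2^n : ∀ n → n < 2 ^ n
n<2^n zero    = s≤s z≤n
n<2^n (suc n) = begin-strict
  suc n           ≤⟨ n<2^n n ⟩
  2 ^ n           <⟨ m<m+n (2 ^ n) (m^n>0 2 n) ⟩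
  2 ^ n + 2 ^ n   ≡⟨ cong (2 ^ n +_) (sym (+-identityʳ _)) ⟩
  2 ^ suc n       ∎
  where open ≤-Reasoning

module PreludeTime (Q : ℕ) (2≤Q : 2 ≤ Q) where

  open ≤-Reasoning

  instance
    Q≢0 : NonZero Q
    Q≢0 = >-nonZero (≤-trans (s≤s z≤n) 2≤Q)

  const : ∀ c → c ≤ c * Q
  const c = m≤m*n c Q

  add : ∀ {x y} c d → x ≤ c * Q → y ≤ d * Q → x + y ≤ (c + d) * Q
  add c d p q = ≤-trans (+-mono-≤ p q) (≤-reflexive (sym (*-distribʳ-+ Q c d)))

  scale : ∀ {x} → x ≤ Q → x * 10 ≤ 10 * Q
  scale p = ≤-trans (*-monoˡ-≤ 10 p) (≤-reflexive (*-comm Q 10))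

  powers : ∀ m {x} → x ≤ Q → m * (8 + x * 10) + 1 ≤ (m * 18 + 1) * Q
  powers m p = add (m * 18) 1
    (≤-trans (*-monoʳ-≤ m (add 8 10 (const 8) (scale p))) (≤-reflexive (sym (*-assoc m 18 Q)))) (const 1)

  -- Every part of the prelude takes time linear in `Q`: 34 `Q` for the tower and 296 `Q` for the
  -- products and copies. The sum is absorbed by 330 ≤ 2 ^ 10 ≤ `Q ^ 10`. The result is phrased as a
  -- power of `Q ^ 16` because this is the `B` of the main computation.
  bound : ∀ {e e₁ n x y} → e ≤ Q → e₁ ≤ Q → n ≤ Q → x ≤ Q → y ≤ Q →
    6 + (2 + (e * 10 + 2 + (2 + (e₁ * 10 + 2)))) +
      (2 + (2 + (n * 10 + 2 + 2)) + (2 + ((7 * (8 + x * 10) + 1) + (2 + ((8 * (8 + y * 10) + 1) + 2)))))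
    ≤ (Q ^ 16) ^ 11
  bound {e} {e₁} {n} {x} {y} p p₁ q u v = begin
    _                ≤⟨ add 34 (18 + 278)
                          (add 6 28 (const 6) (add 2 26 (const 2) (add 12 14 (add 10 2 (scale p) (const 2))
                            (add 2 12 (const 2) (add 10 2 (scale p₁) (const 2))))))
                          (add 18 278 (add 2 16 (const 2) (add 2 14 (const 2) (add 12 2 (add 10 2 (scale q) (const 2)) (const 2))))
                            (add 2 276 (const 2) (add 127 149 (powers 7 u)
                              (add 2 147 (const 2) (add 145 2 (powers 8 v) (const 2)))))) ⟩
    330 * Q          ≤⟨ *-monoˡ-≤ Q (m≤m+n 330 694) ⟩
    1024 * Q         ≤⟨ *-monoˡ-≤ Q (^-monoˡ-≤ 10 2≤Q) ⟩
    Q ^ 10 * Q       ≡⟨ *-comm (Q ^ 10) Q ⟩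
    Q ^ 11           ≤⟨ ^-monoˡ-≤ 11 (subst (_≤ Q ^ 16) (*-identityʳ Q) (^-monoʳ-≤ Q {1} {16} (s≤s z≤n))) ⟩
    (Q ^ 16) ^ 11    ∎

opaque
  prelude-runs : ∀ a s Q → 1 ≤ register s 0 → Q ≡ register s 0 * tower a (register s 2) →
    ∃[ s′ ] ∃[ t ] ⟨ prelude a , s ⟩⇓⟨ s′ , t ⟩ × t ≤ (Q ^ 16) ^ 11 ×
      Inputs s s′ × register s′ 3 ≡ Q × register s′ 4 ≡ Q ^ 8 × register s′ 5 ≡ Q ^ 16
  prelude-runs a s Q n≥1 Q≡ with towerP-runs a s
  ... | s₁ , r₁ , e₁ , (a₁ , b₁ , c₁ , d₁) with multiply-runs 0 s₁ (s≤s z≤n)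
  ... | s₂ , r₂ , e₂ , (a₂ , b₂ , c₂ , d₂) , _ with multiply³-runs 7 (setRegister 3 (register s₂ 8) s₂)
  ... | s₃ , r₃ , e₃ , (a₃ , b₃ , c₃ , d₃) , q₃ , _ with multiply³-runs 8 (setRegister 4 (register s₃ 8) s₃)
  ... | s₄ , r₄ , e₄ , (a₄ , b₄ , c₄ , d₄) , q₄ , n₄ =
    _ , _ , seq r₁ (seq r₂ (seq assign (seq r₃ (seq assign (seq r₄ assign))))) ,
    PreludeTime.bound Q 2≤Q {e} {2 ^ e} {register s₁ 0} {register s₂ 8} {register s₃ 3} e≤Q 2^e≤Q (≤-trans (≤-reflexive a₁) n≤Q) (≤-reflexive q₂) (≤-reflexive (trans q₃ q₂)) ,
    (trans a₄ (trans a₃ (trans a₂ a₁)) , trans b₄ (trans b₃ (trans b₂ b₁)) ,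
     trans c₄ (trans c₃ (trans c₂ c₁)) , trans d₄ (trans d₃ (trans d₂ d₁))) ,
    trans q₄ (trans q₃ q₂) , trans n₄ p₃ ,
    trans e₄ (trans (cong₂ (λ x y → x ^ 8 * y) (trans q₃ q₂) p₃) (sym (^-distribˡ-+-* Q 8 8)))
    where
    n : ℕ
    n = register s 0
    e : ℕ
    e = register s 2 + register s 2 + a
    q₂ : register s₂ 8 ≡ Q
    q₂ = trans e₂ (trans (cong₂ _*_ a₁ e₁) (sym Q≡))
    p₃ : register s₃ 8 ≡ Q ^ 8
    p₃ = trans e₃ (trans (cong (λ x → x ^ 7 * x) q₂) (*-comm (Q ^ 7) Q))
    tower≤Q : tower a (register s 2) ≤ Q
    tower≤Q = subst (tower a (register s 2) ≤_) (sym Q≡) (m≤n*m (tower a (register s 2)) n {{>-nonZero n≥1}})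
    2^e≤Q : 2 ^ e ≤ Q
    2^e≤Q = ≤-trans (<⇒≤ (n<2^n (2 ^ e))) tower≤Q
    e≤Q : e ≤ Q
    e≤Q = ≤-trans (<⇒≤ (n<2^n e)) 2^e≤Q
    2≤Q : 2 ≤ Q
    2≤Q = ≤-trans (^-monoʳ-≤ 2 {1} (m^n>0 2 e)) tower≤Q
    n≤Q : n ≤ Q
    n≤Q = subst (n ≤_) (sym Q≡) (m≤m*n n (tower a (register s 2)) {{>-nonZero (m^n>0 2 (2 ^ e))}})

-- Arithmetic, bit vectors and transitive closure

True : ℕ → Set
True zero    = ⊥
True (suc _) = ⊤

¬True⇒≡0 : ∀ {x} → ¬ True x → x ≡ 0
¬True⇒≡0 {zero}  _ = refl
¬True⇒≡0 {suc x} h = ⊥-elim (h tt)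

True? : ∀ x → Dec (True x)
True? zero    = no λ ()
True? (suc _) = yes tt

andᵀ orᵀ leᵀ ltᵀ eqᵀ : Tm → Tm → Tm
andᵀ a b = ite a b (num 0)
orᵀ a b  = ite a (num 1) b
leᵀ a b  = ite (a ⊖ b) (num 0) (num 1)
ltᵀ a b  = b ⊖ a
eqᵀ a b  = andᵀ (leᵀ a b) (leᵀ b a)

notᵀ anyᵀ sumᵀ : Tm → Tm
notᵀ a = ite a (num 0) (num 1)
anyᵀ φ = fold (num 0) (ite (var 1) (num 1) φ)
sumᵀ φ = fold (num 0) (var 1 ⊕ φ)

and⇔ : ∀ {x y} {P Q : Set} → True x ⇔ P → True y ⇔ Q → True (choose x y 0) ⇔ (P × Q)
and⇔ {zero}  p q = mk⇔ (λ ()) (λ (h , _) → from p h)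
and⇔ {suc x} p q = mk⇔ (λ t → to p tt , to q t) (λ (_ , h) → from q h)

or⇔ : ∀ {x y} {P Q : Set} → True x ⇔ P → True y ⇔ Q → True (choose x 1 y) ⇔ (P ⊎ Q)
or⇔ {zero}  p q = mk⇔ (inj₂ ∘ to q) λ { (inj₁ h) → ⊥-elim (from p h) ; (inj₂ h) → from q h }
or⇔ {suc x} p q = mk⇔ (λ _ → inj₁ (to p tt)) (λ _ → tt)

not⇔ : ∀ {x} {P : Set} → True x ⇔ P → True (choose x 0 1) ⇔ (¬ P)
not⇔ {zero}  p = mk⇔ (λ _ h → from p h) (λ _ → tt)
not⇔ {suc x} p = mk⇔ (λ ()) (λ h → h (to p tt))

lt⇔ : ∀ {x y} → True (y ∸ x) ⇔ (x < y)
lt⇔ {x} {y} = mk⇔ f g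
  where
  f : True (y ∸ x) → x < y
  f t with x <? y
  ... | yes p = p
  ... | no ¬p = ⊥-elim (subst True (m≤n⇒m∸n≡0 (≮⇒≥ ¬p)) t)
  g : x < y → True (y ∸ x)
  g p with y ∸ x in eq
  ... | zero  = ⊥-elim (<⇒≱ p (m∸n≡0⇒m≤n eq))
  ... | suc _ = tt

le⇔ : ∀ {x y} → True (choose (x ∸ y) 0 1) ⇔ (x ≤ y)
le⇔ = ⇔-trans (not⇔ lt⇔) (mk⇔ ≮⇒≥ ≤⇒≯)

eq⇔ : ∀ {x y} → True (choose (choose (x ∸ y) 0 1) (choose (y ∸ x) 0 1) 0) ⇔ (x ≡ y)
eq⇔ = ⇔-trans (and⇔ le⇔ le⇔) (mk⇔ (λ (p , q) → ≤-antisym p q) λ { refl → ≤-refl , ≤-refl })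

-- Once a witness is found the body is no longer consulted, so its meaning matters only for
-- accumulator 0.
any⇔ : ∀ m {f : ℕ → ℕ → ℕ} {P : ℕ → Set} → (∀ i → i < m → True (f i 0) ⇔ P i) →
  True (iterate m (λ i a → choose a 1 (f i a)) 0) ⇔ (∃[ i ] i < m × P i)
any⇔ zero h = mk⇔ (λ ()) (λ ())
any⇔ (suc m) {f} {P} h with iterate m (λ i a → choose a 1 (f i a)) 0 | any⇔ m {f} {P} (λ i i<m → h i (m≤n⇒m≤1+n i<m))
... | suc _ | p = mk⇔ (λ _ → let i , i<m , Pi = to p tt in i , m≤n⇒m≤1+n i<m , Pi) (λ _ → tt)
... | zero  | p = mk⇔ (λ t → m , ≤-refl , to (h m ≤-refl) t) g
  where
  g : (∃[ i ] i < suc m × P i) → True (f m 0)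
  g (i , i<sm , Pi) with m≤n⇒m<n∨m≡n (s≤s⁻¹ i<sm)
  ... | inj₁ i<m  = ⊥-elim (from p (i , i<m , Pi))
  ... | inj₂ refl = from (h m ≤-refl) Pi

sum : ℕ → (ℕ → ℕ) → ℕ
sum m f = iterate m (λ i a → a + f i) 0

sum-cong : ∀ m {f g : ℕ → ℕ} → (∀ i → i < m → f i ≡ g i) → sum m f ≡ sum m g
sum-cong zero    h = refl
sum-cong (suc m) h = cong₂ _+_ (sum-cong m (λ i i<m → h i (m≤n⇒m≤1+n i<m))) (h m ≤-refl)

iterate-cong : ∀ m {f g : ℕ → ℕ → ℕ} a → (∀ i b → i < m → f i b ≡ g i b) → iterate m f a ≡ iterate m g a
iterate-cong zero    a h = refl
iterate-cong (suc m) {f} {g} a h =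
  trans (h m _ ≤-refl) (cong (g m) (iterate-cong m a (λ i b i<m → h i b (m≤n⇒m≤1+n i<m))))

bitOf : ℕ → ℕ
bitOf x = choose x 1 0

bitOf≤1 : ∀ x → bitOf x ≤ 1
bitOf≤1 zero    = z≤n
bitOf≤1 (suc x) = ≤-refl

True-bitOf : ∀ {x} → True (bitOf x) ⇔ True x
True-bitOf {zero}  = mk⇔ (λ ()) (λ ())
True-bitOf {suc x} = mk⇔ (λ _ → tt) (λ _ → tt)

val : (ℕ → ℕ) → ℕ → ℕ
val β m = sum m (λ i → β i * 2 ^ i)

val< : ∀ {β} → (∀ i → β i ≤ 1) → ∀ m → val β m < 2 ^ m
val< h zero    = ≤-refl
val< {β} h (suc m) = +-mono-<-≤ (val< h m) (*-monoˡ-≤ (2 ^ m) (h m))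

choose-true : ∀ {x a b} → True x → choose x a b ≡ a
choose-true {suc x} _ = refl

choose-false : ∀ {x a b} → ¬ True x → choose x a b ≡ b
choose-false {zero}  _ = refl
choose-false {suc x} h = ⊥-elim (h tt)

opaque
  mulᵀ divᵀ modᵀ pow2ᵀ lookᵀ : Tm
  mulᵀ  = fold (num 0) (ite (ltᵀ (var 0) (var 2)) (var 1 ⊕ var 3) (var 1))
  divᵀ  = fold (num 0) (ite (leᵀ (call mulᵀ (var 1 ⊕ num 1 ∷ var 3 ∷ [])) (var 2)) (var 1 ⊕ num 1) (var 1))
  modᵀ  = var 0 ⊖ call mulᵀ (call divᵀ (var 0 ∷ var 1 ∷ []) ∷ var 1 ∷ [])
  pow2ᵀ = fold (num 1) (ite (ltᵀ (var 0) (var 2)) (var 1 ⊕ var 1) (var 1))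
  -- Entry var 1 of the bit vector var 0: the powers of 2 above it are
  -- subtracted, from the top, since halving such a number takes too long.
  lookᵀ = leᵀ (call pow2ᵀ (var 1 ∷ [])) (fold (var 0)
            (ite (andᵀ (ltᵀ (var 3) round) (leᵀ (call pow2ᵀ (round ∷ [])) (var 1)))
                 (var 1 ⊖ call pow2ᵀ (round ∷ [])) (var 1)))
    where
    round : Tm
    round = glob (# 5) ⊖ (var 0 ⊕ num 1)

tableᵀ : Tm → Tm
tableᵀ φ = sumᵀ (ite φ (call pow2ᵀ (var 0 ∷ [])) (num 0))

indexᵀ : Tm → Tm → Tm
indexᵀ u v = call mulᵀ (u ∷ glob (# 4) ∷ []) ⊕ v

rowᵀ colᵀ : Tm
rowᵀ = call divᵀ (var 0 ∷ glob (# 4) ∷ [])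
colᵀ = call modᵀ (var 0 ∷ glob (# 4) ∷ [])

-- Warshall's algorithm on the vertices below register 4, for the edges
-- recognised by e.
opaque
  warshallᵀ reachᵀ : Tm → Tm
  warshallᵀ e = fold
    (tableᵀ (orᵀ (eqᵀ rowᵀ colᵀ) (call e (rowᵀ ∷ colᵀ ∷ []))))
    (tableᵀ (orᵀ (call lookᵀ (var 3 ∷ var 0 ∷ []))
      (andᵀ (ltᵀ (var 2) (glob (# 4)))
        (andᵀ (call lookᵀ (var 3 ∷ indexᵀ rowᵀ (var 2) ∷ []))
              (call lookᵀ (var 3 ∷ indexᵀ (var 2) colᵀ ∷ []))))))
  reachᵀ e = call lookᵀ (call (warshallᵀ e) [] ∷ indexᵀ (var 0) (var 1) ∷ [])

-- Correctness of the arithmetic terms and of Warshall's algorithm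

module Arithmetic (g : ℕ → ℕ) (α : ℕ → ℕ → ℕ) where

  open Eval g α

  private
    B N : ℕ
    B = g 5
    N = g 4

  opaque
    unfolding mulᵀ

    mul-eval : ∀ x y → x ≤ B → eval mulᵀ (x ∷ y ∷ []) ≡ x * y
    mul-eval x y = later B
      where
      f : ℕ → ℕ → ℕ
      f i a = choose (x ∸ i) (a + y) a
      early : ∀ m → m ≤ x → iterate m f 0 ≡ m * y
      early zero    _ = refl
      early (suc m) p = trans (choose-true (from lt⇔ p))
        (trans (cong (_+ y) (early m (<⇒≤ p))) (+-comm (m * y) y))
      later : ∀ m → x ≤ m → iterate m f 0 ≡ x * y
      later m p with m≤n⇒m<n∨m≡n p
      ... | inj₂ refl = early m ≤-refl
      later (suc m) p | inj₁ (s≤s q) = trans (choose-false (λ t → <⇒≱ (to lt⇔ t) q)) (later m q)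

    pow2-eval : ∀ x → x ≤ B → eval pow2ᵀ (x ∷ []) ≡ 2 ^ x
    pow2-eval x = later B
      where
      f : ℕ → ℕ → ℕ
      f i a = choose (x ∸ i) (a + a) a
      early : ∀ m → m ≤ x → iterate m f 1 ≡ 2 ^ m
      early zero    _ = refl
      early (suc m) p = trans (choose-true (from lt⇔ p))
        (trans (cong₂ _+_ (early m (<⇒≤ p)) (early m (<⇒≤ p))) (cong (2 ^ m +_) (sym (+-identityʳ _))))
      later : ∀ m → x ≤ m → iterate m f 1 ≡ 2 ^ x
      later m p with m≤n⇒m<n∨m≡n p
      ... | inj₂ refl = early m ≤-refl
      later (suc m) p | inj₁ (s≤s q) = trans (choose-false (λ t → <⇒≱ (to lt⇔ t) q)) (later m q)

    -- The accumulator grows by one per round while the next multiple of `y` still fits, then stays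
    -- at `b`. The bound `b < B` provides enough rounds and keeps the trial factor `b + 1` within
    -- the range of `mulᵀ`.
    div-eval : ∀ b y a → a < y → b < B → eval divᵀ (b * y + a ∷ y ∷ []) ≡ b
    div-eval b y a a<y b<B = later B (<⇒≤ b<B)
      where
      x : ℕ
      x = b * y + a
      f : ℕ → ℕ → ℕ
      f i c = choose (choose (eval mulᵀ (c + 1 ∷ y ∷ []) ∸ x) 0 1) (c + 1) c
      hit : ∀ i c → c < b → f i c ≡ suc c
      hit i c c<b = trans (choose-true (from le⇔ (begin
        eval mulᵀ (c + 1 ∷ y ∷ []) ≡⟨ mul-eval (c + 1) y (subst (_≤ B) (+-comm 1 c) (≤-trans c<b (<⇒≤ b<B))) ⟩
        (c + 1) * y                ≡⟨ cong (_* y) (+-comm c 1) ⟩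
        suc c * y                  ≤⟨ *-monoˡ-≤ y c<b ⟩
        b * y                      ≤⟨ m≤m+n (b * y) a ⟩
        x                          ∎))) (+-comm c 1)
        where open ≤-Reasoning
      miss : ∀ i → f i b ≡ b
      miss i = choose-false λ t → <⇒≱ (begin-strict
        x                          <⟨ +-monoʳ-< (b * y) a<y ⟩
        b * y + y                  ≡⟨ +-comm (b * y) y ⟩
        suc b * y                  ≡⟨ cong (_* y) (+-comm 1 b) ⟩
        (b + 1) * y                ≡⟨ sym (mul-eval (b + 1) y (subst (_≤ B) (+-comm 1 b) b<B)) ⟩
        eval mulᵀ (b + 1 ∷ y ∷ []) ∎) (to le⇔ t)
        where open ≤-Reasoning
      early : ∀ m → m ≤ b → iterate m f 0 ≡ m
      early zero    _ = refl
      early (suc m) p = trans (cong (f m) (early m (<⇒≤ p))) (hit m m p)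
      later : ∀ m → b ≤ m → iterate m f 0 ≡ b
      later m p with m≤n⇒m<n∨m≡n p
      ... | inj₂ refl = early m ≤-refl
      later (suc m) p | inj₁ (s≤s q) = trans (cong (f m) (later m q)) (miss m)

    mod-eval : ∀ b y a → a < y → b < B → eval modᵀ (b * y + a ∷ y ∷ []) ≡ a
    mod-eval b y a a<y b<B = trans (cong (λ c → b * y + a ∸ eval mulᵀ (c ∷ y ∷ [])) (div-eval b y a a<y b<B))
      (trans (cong (b * y + a ∸_) (mul-eval b y (<⇒≤ b<B))) (m+n∸m≡n (b * y) a))

    look-eval : ∀ {β} → (∀ i → β i ≤ 1) → ∀ j → j < B → eval lookᵀ (val β B ∷ j ∷ []) ≡ β j
    look-eval {β} bit j j<B =
      trans (cong₂ (λ x y → choose (x ∸ y) 0 1) (pow2-eval j (<⇒≤ j<B)) inv-end) (top j)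
      where
      top : ∀ j → choose (2 ^ j ∸ val β (suc j)) 0 1 ≡ β j
      top j with β j | bit j | val< bit j
      ... | zero  | _     | v rewrite +-identityʳ (val β j) = choose-true (from lt⇔ v)
      ... | suc zero | s≤s z≤n | v = choose-false {x = 2 ^ j ∸ (val β j + (2 ^ j + 0))}
        (λ t → <⇒≱ (to lt⇔ t) (≤-trans (m≤m+n (2 ^ j) 0) (m≤n+m (2 ^ j + 0) (val β j))))
      round : ℕ → ℕ
      round t = B ∸ (t + 1)
      f : ℕ → ℕ → ℕ
      f t y = choose (choose (round t ∸ j) (choose (eval pow2ᵀ (round t ∷ []) ∸ y) 0 1) 0)
                (y ∸ eval pow2ᵀ (round t ∷ [])) y
      drop : ∀ i → choose (choose (2 ^ i ∸ val β (suc i)) 0 1) (val β (suc i) ∸ 2 ^ i) (val β (suc i)) ≡ val β i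
      drop i with β i | bit i | val< bit i
      ... | zero | _ | v rewrite +-identityʳ (val β i) =
        choose-false (λ t → <⇒≱ v (to le⇔ t))
      ... | suc zero | s≤s z≤n | v rewrite +-identityʳ (2 ^ i) =
        trans (choose-true (from le⇔ (m≤n+m (2 ^ i) (val β i)))) (m+n∸n≡m (val β i) (2 ^ i))
      -- After `t` rounds the digits from `B ∸ t` on have been subtracted, except that digit `j` and
      -- those below it are never touched. What is left in the end is at least `2 ^ j` exactly if
      -- digit `j` is set.
      inv : ∀ t → t ≤ B → iterate t f (val β B) ≡ val β ((B ∸ t) ⊔ suc j)
      inv zero    _ = cong (val β) (sym (m≥n⇒m⊔n≡m j<B))
      inv (suc t) p = trans (cong (f t) (inv t (<⇒≤ p))) step
        where
        i : ℕ
        i = B ∸ suc t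
        r≡i : round t ≡ i
        r≡i = cong (B ∸_) (+-comm t 1)
        B∸t : B ∸ t ≡ suc i
        B∸t = +-∸-assoc 1 p
        step : f t (val β ((B ∸ t) ⊔ suc j)) ≡ val β (i ⊔ suc j)
        step rewrite r≡i | B∸t | pow2-eval i (m∸n≤m B (suc t)) with j <? i
        ... | yes j<i rewrite m≥n⇒m⊔n≡m j<i | m≥n⇒m⊔n≡m (<⇒≤ j<i) =
          trans (cong (λ c → choose c (val β (suc i) ∸ 2 ^ i) (val β (suc i)))
                  (choose-true {x = i ∸ j} (from lt⇔ j<i))) (drop i)
        ... | no j≮i rewrite m≤n⇒m⊔n≡n (≮⇒≥ j≮i) | m≤n⇒m⊔n≡n (m≤n⇒m≤1+n (≮⇒≥ j≮i)) =
          choose-false (λ t → j≮i (proj₁ (to (and⇔ {y = choose (2 ^ i ∸ val β (suc j)) 0 1} (lt⇔ {j} {i}) ⇔-refl) t)))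
      inv-end : iterate B f (val β B) ≡ val β (suc j)
      inv-end = trans (inv B ≤-refl) (cong (λ z → val β (z ⊔ suc j)) (n∸n≡0 B))

  table-eval : ∀ (h : ℕ → ℕ) →
    sum B (λ i → choose (h i) (eval pow2ᵀ (i ∷ [])) 0) ≡ val (bitOf ∘ h) B
  table-eval h = sum-cong B λ i i<B → lem i i<B (h i)
    where
    lem : ∀ i → i < B → ∀ x → choose x (eval pow2ᵀ (i ∷ [])) 0 ≡ bitOf x * 2 ^ i
    lem i i<B zero    = refl
    lem i i<B (suc x) = trans (pow2-eval i (<⇒≤ i<B)) (sym (+-identityʳ _))

  module Closure (e : Tm) (N*N≡B : N * N ≡ B) where

    Edge : ℕ → ℕ → Set
    Edge u v = u < N × v < N × True (eval e (u ∷ v ∷ []))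

    -- Reachability with all intermediate vertices below `m`. The fold makes `B` rounds, more than
    -- there are vertices in general; the condition `m < N` makes the surplus rounds idle.
    R : ℕ → ℕ → ℕ → Set
    R zero    u v = u ≡ v ⊎ True (eval e (u ∷ v ∷ []))
    R (suc m) u v = R m u v ⊎ m < N × R m u m × R m m v

    R-sound : ∀ m {u v} → u < N → v < N → R m u v → Star Edge u v
    R-sound zero    p q (inj₁ refl)          = ε
    R-sound zero    p q (inj₂ t)             = (p , q , t) ◅ ε
    R-sound (suc m) p q (inj₁ r)             = R-sound m p q r
    R-sound (suc m) p q (inj₂ (m<N , r , s)) = R-sound m p m<N r ◅◅ R-sound m m<N q s

    -- If both halves pass through the top vertex `m`, the piece from its visit in the first half to
    -- its visit in the second is cut out. If the halves meet at `m` itself, neither needs `m` in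
    -- its interior.
    R-trans : ∀ m {u x v} → x < m → x < N → R m u x → R m x v → R m u v
    R-trans (suc m) {x = x} p x<N r s with m≤n⇒m<n∨m≡n (s≤s⁻¹ p)
    R-trans (suc m) p x<N (inj₁ r) (inj₁ s) | inj₁ q = inj₁ (R-trans m q x<N r s)
    R-trans (suc m) p x<N (inj₁ r) (inj₂ (l , s , t)) | inj₁ q = inj₂ (l , R-trans m q x<N r s , t)
    R-trans (suc m) p x<N (inj₂ (l , r , s)) (inj₁ t) | inj₁ q = inj₂ (l , r , R-trans m q x<N s t)
    R-trans (suc m) p x<N (inj₂ (l , r , s)) (inj₂ (_ , s′ , t)) | inj₁ q = inj₂ (l , r , t)
    R-trans (suc m) p x<N r s | inj₂ refl = inj₂ (x<N , left r , right s)
      where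
      left : ∀ {u} → R (suc m) u m → R m u m
      left (inj₁ r)           = r
      left (inj₂ (_ , r , _)) = r
      right : ∀ {v} → R (suc m) m v → R m m v
      right (inj₁ r)           = r
      right (inj₂ (_ , _ , r)) = r

    R-base : ∀ m {u v} → R 0 u v → R m u v
    R-base zero    r = r
    R-base (suc m) r = inj₁ (R-base m r)

    N≤B : ∀ {u} → u < N → N ≤ B
    N≤B p = subst (N ≤_) N*N≡B (m≤m*n N N {{>-nonZero (≤-trans (s≤s z≤n) p)}})

    R-complete : ∀ {u v} → Star Edge u v → R B u v
    R-complete ε                     = R-base B (inj₁ refl)
    R-complete ((p , q , t) ◅ steps) =
      R-trans B (≤-trans q (N≤B q)) q (R-base B (inj₂ t)) (R-complete steps)

    index< : ∀ {u v} → u < N → v < N → u * N + v < B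
    index< {u} {v} p q = subst (u * N + v <_) N*N≡B (begin-strict
      u * N + v  <⟨ +-monoʳ-< (u * N) q ⟩
      u * N + N  ≡⟨ +-comm (u * N) N ⟩
      suc u * N  ≤⟨ *-monoˡ-≤ N p ⟩
      N * N      ∎)
      where open ≤-Reasoning

    index-eval : ∀ {u v} → u < N → eval mulᵀ (u ∷ N ∷ []) + v ≡ u * N + v
    index-eval {u} {v} p = cong (_+ v) (mul-eval u N (<⇒≤ (≤-trans p (N≤B p))))

    row-eval : ∀ {u v} → u < N → v < N → eval divᵀ (u * N + v ∷ N ∷ []) ≡ u
    row-eval {u} {v} p q = div-eval u N v q (≤-trans p (N≤B p))

    col-eval : ∀ {u v} → u < N → v < N → eval modᵀ (u * N + v ∷ N ∷ []) ≡ v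
    col-eval {u} {v} p q = mod-eval u N v q (≤-trans p (N≤B p))

    opaque
      unfolding warshallᵀ

      table : ℕ → ℕ
      table m = iterate m (λ i a → eval (tableᵀ (orᵀ (call lookᵀ (var 3 ∷ var 0 ∷ []))
        (andᵀ (ltᵀ (var 2) (glob (# 4)))
          (andᵀ (call lookᵀ (var 3 ∷ indexᵀ rowᵀ (var 2) ∷ []))
                (call lookᵀ (var 3 ∷ indexᵀ (var 2) colᵀ ∷ []))))))
        (i ∷ a ∷ [])) (eval (tableᵀ (orᵀ (eqᵀ rowᵀ colᵀ) (call e (rowᵀ ∷ colᵀ ∷ [])))) [])

      entry : ℕ → ℕ → ℕ
      entry zero    i = choose (choose (choose (r ∸ c) 0 1) (choose (c ∸ r) 0 1) 0) 1 (eval e (r ∷ c ∷ []))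
        where
        r c : ℕ
        r = eval divᵀ (i ∷ N ∷ [])
        c = eval modᵀ (i ∷ N ∷ [])
      entry (suc m) i = choose (eval lookᵀ (table m ∷ i ∷ [])) 1
        (choose (N ∸ m) (choose (eval lookᵀ (table m ∷ eval mulᵀ (eval divᵀ (i ∷ N ∷ []) ∷ N ∷ []) + m ∷ []))
                                (eval lookᵀ (table m ∷ eval mulᵀ (m ∷ N ∷ []) + eval modᵀ (i ∷ N ∷ []) ∷ [])) 0) 0)

      table≡ : ∀ m → table m ≡ val (bitOf ∘ entry m) B
      table≡ zero    = table-eval (entry 0)
      table≡ (suc m) = table-eval (entry (suc m))

      look-table : ∀ m i → i < B → True (eval lookᵀ (table m ∷ i ∷ [])) ⇔ True (entry m i)
      look-table m i i<B rewrite table≡ m | look-eval (λ i → bitOf≤1 (entry m i)) i i<B = True-bitOf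

      entry⇔ : ∀ m {u v} → u < N → v < N → True (entry m (u * N + v)) ⇔ R m u v
      entry⇔ zero {u} {v} p q rewrite row-eval p q | col-eval p q = or⇔ (eq⇔ {u} {v}) ⇔-refl
      entry⇔ (suc m) {u} {v} p q rewrite row-eval p q | col-eval p q =
        or⇔ (⇔-trans (look-table m _ (index< p q)) (entry⇔ m p q)) inner
        where
        inner : True (choose (N ∸ m) (choose (eval lookᵀ (table m ∷ eval mulᵀ (u ∷ N ∷ []) + m ∷ []))
                    (eval lookᵀ (table m ∷ eval mulᵀ (m ∷ N ∷ []) + v ∷ [])) 0) 0) ⇔ (m < N × R m u m × R m m v)
        inner with m <? N
        ... | yes l = and⇔ lt⇔ (and⇔
          (subst (λ z → True (eval lookᵀ (table m ∷ z ∷ [])) ⇔ R m u m) (sym (index-eval p))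
            (⇔-trans (look-table m _ (index< p l)) (entry⇔ m p l)))
          (subst (λ z → True (eval lookᵀ (table m ∷ z ∷ [])) ⇔ R m m v) (sym (index-eval l))
            (⇔-trans (look-table m _ (index< l q)) (entry⇔ m l q))))
        ... | no ¬l = mk⇔ (λ t → ⊥-elim (¬l (to lt⇔ (proj₁ (to (and⇔ {x = N ∸ m} ⇔-refl ⇔-refl) t))))) (λ (l , _) → ⊥-elim (¬l l))

      reach⇔ : ∀ {u v} → u < N → v < N → True (eval (reachᵀ e) (u ∷ v ∷ [])) ⇔ Star Edge u v
      reach⇔ {u} {v} p q =
        ⇔-trans (subst (λ z → True (eval lookᵀ (table B ∷ z ∷ [])) ⇔ True (entry B (u * N + v)))
                  (sym (index-eval p)) (look-table B _ (index< p q)))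
          (⇔-trans (entry⇔ B p q) (mk⇔ (R-sound B p q) R-complete))

-- Finite sums

update≤1 : ∀ {β} c → (∀ i → β i ≤ 1) → ∀ i → (β [ c ↦ 1 ]) i ≤ 1
update≤1 {β} c β≤1 i with c ≟ i
... | yes refl = ≤-reflexive (upd-same β c)
... | no c≢i   = ≤-trans (≤-reflexive (upd-other β c i c≢i)) (β≤1 i)

-- The old value is added on the left, which avoids truncated subtraction.
sum-update : ∀ m f {u a} → u < m → sum m (f [ u ↦ a ]) + f u ≡ sum m f + a
sum-update (suc m) f {u} {a} p with m≤n⇒m<n∨m≡n (s≤s⁻¹ p)
... | inj₁ q = begin
  S + (f [ u ↦ a ]) m + f u   ≡⟨ cong (λ x → S + x + f u) (upd-other f u m (<⇒≢ q)) ⟩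
  S + f m + f u               ≡⟨ +-assoc S (f m) (f u) ⟩
  S + (f m + f u)             ≡⟨ cong (S +_) (+-comm (f m) (f u)) ⟩
  S + (f u + f m)             ≡⟨ sym (+-assoc S (f u) (f m)) ⟩
  S + f u + f m               ≡⟨ cong (_+ f m) (sum-update m f q) ⟩
  sum m f + a + f m           ≡⟨ +-assoc (sum m f) a (f m) ⟩
  sum m f + (a + f m)         ≡⟨ cong (sum m f +_) (+-comm a (f m)) ⟩
  sum m f + (f m + a)         ≡⟨ sym (+-assoc (sum m f) (f m) a) ⟩
  sum m f + f m + a           ∎
  where
  open ≡-Reasoning
  S : ℕ
  S = sum m (f [ u ↦ a ])
... | inj₂ refl = begin
  sum u (f [ u ↦ a ]) + (f [ u ↦ a ]) u + f u
    ≡⟨ cong₂ (λ x y → x + y + f u) (sum-cong u (λ i i<u → upd-other f u i (≢-sym (<⇒≢ i<u)))) (upd-same f u) ⟩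
  sum u f + a + f u     ≡⟨ +-assoc (sum u f) a (f u) ⟩
  sum u f + (a + f u)   ≡⟨ cong (sum u f +_) (+-comm a (f u)) ⟩
  sum u f + (f u + a)   ≡⟨ sym (+-assoc (sum u f) (f u) a) ⟩
  sum u f + f u + a     ∎
  where open ≡-Reasoning

sum-mono : ∀ m {f g : ℕ → ℕ} → (∀ i → f i ≤ g i) → sum m f ≤ sum m g
sum-mono zero    h = z≤n
sum-mono (suc m) h = +-mono-≤ (sum-mono m h) (h m)

sum-const : ∀ m c → sum m (λ _ → c) ≡ m * c
sum-const zero    c = refl
sum-const (suc m) c = trans (cong (_+ c) (sum-const m c)) (+-comm (m * c) c)

sum-zero : ∀ m {f : ℕ → ℕ} → (∀ i → i < m → ¬ True (f i)) → sum m f ≡ 0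
sum-zero m h = trans (sum-cong m {g = λ _ → 0} (λ i i<m → ¬True⇒≡0 (h i i<m))) (trans (sum-const m 0) (*-zeroʳ m))

sum-extend : ∀ {m m′} f → m ≤ m′ → (∀ i → m ≤ i → f i ≡ 0) → sum m′ f ≡ sum m f
sum-extend {m} {m′} f p h with m≤n⇒m<n∨m≡n p
... | inj₂ refl = refl
sum-extend {m} {suc m′} f p h | inj₁ (s≤s q) =
  trans (cong₂ _+_ (sum-extend f q h) (h m′ q)) (+-identityʳ _)

total : (ℕ → ℕ) → List ℕ → ℕ
total f []      = 0
total f (u ∷ U) = f u + total f U

-- For a 0/1 function `f` that marks leaders, `total f U` counts those dealt with and `rest f U`
-- marks those outstanding; `sum-rest` balances the two.
rest : (ℕ → ℕ) → List ℕ → ℕ → ℕ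
rest f []      = f
rest f (u ∷ U) = rest f U [ u ↦ 0 ]

rest-∉ : ∀ f U {i} → i ∉ U → rest f U i ≡ f i
rest-∉ f []      h = refl
rest-∉ f (u ∷ U) h = trans (upd-other (rest f U) u _ λ { refl → h (here refl) }) (rest-∉ f U (h ∘ there))

rest-∈ : ∀ f U {i} → i ∈ U → rest f U i ≡ 0
rest-∈ f (u ∷ U) (here refl) = upd-same (rest f U) u
rest-∈ f (u ∷ U) {i} (there h) with u ≟ i
... | yes refl = upd-same (rest f U) u
... | no u≢i   = trans (upd-other (rest f U) u i u≢i) (rest-∈ f U h)

∈-dec : ∀ i (U : List ℕ) → Dec (i ∈ U)
∈-dec i U = any? (i ≟_) U

rest-true : ∀ f U {i} → True (rest f U i) → i ∉ U × True (f i)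
rest-true f U {i} t with ∈-dec i U
... | yes i∈ = ⊥-elim (subst True (rest-∈ f U i∈) t)
... | no i∉  = i∉ , subst True (rest-∉ f U i∉) t

sum-rest : ∀ m f {U} → Unique U → All (_< m) U → sum m (rest f U) + total f U ≡ sum m f
sum-rest m f []           []       = +-identityʳ _
sum-rest m f {u ∷ U} (u≢ ∷ uniq) (p ∷ ps) = begin
  sum m (rest f U [ u ↦ 0 ]) + (f u + total f U)           ≡⟨ sym (+-assoc (sum m (rest f U [ u ↦ 0 ])) (f u) (total f U)) ⟩
  sum m (rest f U [ u ↦ 0 ]) + f u + total f U
    ≡⟨ cong (λ x → sum m (rest f U [ u ↦ 0 ]) + x + total f U) (sym (rest-∉ f U λ h → All.lookup u≢ h refl)) ⟩
  sum m (rest f U [ u ↦ 0 ]) + rest f U u + total f U      ≡⟨ cong (_+ total f U) (sum-update m (rest f U) p) ⟩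
  sum m (rest f U) + 0 + total f U                         ≡⟨ cong (_+ total f U) (+-identityʳ _) ⟩
  sum m (rest f U) + total f U                             ≡⟨ sum-rest m f uniq ps ⟩
  sum m f                                                  ∎
  where open ≡-Reasoning

-- Induction on `ss`: a member related to a marked index is matched with it and the index is
-- cleared; by injectivity no other marked index relied on that member.
injective-count : ∀ {A : Set} (_~_ : A → ℕ → Set) → (∀ s i → Dec (s ~ i)) → ∀ m ss (f : ℕ → ℕ) →
  (∀ i → f i ≤ 1) → (∀ i → i < m → True (f i) → Any (_~ i) ss) →
  (∀ s i j → i < m → j < m → True (f i) → True (f j) → s ~ i → s ~ j → i ≡ j) → sum m f ≤ length ss
injective-count _~_ dec m []       f f≤1 hit inj =
  ≤-reflexive (sum-zero m (λ i i<m t → case-[] (hit i i<m t)))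
  where
  case-[] : ∀ {i} → ¬ Any (_~ i) []
  case-[] ()
injective-count _~_ dec m (s ∷ ss) f f≤1 hit inj with anyUpTo? (λ i → True? (f i) ×-dec dec s i) m
... | no none = m≤n⇒m≤1+n (injective-count _~_ dec m ss f f≤1
        (λ i i<m t → tail (λ s~i → none (i , i<m , t , s~i)) (hit i i<m t)) inj)
  where
  tail : ∀ {i} → ¬ s ~ i → Any (_~ i) (s ∷ ss) → Any (_~ i) ss
  tail h (here p)  = ⊥-elim (h p)
  tail h (there p) = p
... | yes (j , j<m , t , s~j) = begin
  sum m f                    ≡⟨ sym (+-identityʳ _) ⟩
  sum m f + 0                ≡⟨ sym (sum-update m f j<m) ⟩
  sum m (f [ j ↦ 0 ]) + f j  ≤⟨ +-mono-≤ smaller (f≤1 j) ⟩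
  length ss + 1              ≡⟨ +-comm (length ss) 1 ⟩
  suc (length ss)            ∎
  where
  open ≤-Reasoning
  below : ∀ i → (f [ j ↦ 0 ]) i ≤ f i
  below i with j ≟ i
  ... | yes refl = ≤-trans (≤-reflexive (upd-same f j)) z≤n
  ... | no j≢i   = ≤-reflexive (upd-other f j i j≢i)
  kept : ∀ i → True ((f [ j ↦ 0 ]) i) → j ≢ i × True (f i)
  kept i t with j ≟ i
  ... | yes refl = ⊥-elim (subst True (upd-same f j) t)
  ... | no j≢i   = j≢i , subst True (upd-other f j i j≢i) t
  shift : ∀ i → i < m → True (f i) → j ≢ i → Any (_~ i) (s ∷ ss) → Any (_~ i) ss
  shift i i<m tᵢ j≢i (here p)  = ⊥-elim (j≢i (inj s j i j<m i<m t tᵢ s~j p))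
  shift i i<m tᵢ j≢i (there p) = p
  smaller : sum m (f [ j ↦ 0 ]) ≤ length ss
  smaller = injective-count _~_ dec m ss (f [ j ↦ 0 ]) (λ i → ≤-trans (below i) (f≤1 i))
    (λ i i<m t → let j≢i , tᵢ = kept i t in shift i i<m tᵢ j≢i (hit i i<m tᵢ))
    (λ s i j i<m j<m tᵢ tⱼ → inj s i j i<m j<m (proj₂ (kept i tᵢ)) (proj₂ (kept j tⱼ)))

collect : ∀ {A : Set} (P : ℕ → A → Set) (Q : A → Set) m (f : ℕ → ℕ) →
  (∀ i → i < m → True (f i) → Σ[ a ∈ A ] Q a × P i a) →
  Σ[ as ∈ List A ] length as ≤ sum m f × All Q as × (∀ i → i < m → True (f i) → Any (P i) as)
collect P Q zero    f h = [] , z≤n , [] , λ _ ()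
collect P Q (suc m) f h with collect P Q m f (λ i i<m → h i (m≤n⇒m≤1+n i<m)) | True? (f m)
... | as , l , q , any | no ¬t = as , ≤-trans l (m≤m+n _ (f m)) , q , at
  where
  at : ∀ i → i < suc m → True (f i) → Any (P i) as
  at i i<sm t with m≤n⇒m<n∨m≡n (s≤s⁻¹ i<sm)
  ... | inj₁ i<m  = any i i<m t
  ... | inj₂ refl = ⊥-elim (¬t t)
... | as , l , q , any | yes t with h m ≤-refl t
... | a , qa , pa = a ∷ as , ≤-trans (≤-reflexive (+-comm 1 _)) (+-mono-≤ l (positive t)) , qa ∷ q , at
  where
  positive : ∀ {x} → True x → 1 ≤ x
  positive {suc x} _ = s≤s z≤n
  at : ∀ i → i < suc m → True (f i) → Any (P i) (a ∷ as)
  at i i<sm t with m≤n⇒m<n∨m≡n (s≤s⁻¹ i<sm)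
  ... | inj₁ i<m  = there (any i i<m t)
  ... | inj₂ refl = here pa

-- Binary digits

bits : ℕ → ℕ → ℕ → ℕ
bits zero    v = λ _ → 0
bits (suc m) v with v <? 2 ^ m
... | yes _ = bits m v
... | no _  = bits m (v ∸ 2 ^ m) [ m ↦ 1 ]

bits≤1 : ∀ m v i → bits m v i ≤ 1
bits≤1 zero    v i = z≤n
bits≤1 (suc m) v i with v <? 2 ^ m
... | yes _ = bits≤1 m v i
... | no _  = update≤1 m (bits≤1 m (v ∸ 2 ^ m)) i

bits-beyond : ∀ m v i → m ≤ i → bits m v i ≡ 0
bits-beyond zero    v i p = refl
bits-beyond (suc m) v i p with v <? 2 ^ m
... | yes _ = bits-beyond m v i (<⇒≤ p)
... | no _  = trans (upd-other (bits m (v ∸ 2 ^ m)) m i (<⇒≢ p)) (bits-beyond m (v ∸ 2 ^ m) i (<⇒≤ p))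

val-cong : ∀ {β γ} m → (∀ i → i < m → β i ≡ γ i) → val β m ≡ val γ m
val-cong m h = sum-cong m (λ i i<m → cong (_* 2 ^ i) (h i i<m))

val-extend : ∀ {β m m′} → m ≤ m′ → (∀ i → m ≤ i → β i ≡ 0) → val β m′ ≡ val β m
val-extend p h = sum-extend _ p (λ i q → cong (_* 2 ^ i) (h i q))

val-update : ∀ m {β c} → c < m → β c ≡ 0 → val (β [ c ↦ 1 ]) m ≡ val β m + 2 ^ c
val-update m {β} {c} c<m βc = begin
  val (β [ c ↦ 1 ]) m                       ≡⟨ sum-cong m (λ i _ → entry i) ⟩
  sum m (f [ c ↦ 2 ^ c ])                   ≡⟨ sym (+-identityʳ _) ⟩
  sum m (f [ c ↦ 2 ^ c ]) + 0               ≡⟨ cong (sum m (f [ c ↦ 2 ^ c ]) +_) (cong (_* 2 ^ c) (sym βc)) ⟩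
  sum m (f [ c ↦ 2 ^ c ]) + f c             ≡⟨ sum-update m f c<m ⟩
  val β m + 2 ^ c                           ∎
  where
  open ≡-Reasoning
  f : ℕ → ℕ
  f i = β i * 2 ^ i
  entry : ∀ i → (β [ c ↦ 1 ]) i * 2 ^ i ≡ (f [ c ↦ 2 ^ c ]) i
  entry i with c ≟ i
  ... | yes refl = trans (cong (_* 2 ^ c) (upd-same β c)) (trans (+-identityʳ _) (sym (upd-same f c)))
  ... | no c≢i   = trans (cong (_* 2 ^ i) (upd-other β c i c≢i)) (sym (upd-other f c i c≢i))

val-bits : ∀ m v → v < 2 ^ m → val (bits m v) m ≡ v
val-bits zero    zero p = refl
val-bits zero (suc v) (s≤s ())
val-bits (suc m) v p with v <? 2 ^ m
... | yes q = trans (cong (λ x → val (bits m v) m + x * 2 ^ m) (bits-beyond m v m ≤-refl))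
                (trans (+-identityʳ _) (val-bits m v q))
... | no q  = begin
  val β (suc m)                  ≡⟨ val-update (suc m) ≤-refl (bits-beyond m _ m ≤-refl) ⟩
  val γ (suc m) + 2 ^ m          ≡⟨ cong (_+ 2 ^ m) (val-extend {γ} (n≤1+n m) (bits-beyond m _)) ⟩
  val γ m + 2 ^ m                ≡⟨ cong (_+ 2 ^ m) (val-bits m _ small) ⟩
  v ∸ 2 ^ m + 2 ^ m              ≡⟨ m∸n+n≡m (≮⇒≥ q) ⟩
  v                              ∎
  where
  open ≡-Reasoning
  γ β : ℕ → ℕ
  γ = bits m (v ∸ 2 ^ m)
  β = γ [ m ↦ 1 ]
  small : v ∸ 2 ^ m < 2 ^ m
  small = +-cancelʳ-< (2 ^ m) _ _ (subst₂ _<_ (sym (m∸n+n≡m (≮⇒≥ q))) (cong (2 ^ m +_) (+-identityʳ _)) p)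

-- `L` digits suffice to write the numbers below `n`, while the upper bound keeps the number of
-- masks with `L` digits linear in `n`.
logarithm : ∀ n → 1 ≤ n → ∃[ L ] n ≤ 2 ^ L × 2 ^ L ≤ 2 * n
logarithm (suc zero)    _ = 0 , ≤-refl , s≤s z≤n
logarithm (suc (suc n)) _ with logarithm (suc n) (s≤s z≤n)
... | L , p , q with suc (suc n) ≤? 2 ^ L
...   | yes r = L , r , ≤-trans q (*-monoʳ-≤ 2 (n≤1+n (suc n)))
...   | no r  = suc L , ≤-trans (s≤s p) (+-mono-≤ (m^n>0 2 L) (m≤m+n (2 ^ L) 0)) ,
                *-monoʳ-≤ 2 (m≤n⇒m≤1+n (s≤s⁻¹ (≰⇒> r)))

-- hash β ν m is the number whose digits are the ν i with i < m and β i ≢ 0.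
hash : (ℕ → ℕ) → (ℕ → ℕ) → ℕ → ℕ
hash β ν m = iterate m (λ i a → choose (β i) (a + a + ν i) a) 0

hash-cong : ∀ m {β β′ ν ν′} → (∀ i → i < m → β i ≡ β′ i) → (∀ i → i < m → ν i ≡ ν′ i) →
  hash β ν m ≡ hash β′ ν′ m
hash-cong m h h′ = iterate-cong m 0 (λ i a i<m → cong₂ (λ b n → choose b (a + a + n) a) (h i i<m) (h′ i i<m))

hash-extend : ∀ {β ν m m′} → m ≤ m′ → (∀ i → m ≤ i → β i ≡ 0) → hash β ν m′ ≡ hash β ν m
hash-extend {β} {ν} {m} {m′} p h with m≤n⇒m<n∨m≡n p
... | inj₂ refl = refl
hash-extend {β} {ν} {m} {suc m′} p h | inj₁ (s≤s q) rewrite h m′ q = hash-extend {β} {ν} q h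

double-+-injective : ∀ {x y a b} → a ≤ 1 → b ≤ 1 → x + x + a ≡ y + y + b → x ≡ y × a ≡ b
double-+-injective {zero}  {zero}  _ _ e = refl , e
double-+-injective {zero}  {suc y} {a} {b} p _ e rewrite +-suc y y = ⊥-elim (<⇒≱ (s≤s (s≤s z≤n)) (subst (_≤ 1) e p))
double-+-injective {suc x} {zero}  {a} {b} _ q e rewrite +-suc x x = ⊥-elim (<⇒≱ (s≤s (s≤s z≤n)) (subst (_≤ 1) (sym e) q))
double-+-injective {suc x} {suc y} p q e rewrite +-suc x x | +-suc y y
  with double-+-injective {x} {y} p q (suc-injective (suc-injective e))
... | refl , r = refl , r

Separation : (ℕ → ℕ → ℕ) → ℕ → ℕ → List ℕ → Set
Separation ν L c S = ∃[ β ] (∀ i → β i ≤ 1) × (∀ i → L ≤ i → β i ≡ 0) ×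
  (∀ x y → x ∈ S → y ∈ S → hash β (ν x) L ≡ hash β (ν y) L → ∀ i → i < L → ν x i ≡ ν y i) ×
  (∀ x → x ∈ S → hash β (ν x) L < 2 ^ c)

-- Two elements of S that agree below L but not at L force bit L into the
-- mask; one of them can then be dropped, so the mask has fewer than |S| bits.
separate : ∀ (ν : ℕ → ℕ → ℕ) → (∀ v i → ν v i ≤ 1) → ∀ L c S → length S ≤ c →
  Separation ν L c S
separate ν ν≤1 zero    c S l = (λ _ → 0) , (λ _ → z≤n) , (λ _ _ → refl) , (λ _ _ _ _ _ _ ()) , (λ _ _ → m^n>0 2 c)
separate ν ν≤1 (suc L) c S l with any? (λ x → any? (λ y → agree? x y ×-dec ¬? (ν x L ≟ ν y L)) S) S
  where
  agree? : ∀ x y → Dec (∀ {i} → i < L → ν x i ≡ ν y i)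
  agree? x y = allUpTo? (λ i → ν x i ≟ ν y i) L
... | no none with separate ν ν≤1 L c S l
...   | β , β≤1 , beyond , sep , small = β , β≤1 , (λ i p → beyond i (<⇒≤ p)) , sep′ ,
        λ x x∈S → subst (_< 2 ^ c) (sym (same x)) (small x x∈S)
  where
  same : ∀ x → hash β (ν x) (suc L) ≡ hash β (ν x) L
  same x = hash-extend {β} {ν x} (n≤1+n L) beyond
  sep′ : ∀ x y → x ∈ S → y ∈ S → hash β (ν x) (suc L) ≡ hash β (ν y) (suc L) → ∀ i → i < suc L → ν x i ≡ ν y i
  sep′ x y x∈S y∈S e i i<sL with m≤n⇒m<n∨m≡n (s≤s⁻¹ i<sL) | sep x y x∈S y∈S (trans (sym (same x)) (trans e (same y)))
  ... | inj₁ i<L  | below = below i i<L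
  ... | inj₂ refl | below = decidable-stable (ν x i ≟ ν y i) λ differ →
    none (lose x∈S (lose y∈S ((λ {i} → below i) , differ)))
separate ν ν≤1 (suc L) c S l | yes any with find any
... | x , x∈S , any′ with find any′
... | y , y∈S , agree , differ with ∈-∃++ x∈S
... | S₁ , S₂ , refl = shrink c (≤-trans (≤-reflexive (sym (trans (length-++ S₁) (+-suc _ _)))) l)
  where
  S′ : List ℕ
  S′ = S₁ ++ S₂
  in-S′ : ∀ {z} → z ≢ x → z ∈ S₁ ++ x ∷ S₂ → z ∈ S′
  in-S′ z≢x z∈ with ∈-++⁻ S₁ z∈
  ... | inj₁ h         = ∈-++⁺ˡ h
  ... | inj₂ (here e)  = ⊥-elim (z≢x e)
  ... | inj₂ (there h) = ∈-++⁺ʳ S₁ h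
  -- The dropped element `x` is replaced by `y`, which has the same digits below `L`. Hashes over
  -- these digits therefore take no new values on the full list.
  representative : ∀ z → z ∈ S₁ ++ x ∷ S₂ → ∃[ z′ ] z′ ∈ S′ × (∀ i → i < L → ν z i ≡ ν z′ i)
  representative z z∈ with z ≟ x
  ... | yes refl = y , in-S′ (λ { refl → differ refl }) y∈S , λ i i<L → agree i<L
  ... | no z≢x   = z , in-S′ z≢x z∈ , λ _ _ → refl
  shrink : ∀ c → suc (length S₁ + length S₂) ≤ c → Separation ν (suc L) c (S₁ ++ x ∷ S₂)
  shrink (suc c) (s≤s l) with separate ν ν≤1 L c S′ (≤-trans (≤-reflexive (length-++ S₁)) l)
  ... | β , β≤1 , beyond , sep , small = β′ , update≤1 L β≤1 , beyond′ , sep′ , small′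
    where
    β′ : ℕ → ℕ
    β′ = β [ L ↦ 1 ]
    beyond′ : ∀ i → suc L ≤ i → β′ i ≡ 0
    beyond′ i p = trans (upd-other β L i (<⇒≢ p)) (beyond i (<⇒≤ p))
    step : ∀ z → hash β′ (ν z) (suc L) ≡ hash β (ν z) L + hash β (ν z) L + ν z L
    step z = trans (cong (λ b → choose b (h + h + ν z L) h) (upd-same β L)) (cong (λ x → x + x + ν z L)
      (hash-cong L (λ i i<L → upd-other β L i (≢-sym (<⇒≢ i<L))) (λ _ _ → refl)))
      where
      h : ℕ
      h = hash β′ (ν z) L
    sep′ : ∀ a b → a ∈ S₁ ++ x ∷ S₂ → b ∈ S₁ ++ x ∷ S₂ →
      hash β′ (ν a) (suc L) ≡ hash β′ (ν b) (suc L) → ∀ i → i < suc L → ν a i ≡ ν b i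
    sep′ a b a∈ b∈ e i i<sL
      with double-+-injective (ν≤1 a L) (ν≤1 b L) (trans (sym (step a)) (trans e (step b)))
         | representative a a∈ | representative b b∈ | m≤n⇒m<n∨m≡n (s≤s⁻¹ i<sL)
    ... | _ , top | _ | _ | inj₂ refl = top
    ... | eq , _ | a′ , a′∈ , aa | b′ , b′∈ , bb | inj₁ i<L =
      trans (aa i i<L) (trans (sep a′ b′ a′∈ b′∈
        (trans (sym (hash-cong L (λ _ _ → refl) aa)) (trans eq (hash-cong L (λ _ _ → refl) bb))) i i<L)
        (sym (bb i i<L)))
    small′ : ∀ a → a ∈ S₁ ++ x ∷ S₂ → hash β′ (ν a) (suc L) < 2 ^ suc c
    small′ a a∈ with representative a a∈
    ... | a′ , a′∈ , aa = begin-strict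
      hash β′ (ν a) (suc L)  ≡⟨ step a ⟩
      h + h + ν a L          ≤⟨ +-monoʳ-≤ (h + h) (ν≤1 a L) ⟩
      h + h + 1              ≡⟨ +-assoc h h 1 ⟩
      h + (h + 1)            ≡⟨ cong (h +_) (+-comm h 1) ⟩
      h + suc h              <⟨ +-mono-<-≤ h< h< ⟩
      2 ^ c + 2 ^ c          ≡⟨ cong (2 ^ c +_) (sym (+-identityʳ _)) ⟩
      2 ^ suc c              ∎
      where
      open ≤-Reasoning
      h : ℕ
      h = hash β (ν a) L
      h< : h < 2 ^ c
      h< = subst (_< 2 ^ c) (sym (hash-cong L (λ _ _ → refl) aa)) (small a′ a′∈)

-- Colours computed by the program

opaque
  hashᵀ : Tm
  hashᵀ = fold (num 0) (ite (call lookᵀ (var 2 ∷ var 0 ∷ []))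
    (var 1 ⊕ var 1 ⊕ call lookᵀ (var 3 ∷ var 0 ∷ [])) (var 1))

module Colours (g : ℕ → ℕ) (α : ℕ → ℕ → ℕ) where

  open Eval g α
  open Arithmetic g α

  private
    B : ℕ
    B = g 5

  colour : ℕ → ℕ → ℕ
  colour b v = eval hashᵀ (b ∷ v ∷ [])

  opaque
    unfolding hashᵀ

    hash-eval : ∀ {β ν} → (∀ i → β i ≤ 1) → (∀ i → ν i ≤ 1) → colour (val β B) (val ν B) ≡ hash β ν B
    hash-eval b n = iterate-cong B 0 (λ i a i<B →
      cong₂ (λ x y → choose x (a + a + y) a) (look-eval b i i<B) (look-eval n i i<B))

  -- The program scans `B` digits, but mask and members of `S` vanish from digit `L` on. So the
  -- computed colour is the hash over `L` digits, to which `separate` applies, and the mask is below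
  -- `2 ^ L`.
  separating-mask : ∀ n c S → 1 ≤ n → 2 * n ≤ B → All (_< n) S → length S ≤ c →
    ∃[ b ] b < 2 * n ×
      (∀ x y → x ∈ S → y ∈ S → colour b x ≡ colour b y → x ≡ y) × (∀ x → x ∈ S → colour b x < 2 ^ c)
  separating-mask n c S n≥1 2n≤B S<n l with logarithm n n≥1
  ... | L , n≤2^L , 2^L≤2n with separate (bits L) (bits≤1 L) L c S l
  ... | β , β≤1 , beyond , sep , small =
    val β B , subst (_< 2 * n) (sym (val-extend {β} L≤B beyond)) (≤-trans (val< β≤1 L) 2^L≤2n) ,
    (λ x y x∈S y∈S e → trans (sym (value x∈S)) (trans (val-cong L (sep x y x∈S y∈S
      (trans (sym (as-hash x∈S)) (trans e (as-hash y∈S))))) (value y∈S))) ,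
    λ x x∈S → subst (_< 2 ^ c) (sym (as-hash x∈S)) (small x x∈S)
    where
    L≤B : L ≤ B
    L≤B = ≤-trans (<⇒≤ (n<2^n L)) (≤-trans 2^L≤2n 2n≤B)
    value : ∀ {x} → x ∈ S → val (bits L x) L ≡ x
    value x∈S = val-bits L _ (≤-trans (All.lookup S<n x∈S) n≤2^L)
    as-hash : ∀ {x} → x ∈ S → colour (val β B) x ≡ hash β (bits L x) L
    as-hash {x} x∈S = trans (cong (colour (val β B)) (sym (trans (val-extend {bits L x} L≤B (bits-beyond L x)) (value x∈S))))
      (trans (hash-eval β≤1 (bits≤1 L x)) (hash-extend {β} {bits L x} L≤B beyond))

-- Walks and covers

module Paths (n : ℕ) (A : ℕ → ℕ → Set) (A-sym : ∀ {u v} → A u v → A v u)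
             (A<n : ∀ {u v} → A u v → u < n × v < n)
             (wt : ℕ → ℕ → ℕ) (wt-sym : ∀ {u v} → A u v → wt u v ≡ wt v u) where

  data Path : ℕ → ℕ → Set where
    [_] : ∀ {u} → u < n → Path u u
    _∷_ : ∀ {u v x} → A u v → Path v x → Path u x

  path-weight : ∀ {u v} → Path u v → ℕ
  path-weight [ _ ]                   = 0
  path-weight (_∷_ {u} {v} _ p) = wt u v + path-weight p

  verts : ∀ {u v} → Path u v → List ℕ
  verts ([_] {u} _)   = u ∷ []
  verts (_∷_ {u} _ p) = u ∷ verts p

  start∈ : ∀ {u v} (p : Path u v) → u ∈ verts p
  start∈ [ _ ]   = here refl
  start∈ (_ ∷ _) = here refl

  end∈ : ∀ {u v} (p : Path u v) → v ∈ verts p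
  end∈ [ _ ]   = here refl
  end∈ (_ ∷ p) = there (end∈ p)

  verts<n : ∀ {u v x} (p : Path u v) → x ∈ verts p → x < n
  verts<n [ l ]   (here refl) = l
  verts<n (a ∷ p) (here refl) = proj₁ (A<n a)
  verts<n (a ∷ p) (there h)   = verts<n p h

  infixr 5 _⟫_
  _⟫_ : ∀ {u v x} → Path u v → Path v x → Path u x
  [ _ ]   ⟫ q = q
  (a ∷ p) ⟫ q = a ∷ (p ⟫ q)

  ⟫-weight : ∀ {u v x} (p : Path u v) (q : Path v x) → path-weight (p ⟫ q) ≡ path-weight p + path-weight q
  ⟫-weight [ _ ]   q = refl
  ⟫-weight (_∷_ {u} {v} a p) q = trans (cong (wt u v +_) (⟫-weight p q)) (sym (+-assoc (wt u v) _ _))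

  ∈-⟫ˡ : ∀ {u v x y} (p : Path u v) (q : Path v x) → y ∈ verts p → y ∈ verts (p ⟫ q)
  ∈-⟫ˡ [ _ ]   q (here refl) = start∈ q
  ∈-⟫ˡ (a ∷ p) q (here e)    = here e
  ∈-⟫ˡ (a ∷ p) q (there h)   = there (∈-⟫ˡ p q h)

  ∈-⟫ʳ : ∀ {u v x y} (p : Path u v) (q : Path v x) → y ∈ verts q → y ∈ verts (p ⟫ q)
  ∈-⟫ʳ [ _ ]   q h = h
  ∈-⟫ʳ (a ∷ p) q h = there (∈-⟫ʳ p q h)

  reverse : ∀ {u v} → Path u v → Path v u
  reverse [ l ]   = [ l ]
  reverse (a ∷ p) = reverse p ⟫ (A-sym a ∷ [ proj₁ (A<n a) ])

  reverse-weight : ∀ {u v} (p : Path u v) → path-weight (reverse p) ≡ path-weight p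
  reverse-weight [ l ] = refl
  reverse-weight (_∷_ {u} {v} a p) = trans (⟫-weight (reverse p) _)
    (trans (cong₂ _+_ (reverse-weight p) (trans (+-identityʳ _) (sym (wt-sym a)))) (+-comm (path-weight p) (wt u v)))

  Zero : ℕ → ℕ → Set
  Zero u v = Σ[ p ∈ Path u v ] path-weight p ≡ 0

  zero-refl : ∀ {u} → u < n → Zero u u
  zero-refl l = [ l ] , refl

  zero-sym : ∀ {u v} → Zero u v → Zero v u
  zero-sym (p , z) = reverse p , trans (reverse-weight p) z

  zero-trans : ∀ {u v x} → Zero u v → Zero v x → Zero u x
  zero-trans (p , z) (q , z′) = p ⟫ q , trans (⟫-weight p q) (cong₂ _+_ z z′)

  ZeroEdge : ℕ → ℕ → Set
  ZeroEdge u v = A u v × wt u v ≡ 0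

  zero⇔star : ∀ {u v} → u < n → Zero u v ⇔ Star ZeroEdge u v
  zero⇔star l = mk⇔ (uncurry star) (path l)
    where
    star : ∀ {u v} (p : Path u v) → path-weight p ≡ 0 → Star ZeroEdge u v
    star [ _ ] _ = ε
    star (_∷_ {u} {v} a p) z = (a , m+n≡0⇒m≡0 (wt u v) z) ◅ star p (m+n≡0⇒n≡0 (wt u v) z)
    path : ∀ {u v} → u < n → Star ZeroEdge u v → Zero u v
    path l ε             = zero-refl l
    path l ((a , z) ◅ s) = let p , z′ = path (proj₂ (A<n a)) s in a ∷ p , cong₂ _+_ z z′

  module Covers (Dep Cli : ℕ → Set) (Dep<n : ∀ {s} → Dep s → s < n) (Cli<n : ∀ {c} → Cli c → c < n)
                (k r : ℕ) where

    record Tour : Set where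
      constructor tour
      field
        {depot} : ℕ
        isDepot : Dep depot
        path    : Path depot depot

    open Tour public

    tour-weight : Tour → ℕ
    tour-weight t = path-weight (path t)

    total-weight : List Tour → ℕ
    total-weight []       = 0
    total-weight (t ∷ ts) = tour-weight t + total-weight ts

    Meets : ℕ → Tour → Set
    Meets c t = Any (λ x → Zero x c) (verts (path t))

    -- A routing up to free detours: a tour only has to touch the class of a client. Thus serving a
    -- leader serves its whole class, and the detours are inserted once, by `expand`.
    record Cover : Set where
      constructor cover
      field
        tours  : List Tour
        few    : length tours ≤ k
        light  : total-weight tours ≤ r
        meets  : ∀ c → Cli c → Any (Meets c) tours

    module Expand (Zero? : ∀ u v → Dec (Zero u v)) where

      -- Each equivalent vertex is reached by a path of weight zero and left again along its
      -- reverse.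
      detour : ∀ {x} → x < n → ∀ m → m ≤ n →
        Σ[ p ∈ Path x x ] path-weight p ≡ 0 × (∀ c → c < m → Zero x c → c ∈ verts p)
      detour l zero    _ = [ l ] , refl , λ _ ()
      detour {x} l (suc m) m<n with detour l m (<⇒≤ m<n) | Zero? x m
      ... | p , z , all | no ¬z = p , z , all′
        where
        all′ : ∀ c → c < suc m → Zero x c → c ∈ verts p
        all′ c c<sm zc with m≤n⇒m<n∨m≡n (s≤s⁻¹ c<sm)
        ... | inj₁ c<m  = all c c<m zc
        ... | inj₂ refl = ⊥-elim (¬z zc)
      ... | p , z , all | yes (q , w) = p ⟫ q ⟫ reverse q ,
            trans (⟫-weight p _) (cong₂ _+_ z (trans (⟫-weight q _) (cong₂ _+_ w (trans (reverse-weight q) w)))) , all′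
        where
        all′ : ∀ c → c < suc m → Zero x c → c ∈ verts (p ⟫ q ⟫ reverse q)
        all′ c c<sm zc with m≤n⇒m<n∨m≡n (s≤s⁻¹ c<sm)
        ... | inj₁ c<m  = ∈-⟫ˡ p _ (all c c<m zc)
        ... | inj₂ refl = ∈-⟫ʳ p _ (∈-⟫ˡ q _ (end∈ q))

      expand : ∀ {u v} (p : Path u v) → Σ[ q ∈ Path u v ] path-weight q ≡ path-weight p ×
        (∀ c → c < n → Any (λ x → Zero x c) (verts p) → c ∈ verts q)
      expand [ l ] with detour l n ≤-refl
      ... | q , z , all = q , z , λ { c c<n (here zc) → all c c<n zc }
      expand (a ∷ p) with detour (proj₁ (A<n a)) n ≤-refl | expand p
      ... | q , z , all | q′ , w , all′ = q ⟫ (a ∷ q′) ,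
            trans (⟫-weight q _) (cong₂ _+_ z (cong (wt _ _ +_) w)) , λ where
              c c<n (here zc) → ∈-⟫ˡ q _ (all c c<n zc)
              c c<n (there h) → ∈-⟫ʳ q _ (there (all′ c c<n h))

-- From routings to covers on natural numbers and back

vector-lookup : ∀ {m} (f : Fin m → ℕ) i → vector f (toℕ i) ≡ f i
vector-lookup f zero    = refl
vector-lookup f (suc i) = vector-lookup (λ j → f (suc j)) i

vector-< : ∀ {m} (f : Fin m → ℕ) i → True (vector f i) → i < m
vector-< {suc m} f zero    t = s≤s z≤n
vector-< {suc m} f (suc i) t = s≤s (vector-< (λ j → f (suc j)) i t)

matrix-lookup : ∀ {m} (f : Fin m → Fin m → ℕ) u v → matrix f (m * toℕ u + toℕ v) ≡ f u v
matrix-lookup {m} f u v =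
  trans (cong (matrix f) (sym (toℕ-combine u v)))
    (trans (vector-lookup _ (combine u v)) (cong (uncurry f) (remQuot-combine u v)))

True-bit : ∀ {b} → True (bit b) ⇔ T b
True-bit {false} = mk⇔ (λ ()) (λ ())
True-bit {true}  = mk⇔ (λ _ → tt) (λ _ → tt)

last-∷ : ∀ {X : Set} (x y : X) ys → List⁺.last (x ∷ (y ∷ ys)) ≡ List⁺.last (y ∷ ys)
last-∷ x y ys with List.initLast ys
... | []             = refl
... | _ List.∷ʳ′ _ = refl

module Routes (I : Instance) where

  open Instance I hiding (sym)

  adjacency weights depots clients : ℕ → ℕ
  adjacency = matrix (λ u v → bit (adj u v))
  weights   = matrix w
  depots    = vector (λ v → bit (Vec.lookup D v))
  clients   = vector (λ v → bit (Vec.lookup C v))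

  -- The bounds belong to the relation because with `v ≥ n` the index `n * u + v` would point into
  -- another row of the matrix.
  A : ℕ → ℕ → Set
  A u v = u < n × v < n × True (adjacency (n * u + v))

  wt : ℕ → ℕ → ℕ
  wt u v = weights (n * u + v)

  adj⇒A : ∀ u v → Adj u v → A (toℕ u) (toℕ v)
  adj⇒A u v a = toℕ<n u , toℕ<n v , subst True (sym (matrix-lookup _ u v)) (from True-bit a)

  A⇒adj : ∀ u v → A (toℕ u) (toℕ v) → Adj u v
  A⇒adj u v (_ , _ , t) = to True-bit (subst True (matrix-lookup _ u v) t)

  wt≡w : ∀ u v → wt (toℕ u) (toℕ v) ≡ w u v
  wt≡w = matrix-lookup w

  -- A view: matching on it replaces a number below `n` by `toℕ x` wherever it occurs.
  data Vertex : ℕ → Set where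
    vertex : (x : Fin n) → Vertex (toℕ x)

  asVertex : ∀ {u} → u < n → Vertex u
  asVertex l = subst Vertex (toℕ-fromℕ< l) (vertex (fromℕ< l))

  A-sym : ∀ {u v} → A u v → A v u
  A-sym a@(p , q , _) with asVertex p | asVertex q
  ... | vertex x | vertex y = adj⇒A y x (Graph.sym G x y (A⇒adj x y a))

  wt-sym : ∀ {u v} → A u v → wt u v ≡ wt v u
  wt-sym (p , q , _) with asVertex p | asVertex q
  ... | vertex x | vertex y = trans (wt≡w x y) (trans (w-sym x y) (sym (wt≡w y x)))

  open Paths n A A-sym (λ (p , q , _) → p , q) wt wt-sym public

  IsDepot IsClient : ℕ → Set
  IsDepot v  = True (depots v)
  IsClient v = True (clients v)

  ∈⇒True : ∀ {S : Subset n} {v} → v ∈ₛ S → True (vector (λ v → bit (Vec.lookup S v)) (toℕ v))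
  ∈⇒True {S} {v} h = subst True (sym (vector-lookup _ v)) (subst (True ∘ bit) (sym ([]=⇒lookup h)) tt)

  True⇒∈ : ∀ {S : Subset n} {v} → True (vector (λ v → bit (Vec.lookup S v)) (toℕ v)) → v ∈ₛ S
  True⇒∈ {S} {v} t with Vec.lookup S v in eq | subst True (vector-lookup _ v) t
  ... | true | _ = lookup⇒[]= v S eq

  depot<n : ∀ {s} → IsDepot s → s < n
  depot<n {s} = vector-< _ s

  client<n : ∀ {c} → IsClient c → c < n
  client<n {c} = vector-< _ c

  module Conversion (r : ℕ) where

    open Covers IsDepot IsClient depot<n client<n k r

    walk⇒path : ∀ x xs → Linked Adj (x ∷ xs) →
      Σ[ p ∈ Path (toℕ x) (toℕ (List⁺.last (x ∷ xs))) ]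
        path-weight p ≡ listWeight (x ∷ xs) × (∀ {y} → y ∈ x ∷ xs → toℕ y ∈ verts p)
    walk⇒path x []       _       = [ toℕ<n x ] , refl , λ { (here refl) → here refl }
    walk⇒path x (y ∷ ys) (a ∷ l) with walk⇒path y ys l
    ... | p , e , h rewrite last-∷ x y ys =
      adj⇒A x y a ∷ p , cong₂ _+_ (wt≡w x y) e , λ { (here refl) → here refl ; (there m) → there (h m) }

    path⇒walk : ∀ {u v} (p : Path u v) (x : Fin n) → toℕ x ≡ u →
      Σ[ xs ∈ List (Fin n) ] Linked Adj (x ∷ xs) × toℕ (List⁺.last (x ∷ xs)) ≡ v ×
        listWeight (x ∷ xs) ≡ path-weight p × (∀ y → toℕ y ∈ verts p → y ∈ x ∷ xs)
    path⇒walk [ _ ] x refl = [] , [-] , refl , refl , λ { y (here e) → here (toℕ-injective e) }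
    path⇒walk (a@(_ , l , _) ∷ p) x refl with asVertex l
    ... | vertex y with path⇒walk p y refl
    ...   | ys , linked , e , e′ , h =
      y ∷ ys , A⇒adj x y a ∷ linked , trans (cong toℕ (last-∷ x y ys)) e , cong₂ _+_ (sym (wt≡w x y)) e′ ,
      λ { z (here q) → here (toℕ-injective q) ; z (there m) → there (h z m) }

    close : ∀ {u v} (p : Path u v) → u ≡ v → Σ[ q ∈ Path u u ] path-weight q ≡ path-weight p × verts q ≡ verts p
    close p refl = p , refl , refl

    walk⇒tour : (p : Walk) → Closed p → start p ∈ₛ D →
      Σ[ t ∈ Tour ] tour-weight t ≡ walkWeight p × (∀ c → c ∈ʷ p → Meets (toℕ c) t)
    walk⇒tour record { vertices = x ∷ xs ; consecutive = l } cl d with walk⇒path x xs l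
    ... | p , e , h with close p (cong toℕ cl)
    ... | q , e′ , v = tour (∈⇒True d) q , trans e′ e ,
      λ c m → lose (subst (toℕ c ∈_) (sym v) (h m)) (zero-refl (toℕ<n c))

    routing⇒cover : (R : Routing) → weight R ≤ r → Cover
    routing⇒cover R w≤r = cover (List.tabulate (proj₁ ∘ route))
      (≤-trans (≤-reflexive (length-tabulate (proj₁ ∘ route))) k′≤k)
      (≤-trans (≤-reflexive (sum-weights walks (proj₁ ∘ route) (proj₁ ∘ proj₂ ∘ route))) w≤r)
      λ c t → meet c t (client<n t)
      where
      open Routing R renaming (depots to startsAtDepot; assign to vehicle)
      route : ∀ i → _
      route i = walk⇒tour (Vec.lookup walks i) (closed i) (startsAtDepot i)
      sum-weights : ∀ {m} (ws : Vec Walk m) (T : Fin m → Tour) →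
        (∀ i → tour-weight (T i) ≡ walkWeight (Vec.lookup ws i)) →
        total-weight (List.tabulate T) ≡ Vec.sum (Vec.map walkWeight ws)
      sum-weights []       T h = refl
      sum-weights (x ∷ ws) T h = cong₂ _+_ (h zero) (sum-weights ws (T ∘ suc) (h ∘ suc))
      meet : ∀ c → IsClient c → c < n → Any (Meets c) (List.tabulate (proj₁ ∘ route))
      meet c t l with asVertex l
      ... | vertex x = tabulate⁺ (vehicle x (True⇒∈ t)) (proj₂ (proj₂ (route (vehicle x (True⇒∈ t)))) x (served x (True⇒∈ t)))

    module _ (Zero? : ∀ u v → Dec (Zero u v)) where

      open Expand Zero?

      tour⇒walk : (t : Tour) → Σ[ p ∈ Walk ] walkWeight p ≡ tour-weight t × Closed p × start p ∈ₛ D ×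
        (∀ c → Meets (toℕ c) t → c ∈ʷ p)
      tour⇒walk (tour d p) with asVertex (depot<n d)
      ... | vertex x with expand p
      ... | q , e , h with path⇒walk q x refl
      ... | xs , linked , last , e′ , h′ =
        record { vertices = x ∷ xs ; consecutive = linked } , trans e′ e , toℕ-injective (sym last) , True⇒∈ d ,
        λ c m → h′ c (h (toℕ c) (toℕ<n c) m)

      cover⇒routing : Cover → Σ[ R ∈ Routing ] weight R ≤ r
      cover⇒routing (cover ts few light meets) = record
        { k′ = length ts
        ; k′≤k = few
        ; walks = Vec.tabulate walkOf
        ; assign = λ c c∈C → Any.index (met c c∈C)
        ; depots = λ i → at i (λ p → start p ∈ₛ D) (proj₁ (proj₂ (proj₂ (proj₂ (tour⇒walk (List.lookup ts i))))))
        ; served = λ c c∈C → at (Any.index (met c c∈C)) (c ∈ʷ_)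
            (proj₂ (proj₂ (proj₂ (proj₂ (tour⇒walk (List.lookup ts (Any.index (met c c∈C))))))) c (lookup-index (met c c∈C)))
        ; closed = λ i → at i Closed (proj₁ (proj₂ (proj₂ (tour⇒walk (List.lookup ts i)))))
        } , ≤-trans (≤-reflexive (sum-weights ts)) light
        where
        met : ∀ c → c ∈ₛ C → Any (Meets (toℕ c)) ts
        met c c∈C = meets (toℕ c) (∈⇒True c∈C)
        walkOf : Fin (length ts) → Walk
        walkOf i = proj₁ (tour⇒walk (List.lookup ts i))
        at : ∀ i (P : Walk → Set) → P (walkOf i) → P (Vec.lookup (Vec.tabulate walkOf) i)
        at i P = subst P (sym (lookup∘tabulate walkOf i))
        sum-weights : ∀ ts → Vec.sum (Vec.map walkWeight (Vec.tabulate λ i → proj₁ (tour⇒walk (List.lookup ts i)))) ≡ total-weight ts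
        sum-weights []       = refl
        sum-weights (t ∷ ts) = cong₂ _+_ (proj₁ (proj₂ (tour⇒walk t))) (sum-weights ts)

-- Configurations

term≤sum : ∀ m {i} f → i < m → f i ≤ sum m f
term≤sum (suc m) {i} f p with m≤n⇒m<n∨m≡n (s≤s⁻¹ p)
... | inj₁ q    = ≤-trans (term≤sum m f q) (m≤m+n _ (f m))
... | inj₂ refl = m≤n+m (f i) (sum i f)

True⇒≥1 : ∀ {x} → True x → 1 ≤ x
True⇒≥1 {suc x} _ = s≤s z≤n

-- Of the visited leaders only the colours are stored, together with their numbers `xs` (with a
-- depot in the class) and `ys` (without); storing the leaders themselves would take too many
-- configurations. `closed` counts the finished walks, not the current one.
record Config : Set where
  constructor config
  field mask-number colour-set origin position spent closed xs ys : ℕ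

-- Leaders of the zero-weight classes

module Leaders (I : Instance) where

  open Instance I using (n; k)
  open Routes I

  Leader : ℕ → Set
  Leader ℓ = IsClient ℓ × (∀ c → c < ℓ → IsClient c → ¬ Zero c ℓ)

  NearDepot : ℕ → Set
  NearDepot ℓ = ∃[ d ] IsDepot d × Zero d ℓ

  leader-unique : ∀ {a b} → Leader a → Leader b → Zero a b → a ≡ b
  leader-unique {a} {b} (ca , la) (cb , lb) z with <-cmp a b
  ... | tri< a<b _ _ = ⊥-elim (lb a a<b ca z)
  ... | tri≈ _ e _   = e
  ... | tri> _ _ b<a = ⊥-elim (la b b<a cb (zero-sym z))

  module _ (Zero? : ∀ u v → Dec (Zero u v)) where

    leader-of : ∀ {c} → IsClient c → ∃[ ℓ ] Leader ℓ × Zero ℓ c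
    leader-of {c} t = go (suc c) c ≤-refl t
      where
      -- Descends to smaller and smaller equivalent clients; `m` bounds the number of descents.
      go : ∀ m c → c < m → IsClient c → ∃[ ℓ ] Leader ℓ × Zero ℓ c
      go (suc m) c c<m t with anyUpTo? (λ c′ → True? (clients c′) ×-dec Zero? c′ c) c
      ... | no none = c , (t , λ c′ l t′ z → none (c′ , l , t′ , z)) , zero-refl (client<n t)
      ... | yes (c′ , l , t′ , z) with go m c′ (≤-trans l (s≤s⁻¹ c<m)) t′
      ...   | ℓ , lead , z′ = ℓ , lead , zero-trans z′ z

    near-leader? : ∀ v → Dec (∃[ ℓ ] Leader ℓ × Zero v ℓ)
    near-leader? v with anyUpTo? (λ c → True? (clients c) ×-dec Zero? v c) n
    ... | no none = no λ { (ℓ , (t , _) , z) → none (ℓ , client<n t , t , z) }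
    ... | yes (c , _ , t , z) with leader-of t
    ...   | ℓ , lead , z′ = yes (ℓ , lead , zero-trans z (zero-sym z′))

    leaders-at : ℕ → List ℕ
    leaders-at v with near-leader? v
    ... | yes (ℓ , _) = ℓ ∷ []
    ... | no _        = []

    leaders-at-complete : ∀ {v ℓ} → Leader ℓ → Zero v ℓ → ℓ ∈ leaders-at v
    leaders-at-complete {v} {ℓ} lead z with near-leader? v
    ... | yes (ℓ′ , lead′ , z′) = here (leader-unique lead lead′ (zero-trans (zero-sym z) z′))
    ... | no none               = ⊥-elim (none (ℓ , lead , z))

    leaders-at-sound : ∀ v → All Leader (leaders-at v)
    leaders-at-sound v with near-leader? v
    ... | yes (_ , lead , _) = lead ∷ []
    ... | no _               = []

    leaders-at-length : ∀ v → length (leaders-at v) ≤ 1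
    leaders-at-length v with near-leader? v
    ... | yes _ = ≤-refl
    ... | no _  = z≤n

    -- An edge of weight zero stays within its class, so a leader is listed only before an edge of
    -- positive weight and at the end. Each entry but the last is thus paid for by an edge of weight
    -- at least 1.
    leaders-on : ∀ {u v} → Path u v → List ℕ
    leaders-on ([_] {u} _) = leaders-at u
    leaders-on (_∷_ {u} {v} _ p) with wt u v
    ... | zero  = leaders-on p
    ... | suc _ = leaders-at u ++ leaders-on p

    leaders-on-complete : ∀ {u v x ℓ} (p : Path u v) → x ∈ verts p → Leader ℓ → Zero x ℓ → ℓ ∈ leaders-on p
    leaders-on-complete [ _ ] (here refl) lead z = leaders-at-complete lead z
    leaders-on-complete (_∷_ {u} {v} a p) m lead z with wt u v in eq
    leaders-on-complete (_∷_ {u} {v} a p) (there m) lead z | zero  = leaders-on-complete p m lead z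
    leaders-on-complete (_∷_ {u} {v} a p) (here refl) lead z | zero =
      leaders-on-complete p (start∈ p) lead (zero-trans (zero-sym (a ∷ [ proj₁ (proj₂ a) ] , trans (+-identityʳ _) eq)) z)
    leaders-on-complete (_∷_ {u} {v} a p) (there m) lead z | suc _ =
      ∈-++⁺ʳ (leaders-at u) (leaders-on-complete p m lead z)
    leaders-on-complete (_∷_ {u} {v} a p) (here refl) lead z | suc _ = ∈-++⁺ˡ (leaders-at-complete lead z)

    leaders-on-sound : ∀ {u v} (p : Path u v) → All Leader (leaders-on p)
    leaders-on-sound ([_] {u} _) = leaders-at-sound u
    leaders-on-sound (_∷_ {u} {v} _ p) with wt u v
    ... | zero  = leaders-on-sound p
    ... | suc _ = All-++⁺ (leaders-at-sound u) (leaders-on-sound p)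

    leaders-on-length : ∀ {u v} (p : Path u v) → length (leaders-on p) ≤ suc (path-weight p)
    leaders-on-length ([_] {u} _) = leaders-at-length u
    leaders-on-length (_∷_ {u} {v} _ p) with wt u v
    ... | zero  = leaders-on-length p
    ... | suc m = begin
      length (leaders-at u ++ leaders-on p)         ≡⟨ length-++ (leaders-at u) ⟩
      length (leaders-at u) + length (leaders-on p) ≤⟨ +-mono-≤ (leaders-at-length u) (leaders-on-length p) ⟩
      suc (suc (path-weight p))                     ≤⟨ s≤s (s≤s (m≤n+m _ m)) ⟩
      suc (suc (m + path-weight p))                 ∎
      where open ≤-Reasoning

-- X and Y mark the leaders of the classes with and without a depot.
module Search (I : Instance) (r : ℕ) (B : ℕ)
  (Zero? : ∀ u v → Dec (Routes.Zero I u v))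
  (X Y : ℕ → ℕ) (X≤1 : ∀ ℓ → X ℓ ≤ 1) (Y≤1 : ∀ ℓ → Y ℓ ≤ 1)
  (X⇔ : ∀ {ℓ} → True (X ℓ) ⇔ (Leaders.Leader I ℓ × Leaders.NearDepot I ℓ))
  (Y⇔ : ∀ {ℓ} → True (Y ℓ) ⇔ (Leaders.Leader I ℓ × ¬ Leaders.NearDepot I ℓ))
  (look : ℕ → ℕ → ℕ) (look-val : ∀ {β} → (∀ i → β i ≤ 1) → ∀ j → j < B → look (val β B) j ≡ β j)
  (colour : ℕ → ℕ → ℕ) where

  open Instance I using (n; k)
  open Routes I
  open Leaders I
  open Covers IsDepot IsClient depot<n client<n k r
  open Config

  Marked : ℕ → Set
  Marked ℓ = True (X ℓ) ⊎ True (Y ℓ)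

  marked⇒leader : ∀ {ℓ} → Marked ℓ → Leader ℓ
  marked⇒leader (inj₁ t) = proj₁ (to X⇔ t)
  marked⇒leader (inj₂ t) = proj₁ (to Y⇔ t)

  leader⇒marked : ∀ {ℓ} → Leader ℓ → Marked ℓ
  leader⇒marked {ℓ} lead with True? (X ℓ)
  ... | yes t = inj₁ t
  ... | no ¬t = inj₂ (from Y⇔ (lead , λ near → ¬t (from X⇔ (lead , near))))

  leader<n : ∀ {ℓ} → Leader ℓ → ℓ < n
  leader<n (t , _) = client<n t

  -- `Visit` demands that the walk stand on the leader itself, which is no restriction because the
  -- way there and back within the class is free. `Close` ends the current walk and opens the next
  -- at any depot. The mask never changes during a run, so colours keep their meaning.
  Move Visit Close Step : Config → Config → Set
  Move (config b M s v w j x y) (config b′ M′ s′ v′ w′ j′ x′ y′) =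
    A v v′ × M′ ≡ M × s′ ≡ s × w′ ≡ w + wt v v′ × j′ ≡ j × x′ ≡ x × y′ ≡ y
  Visit (config b M s v w j x y) (config b′ M′ s′ v′ w′ j′ x′ y′) =
    Marked v × colour b v < B × (¬ True (look M (colour b v))) × M′ ≡ M + 2 ^ colour b v ×
    s′ ≡ s × v′ ≡ v × w′ ≡ w × j′ ≡ j × x′ ≡ x + X v × y′ ≡ y + Y v
  Close (config b M s v w j x y) (config b′ M′ s′ v′ w′ j′ x′ y′) =
    v ≡ s × IsDepot s′ × v′ ≡ s′ × M′ ≡ M × w′ ≡ w × j′ ≡ j + 1 × x′ ≡ x × y′ ≡ y
  Step c c′ = mask-number c′ ≡ mask-number c × (Move c c′ ⊎ Visit c c′ ⊎ Close c c′)

  -- The vehicle count in `Final` reads: the `suc j` walks of the run, the current one included,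
  -- plus one vehicle for each of the `sum n X` minus `x` leaders that have a depot in their class
  -- and were not visited, must not exceed `k`.
  Init Final : Config → Set
  Init (config b M s v w j x y) = IsDepot s × v ≡ s × M ≡ 0 × w ≡ 0 × j ≡ 0 × x ≡ 0 × y ≡ 0
  Final (config b M s v w j x y) = v ≡ s × w ≤ r × suc j + sum n X ≤ k + x × sum n Y ≤ y

  record Covering (ts : List Tour) (U : List ℕ) : Set where
    field
      unique : Unique U
      marked : All Marked U
      met    : All (λ u → Any (λ t → u ∈ verts (path t)) ts) U

  total-weight-++ : ∀ ts us → total-weight (ts ++ us) ≡ total-weight ts + total-weight us
  total-weight-++ []       us = refl
  total-weight-++ (t ∷ ts) us = trans (cong (tour-weight t +_) (total-weight-++ ts us)) (sym (+-assoc (tour-weight t) _ _))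

  weightless : ∀ {ts} → All (λ t → tour-weight t ≡ 0) ts → total-weight ts ≡ 0
  weightless []       = refl
  weightless (e ∷ es) = cong₂ _+_ e (weightless es)

  -- The leaders missing from U are served by vehicles that cost nothing.
  complete-cover : ∀ ts U → Covering ts U → total-weight ts ≤ r →
    length ts + sum n X ≤ k + total X U → sum n Y ≤ total Y U → Cover
  complete-cover ts U cov light few noY = go (collect P Q n (rest X U) zero-tour)
    where
    open Covering cov
    P : ℕ → Tour → Set
    P = Meets
    Q : Tour → Set
    Q t = tour-weight t ≡ 0
    U<n : All (_< n) U
    U<n = All.map (leader<n ∘ marked⇒leader) marked
    zero-tour : ∀ i → i < n → True (rest X U i) → Σ[ t ∈ Tour ] Q t × P i t
    zero-tour i _ t with to X⇔ (proj₂ (rest-true X U t))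
    ... | _ , d , isD , z = tour isD [ depot<n isD ] , refl , here z
    noRest : sum n (rest Y U) ≡ 0
    noRest = n≤0⇒n≡0 (+-cancelʳ-≤ (total Y U) _ 0
      (≤-trans (≤-reflexive (sum-rest n Y unique U<n)) noY))
    go : (Σ[ zs ∈ List Tour ] length zs ≤ sum n (rest X U) × All Q zs × (∀ i → i < n → True (rest X U i) → Any (P i) zs)) → Cover
    go (zs , len , free , serve) = cover (ts ++ zs)
      (+-cancelʳ-≤ (total X U) _ _ (begin
        length (ts ++ zs) + total X U           ≡⟨ cong (_+ total X U) (length-++ ts) ⟩
        length ts + length zs + total X U       ≤⟨ +-monoˡ-≤ _ (+-monoʳ-≤ (length ts) len) ⟩
        length ts + sum n (rest X U) + total X U ≡⟨ +-assoc (length ts) _ _ ⟩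
        length ts + (sum n (rest X U) + total X U) ≡⟨ cong (length ts +_) (sum-rest n X unique U<n) ⟩
        length ts + sum n X                     ≤⟨ few ⟩
        k + total X U                           ∎))
      (≤-trans (≤-reflexive (trans (total-weight-++ ts zs)
        (trans (cong (total-weight ts +_) (weightless free)) (+-identityʳ _)))) light)
      meets
      where
      open ≤-Reasoning
      near : ∀ {ℓ c t} → Zero ℓ c → Meets ℓ t → Meets c t
      near z = Any.map (λ z′ → zero-trans z′ z)
      meets : ∀ c → IsClient c → Any (Meets c) (ts ++ zs)
      meets c isC with leader-of Zero? isC
      ... | ℓ , lead , z with ∈-dec ℓ U
      ... | yes ℓ∈U = ++⁺ˡ (Any.map (λ {t} m → near {t = t} z (lose m (zero-refl (leader<n lead)))) (All.lookup met ℓ∈U))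
      ... | no ℓ∉U with leader⇒marked lead
      ...   | inj₁ t = ++⁺ʳ ts (Any.map (λ {t} → near {t = t} z)
                (serve ℓ (leader<n lead) (subst True (sym (rest-∉ X U ℓ∉U)) t)))
      ...   | inj₂ t = ⊥-elim (<⇒≱ (True⇒≥1 (subst True (sym (rest-∉ Y U ℓ∉U)) t))
                (≤-trans (term≤sum n (rest Y U) (leader<n lead)) (≤-reflexive noRest)))

  -- The evidence that a run accumulates: the tours themselves and a duplicate-free list of visited
  -- leaders behind the counters. `coloured` ties this list to the colour set and is what shows the
  -- next visited leader to be new.
  record Inv (c : Config) : Set where
    field
      tours    : List Tour
      fromDepot : IsDepot (origin c)
      current  : Path (origin c) (position c)
      visited  : List ℕ
      unique   : Unique visited
      marked   : All Marked visited
      met      : All (λ u → Any (λ t → u ∈ verts (path t)) tours ⊎ u ∈ verts current) visited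
      β        : ℕ → ℕ
      β≤1      : ∀ i → β i ≤ 1
      set≡     : colour-set c ≡ val β B
      coloured : All (λ u → colour (mask-number c) u < B × β (colour (mask-number c) u) ≡ 1) visited
      closed≡  : length tours ≡ closed c
      spent≡   : total-weight tours + path-weight current ≡ spent c
      xs≡      : total X visited ≡ xs c
      ys≡      : total Y visited ≡ ys c

  inv-init : ∀ {c} → Init c → Inv c
  inv-init (isD , refl , refl , refl , refl , refl , refl) = record
    { tours = [] ; fromDepot = isD ; current = [ depot<n isD ] ; visited = [] ; unique = [] ; marked = [] ; met = []
    ; β = λ _ → 0 ; β≤1 = λ _ → z≤n ; set≡ = sym (sum-zero B (λ _ _ ()))
    ; coloured = [] ; closed≡ = refl ; spent≡ = refl ; xs≡ = refl ; ys≡ = refl }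

  update-keeps : ∀ {β : ℕ → ℕ} c {i} → β i ≡ 1 → (β [ c ↦ 1 ]) i ≡ 1
  update-keeps {β} c {i} e with c ≟ i
  ... | yes refl = upd-same β c
  ... | no c≢i   = trans (upd-other β c i c≢i) e

  inv-step : ∀ {c c′} → Step c c′ → Inv c → Inv c′
  inv-step (refl , inj₁ (a , refl , refl , refl , refl , refl , refl)) inv = record
    { tours = tours ; fromDepot = fromDepot ; current = current ⟫ (a ∷ [ proj₁ (proj₂ a) ])
    ; visited = visited ; unique = unique ; marked = marked
    ; met = All.map [ inj₁ , (λ m → inj₂ (∈-⟫ˡ current _ m)) ]′ met
    ; β = β ; β≤1 = β≤1 ; set≡ = set≡ ; coloured = coloured ; closed≡ = closed≡
    ; spent≡ = trans (cong (total-weight tours +_) (trans (⟫-weight current _) (cong (path-weight current +_) (+-identityʳ _))))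
                 (trans (sym (+-assoc (total-weight tours) _ _)) (cong (_+ _) spent≡))
    ; xs≡ = xs≡ ; ys≡ = ys≡ }
    where open Inv inv
  inv-step {config b M s v w j x y} (refl , inj₂ (inj₁ (mv , c<B , fresh , refl , refl , refl , refl , refl , refl , refl))) inv = record
    { tours = tours ; fromDepot = fromDepot ; current = current
    ; visited = v ∷ visited ; unique = new ∷ unique ; marked = mv ∷ marked
    ; met = inj₂ (end∈ current) ∷ met
    ; β = β [ colour b v ↦ 1 ] ; β≤1 = update≤1 (colour b v) β≤1
    ; set≡ = trans (cong (_+ 2 ^ colour b v) set≡) (sym (val-update B c<B βc≡0))
    ; coloured = (c<B , upd-same β (colour b v)) ∷ All.map (λ (l , e) → l , update-keeps {β} (colour b v) e) coloured
    ; closed≡ = closed≡ ; spent≡ = spent≡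
    ; xs≡ = trans (+-comm (X v) _) (cong (_+ X v) xs≡) ; ys≡ = trans (+-comm (Y v) _) (cong (_+ Y v) ys≡) }
    where
    open Inv inv
    look≡ : look M (colour b v) ≡ β (colour b v)
    look≡ = trans (cong (λ z → look z (colour b v)) set≡) (look-val β≤1 (colour b v) c<B)
    βc≡0 : β (colour b v) ≡ 0
    βc≡0 with β (colour b v) in eq
    ... | zero  = refl
    ... | suc _ = ⊥-elim (fresh (subst True (sym (trans look≡ eq)) tt))
    -- An earlier visit to `v` would have put its colour into the set, where it is not. Two leaders
    -- of the same colour merely block each other.
    new : All (v ≢_) visited
    new = All.map (λ { (_ , e) refl → 0≢1+n (trans (sym βc≡0) e) }) coloured
  inv-step (refl , inj₂ (inj₂ (refl , isD , refl , refl , refl , refl , refl , refl))) inv = record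
    { tours = tour fromDepot current ∷ tours ; fromDepot = isD ; current = [ depot<n isD ]
    ; visited = visited ; unique = unique ; marked = marked
    ; met = All.map [ inj₁ ∘ there , inj₁ ∘ here ]′ met
    ; β = β ; β≤1 = β≤1 ; set≡ = set≡ ; coloured = coloured
    ; closed≡ = trans (+-comm 1 _) (cong (_+ 1) closed≡)
    ; spent≡ = trans (+-identityʳ _) (trans (+-comm (path-weight current) _) spent≡)
    ; xs≡ = xs≡ ; ys≡ = ys≡ }
    where open Inv inv

  inv-star : ∀ {c c′} → Star Step c c′ → Inv c → Inv c′
  inv-star ε        inv = inv
  inv-star (s ◅ ss) inv = inv-star ss (inv-step s inv)

  -- A run contains at least one walk, so the case in which stationary vehicles do all the work is
  -- listed separately; it is the only one possible for `k` equal to 0.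
  Accepts : Set
  Accepts = (sum n X ≤ k × sum n Y ≤ 0) ⊎ (∃[ c ] ∃[ c′ ] Init c × Star Step c c′ × Final c′)

  accepts⇒cover : Accepts → Cover
  accepts⇒cover (inj₁ (few , noY)) =
    complete-cover [] [] (record { unique = [] ; marked = [] ; met = [] }) z≤n
      (≤-trans few (≤-reflexive (sym (+-identityʳ k)))) noY
  accepts⇒cover (inj₂ (c , config b M s v w j x y , init , steps , refl , light , few , noY)) =
    complete-cover (tour fromDepot current ∷ tours) visited
      (record { unique = unique ; marked = marked ; met = All.map [ there , here ]′ met })
      (≤-trans (≤-reflexive (trans (+-comm (path-weight current) _) spent≡)) light)
      (subst₂ (λ a b → suc a + sum n X ≤ k + b) (sym closed≡) (sym xs≡) few)
      (≤-trans noY (≤-reflexive (sym ys≡)))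
    where open Inv (inv-star steps (inv-init init))

  split : ∀ ts → Σ[ as ∈ List Tour ] Σ[ zs ∈ List Tour ] length as + length zs ≡ length ts ×
    total-weight as ≤ total-weight ts × All (λ t → 1 ≤ tour-weight t) as × All (λ t → tour-weight t ≡ 0) zs ×
    (∀ c → Any (Meets c) ts → Any (Meets c) as ⊎ Any (Meets c) zs)
  split []       = [] , [] , refl , z≤n , [] , [] , λ _ ()
  split (t ∷ ts) with split ts | tour-weight t in eq
  ... | as , zs , len , light , pos , free , share | zero =
    as , t ∷ zs , trans (+-suc (length as) _) (cong suc len) , light , pos , eq ∷ free , λ where
      c (here m)  → inj₂ (here m)
      c (there m) → [ inj₁ , inj₂ ∘ there ]′ (share c m)
  ... | as , zs , len , light , pos , free , share | suc m =
    t ∷ as , zs , cong suc len , +-mono-≤ (≤-reflexive eq) light , subst (1 ≤_) (sym eq) (s≤s z≤n) ∷ pos , free , λ where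
      c (here m)  → inj₁ (here m)
      c (there m) → [ inj₁ ∘ there , inj₂ ]′ (share c m)

  length≤weight : ∀ {ts} → All (λ t → 1 ≤ tour-weight t) ts → length ts ≤ total-weight ts
  length≤weight []       = z≤n
  length≤weight (p ∷ ps) = +-mono-≤ p (length≤weight ps)

  leaders-of-all : List Tour → List ℕ
  leaders-of-all []       = []
  leaders-of-all (t ∷ ts) = leaders-on Zero? (path t) ++ leaders-of-all ts

  leaders-of-all-sound : ∀ ts → All Leader (leaders-of-all ts)
  leaders-of-all-sound []       = []
  leaders-of-all-sound (t ∷ ts) = All-++⁺ (leaders-on-sound Zero? (path t)) (leaders-of-all-sound ts)

  -- A tour of weight `a` lists at most `a + 1` leaders, which is at most `a + a` because `a` is
  -- positive. This is the origin of the `r + r` in the choice of masks.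
  leaders-of-all-length : ∀ {ts} → All (λ t → 1 ≤ tour-weight t) ts →
    length (leaders-of-all ts) ≤ total-weight ts + total-weight ts
  leaders-of-all-length [] = z≤n
  leaders-of-all-length {t ∷ ts} (p ∷ ps) = begin
    length (leaders-on Zero? (path t) ++ leaders-of-all ts)       ≡⟨ length-++ (leaders-on Zero? (path t)) ⟩
    length (leaders-on Zero? (path t)) + length (leaders-of-all ts)
      ≤⟨ +-mono-≤ (leaders-on-length Zero? (path t)) (leaders-of-all-length ps) ⟩
    1 + a + (c + c)        ≤⟨ +-monoˡ-≤ (c + c) (+-monoˡ-≤ a p) ⟩
    a + a + (c + c)        ≡⟨ +-assoc a a (c + c) ⟩
    a + (a + (c + c))      ≡⟨ cong (a +_) (trans (sym (+-assoc a c c)) (trans (cong (_+ c) (+-comm a c)) (+-assoc c a c))) ⟩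
    a + (c + (a + c))      ≡⟨ sym (+-assoc a c (a + c)) ⟩
    a + c + (a + c)        ∎
    where
    open ≤-Reasoning
    a c : ℕ
    a = tour-weight t
    c = total-weight ts

  prefix-zero : ∀ {u v x} (p : Path u v) → path-weight p ≡ 0 → x ∈ verts p → Zero u x
  prefix-zero [ l ]   e (here refl) = zero-refl l
  prefix-zero (a ∷ p) e (here refl) = zero-refl (proj₁ a)
  prefix-zero (_∷_ {u} {v} a p) e (there m) =
    zero-trans (a ∷ [ proj₁ (proj₂ a) ] , trans (+-identityʳ _) (m+n≡0⇒m≡0 (wt u v) e))
      (prefix-zero p (m+n≡0⇒n≡0 (wt u v) e) m)

  -- Every cover is found by a run

  module Complete (Q K : ℕ) (n≥1 : 1 ≤ n) (2n≤Q : 2 * n ≤ Q) (r<Q : r < Q) (K≤B : K ≤ B) (2^K≤Q : 2 ^ K ≤ Q)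
    (masks : ∀ S → All (_< n) S → length S ≤ r + r → ∃[ b ] b < 2 * n ×
      (∀ x y → x ∈ S → y ∈ S → colour b x ≡ colour b y → x ≡ y) × (∀ x → x ∈ S → colour b x < K)) where

    n<Q : n < Q
    n<Q = ≤-trans (m<m+n n (≤-trans n≥1 (m≤m+n n 0))) 2n≤Q

    -- Codes are numerals in base `Q`, so a run is visible to the program only if all of its
    -- configurations have fields below `Q`.
    Small : Config → Set
    Small (config b M s v w j x y) = b < Q × M < Q × s < Q × v < Q × w < Q × j < Q × x < Q × y < Q

    SmallStep : Config → Config → Set
    SmallStep c c′ = Small c × Small c′ × Step c c′

    module Simulate (b : ℕ) (b<2n : b < 2 * n) (S : List ℕ) (S-leaders : All Leader S)
      (injective : ∀ x y → x ∈ S → y ∈ S → colour b x ≡ colour b y → x ≡ y)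
      (colour<K : ∀ x → x ∈ S → colour b x < K) where

      mask : List ℕ → ℕ → ℕ
      mask []      = λ _ → 0
      mask (u ∷ U) = mask U [ colour b u ↦ 1 ]

      mask≤1 : ∀ U i → mask U i ≤ 1
      mask≤1 []      i = z≤n
      mask≤1 (u ∷ U) i = update≤1 (colour b u) (mask≤1 U) i

      mask-other : ∀ U {i} → (∀ u → u ∈ U → colour b u ≢ i) → mask U i ≡ 0
      mask-other []      h = refl
      mask-other (u ∷ U) h =
        trans (upd-other (mask U) (colour b u) _ (h u (here refl))) (mask-other U (λ u m → h u (there m)))

      conf : List ℕ → ℕ → ℕ → ℕ → ℕ → Config
      conf U s v w j = config b (val (mask U) B) s v w j (total X U) (total Y U)

      record Good (U : List ℕ) : Set where
        constructor good
        field
          unique : Unique U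
          within : All (_∈ S) U

      U<n : ∀ {U} → Good U → All (_< n) U
      U<n (good _ within) = All.map (λ m → leader<n (All.lookup S-leaders m)) within

      total<Q : ∀ {U} f → (∀ i → f i ≤ 1) → Good U → total f U < Q
      total<Q {U} f f≤1 g = ≤-<-trans (begin
        total f U                         ≤⟨ m≤n+m _ _ ⟩
        sum n (rest f U) + total f U      ≡⟨ sum-rest n f (Good.unique g) (U<n g) ⟩
        sum n f                           ≤⟨ sum-mono n f≤1 ⟩
        sum n (λ _ → 1)                   ≡⟨ trans (sum-const n 1) (*-identityʳ n) ⟩
        n                                 ∎) n<Q
        where open ≤-Reasoning

      small : ∀ {U s v w j} → Good U → s < n → v < n → w ≤ r → j ≤ r → Small (conf U s v w j)
      small {U} g s<n v<n w≤r j≤r =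
        ≤-trans b<2n 2n≤Q ,
        ≤-trans (subst (_< 2 ^ K) (sym (val-extend {mask U} K≤B beyond)) (val< (mask≤1 U) K)) 2^K≤Q ,
        <-trans s<n n<Q , <-trans v<n n<Q , ≤-<-trans w≤r r<Q , ≤-<-trans j≤r r<Q ,
        total<Q X X≤1 g , total<Q Y Y≤1 g
        where
        beyond : ∀ i → K ≤ i → mask U i ≡ 0
        beyond i K≤i = mask-other U λ u u∈U e →
          <⇒≱ (colour<K u (All.lookup (Good.within g) u∈U)) (≤-trans K≤i (≤-reflexive (sym e)))

      along : ∀ {U s u v w j} → Good U → s < n → j ≤ r → (p : Path u v) → w + path-weight p ≤ r →
        Star SmallStep (conf U s u w j) (conf U s v (w + path-weight p) j)
      along {U} {s} {w = w} {j} g s<n j≤r ([_] {u} _) l =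
        subst (λ z → Star SmallStep (conf U s u w j) (conf U s u z j)) (sym (+-identityʳ w)) ε
      along {U} {s} {v = x} {w} {j} g s<n j≤r (_∷_ {u} {v} a@(u<n , v<n , _) p) l =
        (small g s<n u<n (≤-trans (m≤m+n w _) l) j≤r , small g s<n v<n (≤-trans (m≤m+n _ (path-weight p)) l′) j≤r ,
          refl , inj₁ (a , refl , refl , refl , refl , refl , refl))
        ◅ subst (λ z → Star SmallStep (conf U s v (w + wt u v) j) (conf U s x z j)) (+-assoc w (wt u v) (path-weight p))
            (along g s<n j≤r p l′)
        where
        l′ : w + wt u v + path-weight p ≤ r
        l′ = ≤-trans (≤-reflexive (+-assoc w (wt u v) (path-weight p))) l

      _⊆ᴸ_ : List ℕ → List ℕ → Set
      U ⊆ᴸ U′ = ∀ {x} → x ∈ U → x ∈ U′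

      Served : List ℕ → ℕ → Set
      Served U x = ∀ {ℓ} → Leader ℓ → Zero x ℓ → ℓ ∈ U

      -- If the leader of the class of `v` is not yet in `U`, the run goes to it, visits it and
      -- returns, all at weight zero. Its colour is fresh because colours are injective on `S`,
      -- which contains it and `U`.
      absorb : ∀ {U s v w j} → Good U → s < n → v < n → w ≤ r → j ≤ r → Served S v →
        Σ[ U′ ∈ List ℕ ] Good U′ × U ⊆ᴸ U′ × Star SmallStep (conf U s v w j) (conf U′ s v w j) × Served U′ v
      absorb {U} {s} {v} {w} {j} g s<n v<n w≤r j≤r inS with near-leader? Zero? v
      ... | no none = U , g , id , ε , λ lead z → ⊥-elim (none (_ , lead , z))
      ... | yes (ℓ , lead , z) with ∈-dec ℓ U
      ...   | yes ℓ∈U = U , g , id , ε , λ lead′ z′ →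
              subst (_∈ U) (leader-unique lead lead′ (zero-trans (zero-sym z) z′)) ℓ∈U
      ...   | no ℓ∉U = ℓ ∷ U , g′ , there , steps , λ lead′ z′ →
              here (sym (leader-unique lead lead′ (zero-trans (zero-sym z) z′)))
        where
        ℓ∈S : ℓ ∈ S
        ℓ∈S = inS lead z
        g′ : Good (ℓ ∷ U)
        g′ = good (All.tabulate (λ m e → ℓ∉U (subst (_∈ U) (sym e) m)) ∷ Good.unique g) (ℓ∈S ∷ Good.within g)
        ℓ<n : ℓ < n
        ℓ<n = leader<n lead
        c : ℕ
        c = colour b ℓ
        c<B : c < B
        c<B = ≤-trans (colour<K ℓ ℓ∈S) K≤B
        fresh : mask U c ≡ 0
        fresh = mask-other U λ u u∈U e →
          ℓ∉U (subst (_∈ U) (injective u ℓ (All.lookup (Good.within g) u∈U) ℓ∈S e) u∈U)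
        free : ∀ {a d} (q : Path a d) → path-weight q ≡ 0 → w + path-weight q ≡ w
        free q e = trans (cong (w +_) e) (+-identityʳ w)
        go : ∀ {U a d} → Good U → Zero a d → Star SmallStep (conf U s a w j) (conf U s d w j)
        go {U} {a} {d} g (q , e) = subst (λ z → Star SmallStep (conf U s a w j) (conf U s d z j)) (free q e)
          (along g s<n j≤r q (≤-trans (≤-reflexive (free q e)) w≤r))
        steps : Star SmallStep (conf U s v w j) (conf (ℓ ∷ U) s v w j)
        steps = go g z ◅◅
          ((small g s<n ℓ<n w≤r j≤r , small g′ s<n ℓ<n w≤r j≤r , refl ,
            inj₂ (inj₁ (leader⇒marked lead , c<B ,
              (λ t → subst True (trans (look-val (mask≤1 U) c c<B) fresh) t) ,
              val-update B c<B fresh , refl , refl , refl , refl , +-comm (X ℓ) _ , +-comm (Y ℓ) _)))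
          ◅ go g′ (zero-sym z))

      simulate : ∀ {U s u v w j} → Good U → s < n → j ≤ r → (p : Path u v) → w + path-weight p ≤ r →
        (∀ x → x ∈ verts p → Served S x) →
        Σ[ U′ ∈ List ℕ ] Good U′ × U ⊆ᴸ U′ ×
          Star SmallStep (conf U s u w j) (conf U′ s v (w + path-weight p) j) × (∀ x → x ∈ verts p → Served U′ x)
      simulate {U} {s} {u} {w = w} {j} g s<n j≤r [ u<n ] l inS
        with absorb g s<n u<n (≤-trans (m≤m+n w 0) l) j≤r (inS u (here refl))
      ... | U′ , g′ , sub , steps , served = U′ , g′ , sub ,
            subst (λ z → Star SmallStep (conf U s u w j) (conf U′ s u z j)) (sym (+-identityʳ w)) steps ,
            λ { x (here refl) → served }
      simulate {U} {s} {v = x} {w} {j} g s<n j≤r (_∷_ {u} {v} a p) l inS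
        with absorb g s<n (proj₁ a) (≤-trans (m≤m+n w _) l) j≤r (inS u (here refl))
      ... | U₁ , g₁ , sub₁ , steps₁ , served₁
        with simulate {w = w + wt u v} g₁ s<n j≤r p (≤-trans (≤-reflexive (+-assoc w (wt u v) (path-weight p))) l) (λ x m → inS x (there m))
      ... | U₂ , g₂ , sub₂ , steps₂ , served₂ = U₂ , g₂ , sub₂ ∘ sub₁ ,
            subst (λ z → Star SmallStep (conf U s u w j) (conf U₂ s x z j)) (+-assoc w (wt u v) (path-weight p))
              (steps₁ ◅◅ (step ◅ steps₂)) , λ where
                x (here refl) lead z → sub₂ (served₁ lead z)
                x (there m)          → served₂ x m
        where
        step : SmallStep (conf U₁ s u w j) (conf U₁ s v (w + wt u v) j)
        step = small g₁ s<n (proj₁ a) (≤-trans (m≤m+n w _) l) j≤r ,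
          small g₁ s<n (proj₁ (proj₂ a)) (≤-trans (+-monoʳ-≤ w (m≤m+n _ (path-weight p))) l) j≤r ,
          refl , inj₁ (a , refl , refl , refl , refl , refl , refl)

      ServesTours : List ℕ → List Tour → Set
      ServesTours U ts = ∀ {ℓ} → Leader ℓ → Any (Meets ℓ) ts → ℓ ∈ U

      -- The last tour is not closed, since `Final` counts the current walk on top of the closed
      -- ones. Hence `t ∷ ts` adds only `length ts` to `j`.
      simulate-all : ∀ {U w j} t ts → Good U → w + total-weight (t ∷ ts) ≤ r → j + length ts ≤ r →
        ServesTours S (t ∷ ts) →
        Σ[ U′ ∈ List ℕ ] Σ[ s ∈ ℕ ] s < n × Good U′ × U ⊆ᴸ U′ ×
          Star SmallStep (conf U (depot t) (depot t) w j) (conf U′ s s (w + total-weight (t ∷ ts)) (j + length ts)) ×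
          ServesTours U′ (t ∷ ts)
      simulate-all {U} {w} {j} t ts g l l′ inS
        with simulate g (depot<n (isDepot t)) (≤-trans (m≤m+n j _) l′) (path t)
               (≤-trans (+-monoʳ-≤ w (m≤m+n _ (total-weight ts))) l) (λ x m lead z → inS lead (here (lose m z)))
      ... | U₁ , g₁ , sub₁ , steps₁ , served₁ = continue ts l l′ inS
        where
        W : ℕ
        W = w + tour-weight t
        here-served : ∀ {ℓ} → Leader ℓ → Meets ℓ t → ℓ ∈ U₁
        here-served lead m with find m
        ... | x , x∈ , z = served₁ x x∈ lead z
        continue : ∀ ts → w + total-weight (t ∷ ts) ≤ r → j + length ts ≤ r → ServesTours S (t ∷ ts) →
          Σ[ U′ ∈ List ℕ ] Σ[ s ∈ ℕ ] s < n × Good U′ × U ⊆ᴸ U′ ×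
          Star SmallStep (conf U (depot t) (depot t) w j) (conf U′ s s (w + total-weight (t ∷ ts)) (j + length ts)) ×
          ServesTours U′ (t ∷ ts)
        continue [] l l′ inS = U₁ , depot t , depot<n (isDepot t) , g₁ , sub₁ ,
          subst₂ (λ a c → Star SmallStep (conf U (depot t) (depot t) w j) (conf U₁ (depot t) (depot t) a c))
            (cong (w +_) (sym (+-identityʳ _))) (sym (+-identityʳ j)) steps₁ ,
          λ { lead (here m) → here-served lead m }
        continue (t′ ∷ ts) l l′ inS
          with simulate-all {U₁} {W} {j + 1} t′ ts g₁ (≤-trans (≤-reflexive (+-assoc w _ _)) l)
                 (≤-trans (≤-reflexive (+-assoc j 1 _)) l′) (λ lead m → inS lead (there m))
        ... | U₂ , s , s<n , g₂ , sub₂ , steps₂ , served₂ = U₂ , s , s<n , g₂ , sub₂ ∘ sub₁ ,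
            subst₂ (λ a c → Star SmallStep (conf U (depot t) (depot t) w j) (conf U₂ s s a c))
              (+-assoc w _ _) (+-assoc j 1 _) (steps₁ ◅◅ (step ◅ steps₂)) , λ where
                lead (here m)  → sub₂ (here-served lead m)
                lead (there m) → served₂ lead m
          where
          W≤r : W ≤ r
          W≤r = ≤-trans (+-monoʳ-≤ w (m≤m+n _ _)) l
          step : SmallStep (conf U₁ (depot t) (depot t) W j) (conf U₁ (depot t′) (depot t′) W (j + 1))
          step = small g₁ (depot<n (isDepot t)) (depot<n (isDepot t)) W≤r (≤-trans (m≤m+n j _) l′) ,
            small g₁ (depot<n (isDepot t′)) (depot<n (isDepot t′)) W≤r
              (≤-trans (+-monoʳ-≤ j (s≤s z≤n)) l′) ,
            refl , inj₂ (inj₂ (refl , isDepot t′ , refl , refl , refl , refl , refl , refl))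

    SmallAccepts : Set
    SmallAccepts = (sum n X ≤ k × sum n Y ≤ 0) ⊎
      (∃[ c ] ∃[ c′ ] Small c × Small c′ × Init c × Star SmallStep c c′ × Final c′)

    cover⇒accepts : Cover → SmallAccepts
    cover⇒accepts (cover ts few light meets) with split ts
    ... | as , zs , len , light′ , pos , free , share = decide as refl
      where
      as≤r : total-weight as ≤ r
      as≤r = ≤-trans light′ light
      -- A leader outside `U` is met only by tours of weight zero, each of which stays in the class
      -- of its depot. So none of these leaders is marked by `Y`, and different ones occupy
      -- different tours.
      module Count (U : List ℕ) (unique : Unique U) (U<n : All (_< n) U)
                   (serves : ∀ {ℓ} → Leader ℓ → Any (Meets ℓ) as → ℓ ∈ U) where
        idle : ∀ {ℓ} → Leader ℓ → ℓ ∉ U → Any (λ t → Zero (depot t) ℓ) zs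
        idle {ℓ} lead ℓ∉U with share ℓ (meets ℓ (proj₁ lead))
        ... | inj₁ m = ⊥-elim (ℓ∉U (serves lead m))
        ... | inj₂ m = go free m
          where
          go : ∀ {zs} → All (λ t → tour-weight t ≡ 0) zs → Any (Meets ℓ) zs → Any (λ t → Zero (depot t) ℓ) zs
          go (e ∷ es) (here m) with find m
          ... | x , x∈ , z = here (zero-trans (prefix-zero _ e x∈) z)
          go (e ∷ es) (there m) = there (go es m)
        few-X : sum n (rest X U) ≤ length zs
        few-X = injective-count (λ t i → Zero (depot t) i) (λ t i → Zero? (depot t) i) n zs (rest X U)
          (λ i → below i)
          (λ i _ t → let i∉U , x = rest-true X U t in idle (marked⇒leader (inj₁ x)) i∉U)
          (λ s i j _ _ tᵢ tⱼ zᵢ zⱼ → leader-unique (marked⇒leader (inj₁ (proj₂ (rest-true X U tᵢ))))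
            (marked⇒leader (inj₁ (proj₂ (rest-true X U tⱼ)))) (zero-trans (zero-sym zᵢ) zⱼ))
          where
          below : ∀ i → rest X U i ≤ 1
          below i with ∈-dec i U
          ... | yes i∈ = ≤-trans (≤-reflexive (rest-∈ X U i∈)) z≤n
          ... | no i∉  = ≤-trans (≤-reflexive (rest-∉ X U i∉)) (X≤1 i)
        no-Y : sum n (rest Y U) ≡ 0
        no-Y = sum-zero n λ i _ t → impossible (rest-true Y U t)
          where
          impossible : ∀ {i} → ¬ (i ∉ U × True (Y i))
          impossible (i∉U , y) with find (idle (marked⇒leader (inj₂ y)) i∉U)
          ... | t , _ , z = proj₂ (to Y⇔ y) (depot t , isDepot t , z)
        bound-X : length as + sum n X ≤ k + total X U
        bound-X = begin
          length as + sum n X                        ≡⟨ cong (length as +_) (sym (sum-rest n X unique U<n)) ⟩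
          length as + (sum n (rest X U) + total X U) ≡⟨ sym (+-assoc (length as) _ _) ⟩
          length as + sum n (rest X U) + total X U   ≤⟨ +-monoˡ-≤ _ (+-monoʳ-≤ (length as) few-X) ⟩
          length as + length zs + total X U          ≡⟨ cong (_+ total X U) len ⟩
          length ts + total X U                      ≤⟨ +-monoˡ-≤ _ few ⟩
          k + total X U                              ∎
          where open ≤-Reasoning
        bound-Y : sum n Y ≤ total Y U
        bound-Y = ≤-reflexive (trans (sym (sum-rest n Y unique U<n)) (cong (_+ total Y U) no-Y))
      decide : ∀ as′ → as′ ≡ as → SmallAccepts
      decide [] refl = inj₁ (≤-trans bound-X (≤-reflexive (+-identityʳ k)) , bound-Y)
        where open Count [] [] [] (λ _ ())
      decide (t ∷ as′) refl with masks (leaders-of-all as) (All.map leader<n (leaders-of-all-sound as))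
                 (≤-trans (leaders-of-all-length pos) (+-mono-≤ as≤r as≤r))
      ... | b , b<2n , inj , col with Simulate.simulate-all b b<2n (leaders-of-all as) (leaders-of-all-sound as) inj col
                {[]} {0} {0} t as′ (Simulate.good [] []) as≤r
                (≤-trans (m≤n+m _ 1) (≤-trans (length≤weight pos) as≤r)) (all-listed as)
        where
        all-listed : ∀ ts {ℓ} → Leader ℓ → Any (Meets ℓ) ts → ℓ ∈ leaders-of-all ts
        all-listed (t ∷ ts) lead (here m) with find m
        ... | x , x∈ , z = ∈-++⁺ˡ (leaders-on-complete Zero? (path t) x∈ lead z)
        all-listed (t ∷ ts) lead (there m) = ∈-++⁺ʳ (leaders-on Zero? (path t)) (all-listed ts lead m)
      ... | U , s , s<n , g , _ , steps , serves =
        inj₂ (_ , _ ,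
          small (good [] []) (depot<n (isDepot t)) (depot<n (isDepot t)) z≤n z≤n ,
          small g s<n s<n as≤r (≤-trans (m≤n+m _ 1) (≤-trans (length≤weight pos) as≤r)) ,
          (isDepot t , refl , sum-zero B (λ _ _ ()) , refl , refl , refl , refl) , steps ,
          (refl , as≤r , bound-X , bound-Y))
        where
        open Simulate b b<2n (leaders-of-all as) (leaders-of-all-sound as) inj col
        open Count U (Good.unique g) (U<n g) serves

-- The algorithm

-- The second test may have its intended meaning only under the first: a matrix cell is addressed
-- correctly only for a row below `n`, and a power of two is computed correctly only for an exponent
-- up to `B`.
and⇔-dep : ∀ {x y} {P Q : Set} → True x ⇔ P → (P → True y ⇔ Q) → True (choose x y 0) ⇔ (P × Q)
and⇔-dep {zero}  p q = mk⇔ (λ ()) (λ (h , _) → from p h)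
and⇔-dep {suc x} p q = mk⇔ (λ t → to p tt , to (q (to p tt)) t) (λ (h , h′) → from (q h) h′)

gn gk gr gQ gN gB : Tm
gn = glob (# 0)
gk = glob (# 1)
gr = glob (# 2)
gQ = glob (# 3)
gN = glob (# 4)
gB = glob (# 5)

cellᵀ : ℕ → Tm
cellᵀ a = read a (call mulᵀ (var 0 ∷ gn ∷ []) ⊕ var 1)

opaque
  adjᵀ weightᵀ zeroEdgeᵀ zeroᵀ leaderᵀ nearᵀ Xᵀ Yᵀ ΣXᵀ ΣYᵀ : Tm
  adjᵀ      = andᵀ (ltᵀ (var 0) gn) (andᵀ (ltᵀ (var 1) gn) (cellᵀ 2))
  weightᵀ   = cellᵀ 3
  zeroEdgeᵀ = andᵀ (call adjᵀ (var 0 ∷ var 1 ∷ [])) (leᵀ (call weightᵀ (var 0 ∷ var 1 ∷ [])) (num 0))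
  zeroᵀ     = andᵀ (ltᵀ (var 0) gn) (andᵀ (ltᵀ (var 1) gn) (call (reachᵀ zeroEdgeᵀ) (var 0 ∷ var 1 ∷ [])))
  leaderᵀ   = andᵀ (read 1 (var 0)) (notᵀ (anyᵀ (andᵀ (ltᵀ (var 0) (var 2))
                (andᵀ (read 1 (var 0)) (call zeroᵀ (var 0 ∷ var 2 ∷ []))))))
  nearᵀ     = anyᵀ (andᵀ (read 0 (var 0)) (call zeroᵀ (var 0 ∷ var 2 ∷ [])))
  Xᵀ        = ite (andᵀ (call leaderᵀ (var 0 ∷ [])) (call nearᵀ (var 0 ∷ []))) (num 1) (num 0)
  Yᵀ        = ite (andᵀ (call leaderᵀ (var 0 ∷ [])) (notᵀ (call nearᵀ (var 0 ∷ [])))) (num 1) (num 0)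
  ΣXᵀ       = sumᵀ (call Xᵀ (var 0 ∷ []))
  ΣYᵀ       = sumᵀ (call Yᵀ (var 0 ∷ []))

opaque
  digitᵀ : ℕ → Tm
  digitᵀ zero    = call modᵀ (var 0 ∷ gQ ∷ [])
  digitᵀ (suc i) = call (digitᵀ i) (call divᵀ (var 0 ∷ gQ ∷ []) ∷ [])

digitsᵀ : Tm → List Tm → List Tm
digitsᵀ p es = call (digitᵀ 0) (p ∷ []) ∷ call (digitᵀ 1) (p ∷ []) ∷ call (digitᵀ 2) (p ∷ []) ∷
  call (digitᵀ 3) (p ∷ []) ∷ call (digitᵀ 4) (p ∷ []) ∷ call (digitᵀ 5) (p ∷ []) ∷
  call (digitᵀ 6) (p ∷ []) ∷ call (digitᵀ 7) (p ∷ []) ∷ es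

-- Arguments 0 to 7 are the fields of a configuration, in the order of the
-- record; arguments 8 to 15 are those of its successor.
opaque
  moveᵀ visitᵀ closeᵀ stepᵀ initᵀ finalᵀ mainᵀ : Tm
  moveᵀ = andᵀ (call adjᵀ (var 3 ∷ var 11 ∷ [])) (andᵀ (eqᵀ (var 9) (var 1)) (andᵀ (eqᵀ (var 10) (var 2))
    (andᵀ (eqᵀ (var 12) (var 4 ⊕ call weightᵀ (var 3 ∷ var 11 ∷ []))) (andᵀ (eqᵀ (var 13) (var 5))
    (andᵀ (eqᵀ (var 14) (var 6)) (eqᵀ (var 15) (var 7)))))))
  visitᵀ = andᵀ (orᵀ (call Xᵀ (var 3 ∷ [])) (call Yᵀ (var 3 ∷ []))) (andᵀ (ltᵀ colourᵀ gB)
    (andᵀ (notᵀ (call lookᵀ (var 1 ∷ colourᵀ ∷ []))) (andᵀ (eqᵀ (var 9) (var 1 ⊕ call pow2ᵀ (colourᵀ ∷ [])))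
    (andᵀ (eqᵀ (var 10) (var 2)) (andᵀ (eqᵀ (var 11) (var 3)) (andᵀ (eqᵀ (var 12) (var 4))
    (andᵀ (eqᵀ (var 13) (var 5)) (andᵀ (eqᵀ (var 14) (var 6 ⊕ call Xᵀ (var 3 ∷ [])))
    (eqᵀ (var 15) (var 7 ⊕ call Yᵀ (var 3 ∷ [])))))))))))
    where
    colourᵀ : Tm
    colourᵀ = call hashᵀ (var 0 ∷ var 3 ∷ [])
  closeᵀ = andᵀ (eqᵀ (var 3) (var 2)) (andᵀ (read 0 (var 10)) (andᵀ (eqᵀ (var 11) (var 10))
    (andᵀ (eqᵀ (var 9) (var 1)) (andᵀ (eqᵀ (var 12) (var 4)) (andᵀ (eqᵀ (var 13) (var 5 ⊕ num 1))
    (andᵀ (eqᵀ (var 14) (var 6)) (eqᵀ (var 15) (var 7))))))))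
  stepᵀ = call (andᵀ (eqᵀ (var 8) (var 0)) (orᵀ moveᵀ (orᵀ visitᵀ closeᵀ)))
    (digitsᵀ (var 0) (digitsᵀ (var 1) []))
  initᵀ = call (andᵀ (read 0 (var 2)) (andᵀ (eqᵀ (var 3) (var 2)) (andᵀ (eqᵀ (var 1) (num 0))
    (andᵀ (eqᵀ (var 4) (num 0)) (andᵀ (eqᵀ (var 5) (num 0)) (andᵀ (eqᵀ (var 6) (num 0)) (eqᵀ (var 7) (num 0))))))))
    (digitsᵀ (var 0) [])
  finalᵀ = call (andᵀ (eqᵀ (var 3) (var 2)) (andᵀ (leᵀ (var 4) gr)
    (andᵀ (leᵀ (num 1 ⊕ var 5 ⊕ call ΣXᵀ []) (gk ⊕ var 6)) (leᵀ (call ΣYᵀ []) (var 7)))))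
    (digitsᵀ (var 0) [])
  mainᵀ = ite (orᵀ (andᵀ (leᵀ (call ΣXᵀ []) gk) (leᵀ (call ΣYᵀ []) (num 0)))
    -- Each `anyᵀ` binds a round and an accumulator, so `var 2` and `var 0` are the codes of the
    -- first and the last configuration. Both range up to `B`, hence the comparisons with `gN`.
    (anyᵀ (anyᵀ (andᵀ (ltᵀ (var 2) gN) (andᵀ (ltᵀ (var 0) gN) (andᵀ (call initᵀ (var 2 ∷ []))
      (andᵀ (call (reachᵀ stepᵀ) (var 2 ∷ var 0 ∷ [])) (call finalᵀ (var 0 ∷ [])))))))))
    (num 1) (num 0)

module Algorithm (I : Instance) (r Q N B : ℕ) (N≡ : N ≡ Q ^ 8) (N*N≡B : N * N ≡ B)
  (n≥1 : 1 ≤ Instance.n I) (2n≤Q : 2 * Instance.n I ≤ Q) (r<Q : r < Q) (2^K≤Q : 2 ^ (2 ^ (r + r)) ≤ Q) where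

  open Instance I using (n; k)
  open Routes I
  open Leaders I

  g : ℕ → ℕ
  g = nth (n ∷ k ∷ r ∷ Q ∷ N ∷ B ∷ [])

  α : ℕ → ℕ → ℕ
  α = array (load I r)

  open Eval g α
  open Arithmetic g α
  open Colours g α

  1≤Q : 1 ≤ Q
  1≤Q = ≤-trans (s≤s z≤n) r<Q

  instance
    Q≢0 : NonZero Q
    Q≢0 = >-nonZero 1≤Q

  Q≤N : Q ≤ N
  Q≤N = subst₂ _≤_ (*-identityʳ Q) (sym N≡) (^-monoʳ-≤ Q {1} {8} (s≤s z≤n))

  N≤B : N ≤ B
  N≤B = subst (N ≤_) N*N≡B (m≤m*n N N {{>-nonZero (≤-trans 1≤Q Q≤N)}})

  Q≤B : Q ≤ B
  Q≤B = ≤-trans Q≤N N≤B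

  n≤Q : n ≤ Q
  n≤Q = ≤-trans (m≤m+n n _) 2n≤Q

  n≤B : n ≤ B
  n≤B = ≤-trans n≤Q Q≤B

  cell : ∀ {u} v → u < n → eval mulᵀ (u ∷ n ∷ []) + v ≡ n * u + v
  cell {u} v u<n = cong (_+ v) (trans (mul-eval u n (≤-trans (<⇒≤ u<n) n≤B)) (*-comm u n))

  X Y : ℕ → ℕ
  X ℓ = eval Xᵀ (ℓ ∷ [])
  Y ℓ = eval Yᵀ (ℓ ∷ [])

  opaque
    unfolding adjᵀ

    adj⇔ : ∀ u v → True (eval adjᵀ (u ∷ v ∷ [])) ⇔ A u v
    adj⇔ u v = and⇔-dep (lt⇔ {u} {n}) λ u<n → and⇔ (lt⇔ {v} {n})
      (subst (λ z → True (adjacency z) ⇔ True (adjacency (n * u + v))) (sym (cell v u<n)) ⇔-refl)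

    weight-eval : ∀ {u} v → u < n → eval weightᵀ (u ∷ v ∷ []) ≡ wt u v
    weight-eval v u<n = cong weights (cell v u<n)

    zeroEdge⇔ : ∀ u v → True (eval zeroEdgeᵀ (u ∷ v ∷ [])) ⇔ ZeroEdge u v
    zeroEdge⇔ u v = and⇔-dep (adj⇔ u v) λ a → ⇔-trans le⇔
      (subst (λ z → (z ≤ 0) ⇔ (wt u v ≡ 0)) (sym (weight-eval v (proj₁ a))) (mk⇔ n≤0⇒n≡0 ≤-reflexive))

    zero⇔ : ∀ u v → True (eval zeroᵀ (u ∷ v ∷ [])) ⇔ Zero u v
    zero⇔ u v = ⇔-trans (and⇔-dep (lt⇔ {u} {n}) λ u<n → and⇔-dep (lt⇔ {v} {n}) λ v<n →
        ⇔-trans (reach⇔ (≤-trans u<n n≤N) (≤-trans v<n n≤N))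
          (⇔-trans (mk⇔ (gmap id (λ (_ , _ , t) → to (zeroEdge⇔ _ _) t))
                        (gmap id (λ e → ≤-trans (proj₁ (proj₁ e)) n≤N ,
                                         ≤-trans (proj₁ (proj₂ (proj₁ e))) n≤N , from (zeroEdge⇔ _ _) e)))
            (⇔-sym (zero⇔star u<n))))
      (mk⇔ (proj₂ ∘ proj₂) (λ z → verts<n (proj₁ z) (start∈ (proj₁ z)) , verts<n (proj₁ z) (end∈ (proj₁ z)) , z))
      where
      open Closure zeroEdgeᵀ N*N≡B
      n≤N : n ≤ N
      n≤N = ≤-trans n≤Q Q≤N

    leader⇔ : ∀ ℓ → True (eval leaderᵀ (ℓ ∷ [])) ⇔ Leader ℓ
    leader⇔ ℓ = and⇔ ⇔-refl (⇔-trans (not⇔ smaller⇔) none⇔)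
      where
      Smaller : ℕ → Set
      Smaller c = c < ℓ × IsClient c × Zero c ℓ
      smaller⇔ : True (eval (anyᵀ (andᵀ (ltᵀ (var 0) (var 2)) (andᵀ (read 1 (var 0))
        (call zeroᵀ (var 0 ∷ var 2 ∷ []))))) (ℓ ∷ [])) ⇔ (∃[ c ] c < B × Smaller c)
      smaller⇔ = any⇔ B (λ c _ → and⇔ (lt⇔ {c} {ℓ}) (and⇔ ⇔-refl (zero⇔ c ℓ)))
      none⇔ : (¬ (∃[ c ] c < B × Smaller c)) ⇔ (∀ c → c < ℓ → IsClient c → ¬ Zero c ℓ)
      none⇔ = mk⇔ (λ none c l t z → none (c , ≤-trans (client<n t) n≤B , l , t , z)) back
        where
        back : (∀ c → c < ℓ → IsClient c → ¬ Zero c ℓ) → ¬ (∃[ c ] c < B × Smaller c)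
        back all (c , _ , l , t , z) = all c l t z

    near⇔ : ∀ ℓ → True (eval nearᵀ (ℓ ∷ [])) ⇔ NearDepot ℓ
    near⇔ ℓ = ⇔-trans below⇔
      (mk⇔ (λ (d , _ , t , z) → d , t , z) (λ (d , t , z) → d , ≤-trans (depot<n t) n≤B , t , z))
      where
      below⇔ : True (eval nearᵀ (ℓ ∷ [])) ⇔ (∃[ d ] d < B × IsDepot d × Zero d ℓ)
      below⇔ = any⇔ B (λ d _ → and⇔ ⇔-refl (zero⇔ d ℓ))

    X≤1 : ∀ ℓ → X ℓ ≤ 1
    X≤1 ℓ = bitOf≤1 (eval (andᵀ (call leaderᵀ (var 0 ∷ [])) (call nearᵀ (var 0 ∷ []))) (ℓ ∷ []))

    Y≤1 : ∀ ℓ → Y ℓ ≤ 1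
    Y≤1 ℓ = bitOf≤1 (eval (andᵀ (call leaderᵀ (var 0 ∷ [])) (notᵀ (call nearᵀ (var 0 ∷ [])))) (ℓ ∷ []))

    X⇔ : ∀ {ℓ} → True (X ℓ) ⇔ (Leader ℓ × NearDepot ℓ)
    X⇔ {ℓ} = ⇔-trans True-bitOf (and⇔ (leader⇔ ℓ) (near⇔ ℓ))

    Y⇔ : ∀ {ℓ} → True (Y ℓ) ⇔ (Leader ℓ × ¬ NearDepot ℓ)
    Y⇔ {ℓ} = ⇔-trans True-bitOf (and⇔ (leader⇔ ℓ) (not⇔ (near⇔ ℓ)))

    ΣX-eval : eval ΣXᵀ [] ≡ sum n X
    ΣX-eval = sum-extend X n≤B λ i n≤i → ¬True⇒≡0 λ t → <⇒≱ (client<n (proj₁ (proj₁ (to X⇔ t)))) n≤i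

    ΣY-eval : eval ΣYᵀ [] ≡ sum n Y
    ΣY-eval = sum-extend Y n≤B λ i n≤i → ¬True⇒≡0 λ t → <⇒≱ (client<n (proj₁ (proj₁ (to Y⇔ t)))) n≤i

  -- The term `zeroᵀ`, already proved correct, doubles as the decision procedure on which the
  -- existence of leaders and the detours depend.
  Zero? : ∀ u v → Dec (Zero u v)
  Zero? u v = Dec-map (zero⇔ u v) (True? _)

  look : ℕ → ℕ → ℕ
  look M c = eval lookᵀ (M ∷ c ∷ [])

  open Search I r B Zero? X Y X≤1 Y≤1 X⇔ Y⇔ look look-eval colour

  -- Bound on the colours: at most `r + r` leaders are to be told apart, and the hash of `separate`
  -- then has at most `r + r` digits.
  K : ℕ
  K = 2 ^ (r + r)

  K≤B : K ≤ B
  K≤B = ≤-trans (<⇒≤ (n<2^n K)) (≤-trans 2^K≤Q Q≤B)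

  open Complete Q K n≥1 2n≤Q r<Q K≤B 2^K≤Q (λ S S<n l → separating-mask n (r + r) S n≥1 (≤-trans 2n≤Q Q≤B) S<n l)

  digit : ℕ → ℕ → ℕ
  digit i p = eval (digitᵀ i) (p ∷ [])

  opaque
    unfolding digitᵀ

    digit-zero : ∀ q {a} → a < Q → q < B → digit 0 (q * Q + a) ≡ a
    digit-zero q {a} p l = mod-eval q Q a p l

    digit-suc : ∀ i q {a} → a < Q → q < B → digit (suc i) (q * Q + a) ≡ digit i q
    digit-suc i q {a} p l = cong (digit i) (div-eval q Q a p l)

  decode : ℕ → Config
  decode p = config (digit 0 p) (digit 1 p) (digit 2 p) (digit 3 p) (digit 4 p) (digit 5 p) (digit 6 p) (digit 7 p)

  push< : ∀ {m q a} → q < Q ^ m → a < Q → q * Q + a < Q ^ suc m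
  push< {m} {q} {a} p l = begin-strict
    q * Q + a    <⟨ +-monoʳ-< (q * Q) l ⟩
    q * Q + Q    ≡⟨ +-comm (q * Q) Q ⟩
    suc q * Q    ≤⟨ *-monoˡ-≤ Q p ⟩
    Q ^ m * Q    ≡⟨ *-comm (Q ^ m) Q ⟩
    Q ^ suc m    ∎
    where open ≤-Reasoning

  -- The fields are the digits in base `Q`, the mask lowest; the bounds in `Small` are what lets
  -- division by `Q` recover them.
  encoding : ∀ {c} → Small c → ∃[ p ] p < N × decode p ≡ c
  encoding {config b M s v w j x y} (b< , M< , s< , v< , w< , j< , x< , y<) =
    p₀ , subst (p₀ <_) (sym N≡) l₀ , cong-config
      (digit-zero p₁ b< (bd l₁ 7≤8))
      (trans (digit-suc 0 p₁ b< (bd l₁ 7≤8)) (digit-zero p₂ M< (bd l₂ 6≤8)))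
      (trans (digit-suc 1 p₁ b< (bd l₁ 7≤8)) (trans (digit-suc 0 p₂ M< (bd l₂ 6≤8)) (digit-zero p₃ s< (bd l₃ 5≤8))))
      (trans (digit-suc 2 p₁ b< (bd l₁ 7≤8)) (trans (digit-suc 1 p₂ M< (bd l₂ 6≤8)) (trans (digit-suc 0 p₃ s< (bd l₃ 5≤8))
        (digit-zero p₄ v< (bd l₄ 4≤8)))))
      (trans (digit-suc 3 p₁ b< (bd l₁ 7≤8)) (trans (digit-suc 2 p₂ M< (bd l₂ 6≤8)) (trans (digit-suc 1 p₃ s< (bd l₃ 5≤8))
        (trans (digit-suc 0 p₄ v< (bd l₄ 4≤8)) (digit-zero p₅ w< (bd l₅ 3≤8))))))
      (trans (digit-suc 4 p₁ b< (bd l₁ 7≤8)) (trans (digit-suc 3 p₂ M< (bd l₂ 6≤8)) (trans (digit-suc 2 p₃ s< (bd l₃ 5≤8))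
        (trans (digit-suc 1 p₄ v< (bd l₄ 4≤8)) (trans (digit-suc 0 p₅ w< (bd l₅ 3≤8)) (digit-zero p₆ j< (bd l₆ 2≤8)))))))
      (trans (digit-suc 5 p₁ b< (bd l₁ 7≤8)) (trans (digit-suc 4 p₂ M< (bd l₂ 6≤8)) (trans (digit-suc 3 p₃ s< (bd l₃ 5≤8))
        (trans (digit-suc 2 p₄ v< (bd l₄ 4≤8)) (trans (digit-suc 1 p₅ w< (bd l₅ 3≤8)) (trans (digit-suc 0 p₆ j< (bd l₆ 2≤8))
        (digit-zero p₇ x< (bd l₇ 1≤8))))))))
      (trans (digit-suc 6 p₁ b< (bd l₁ 7≤8)) (trans (digit-suc 5 p₂ M< (bd l₂ 6≤8)) (trans (digit-suc 4 p₃ s< (bd l₃ 5≤8))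
        (trans (digit-suc 3 p₄ v< (bd l₄ 4≤8)) (trans (digit-suc 2 p₅ w< (bd l₅ 3≤8)) (trans (digit-suc 1 p₆ j< (bd l₆ 2≤8))
        (trans (digit-suc 0 p₇ x< (bd l₇ 1≤8)) (digit-zero 0 y< (≤-trans 1≤Q Q≤B)))))))))
    where
    p₇ p₆ p₅ p₄ p₃ p₂ p₁ p₀ : ℕ
    p₇ = y
    p₆ = p₇ * Q + x
    p₅ = p₆ * Q + j
    p₄ = p₅ * Q + w
    p₃ = p₄ * Q + v
    p₂ = p₃ * Q + s
    p₁ = p₂ * Q + M
    p₀ = p₁ * Q + b
    l₇ : p₇ < Q ^ 1
    l₇ = push< {0} {0} (s≤s z≤n) y<
    l₆ : p₆ < Q ^ 2
    l₆ = push< {1} l₇ x<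
    l₅ : p₅ < Q ^ 3
    l₅ = push< {2} l₆ j<
    l₄ : p₄ < Q ^ 4
    l₄ = push< {3} l₅ w<
    l₃ : p₃ < Q ^ 5
    l₃ = push< {4} l₄ v<
    l₂ : p₂ < Q ^ 6
    l₂ = push< {5} l₃ s<
    l₁ : p₁ < Q ^ 7
    l₁ = push< {6} l₂ M<
    l₀ : p₀ < Q ^ 8
    l₀ = push< {7} l₁ b<
    1≤8 : 1 ≤ 8
    1≤8 = m≤m+n 1 7
    2≤8 : 2 ≤ 8
    2≤8 = m≤m+n 2 6
    3≤8 : 3 ≤ 8
    3≤8 = m≤m+n 3 5
    4≤8 : 4 ≤ 8
    4≤8 = m≤m+n 4 4
    5≤8 : 5 ≤ 8
    5≤8 = m≤m+n 5 3
    6≤8 : 6 ≤ 8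
    6≤8 = m≤m+n 6 2
    7≤8 : 7 ≤ 8
    7≤8 = m≤m+n 7 1
    bd : ∀ {p m} → p < Q ^ m → m ≤ 8 → p < B
    bd l m≤8 = ≤-trans l (≤-trans (^-monoʳ-≤ Q m≤8) (≤-trans (≤-reflexive (sym N≡)) N≤B))
    cong-config : ∀ {b b′ M M′ s s′ v v′ w w′ j j′ x x′ y y′} → b ≡ b′ → M ≡ M′ → s ≡ s′ → v ≡ v′ →
      w ≡ w′ → j ≡ j′ → x ≡ x′ → y ≡ y′ → config b M s v w j x y ≡ config b′ M′ s′ v′ w′ j′ x′ y′
    cong-config refl refl refl refl refl refl refl refl = refl

  opaque
    unfolding mainᵀ

    step⇔ : ∀ p q → True (eval stepᵀ (p ∷ q ∷ [])) ⇔ Step (decode p) (decode q)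
    step⇔ p q = and⇔ eq⇔ (or⇔ move⇔ (or⇔ visit⇔ close⇔))
      where
      v v′ w w′ c M M′ : ℕ
      v  = digit 3 p
      v′ = digit 3 q
      w  = digit 4 p
      w′ = digit 4 q
      M  = digit 1 p
      M′ = digit 1 q
      c  = colour (digit 0 p) v
      args : List ℕ
      args = evals (digitsᵀ (var 0) (digitsᵀ (var 1) [])) (p ∷ q ∷ [])
      move⇔ : True (eval moveᵀ args) ⇔ Move (decode p) (decode q)
      move⇔ = and⇔-dep (adj⇔ v v′) λ a → and⇔ eq⇔ (and⇔ eq⇔ (and⇔
        (subst (λ z → True (choose (choose (w′ ∸ (w + z)) 0 1) (choose ((w + z) ∸ w′) 0 1) 0) ⇔ (w′ ≡ w + wt v v′))
          (sym (weight-eval v′ (proj₁ a))) eq⇔)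
        (and⇔ eq⇔ (and⇔ eq⇔ eq⇔))))
      visit⇔ : True (eval visitᵀ args) ⇔ Visit (decode p) (decode q)
      visit⇔ = and⇔ (or⇔ ⇔-refl ⇔-refl) (and⇔-dep (lt⇔ {c} {B}) λ c<B → and⇔ (not⇔ ⇔-refl) (and⇔
        (subst (λ z → True (choose (choose (M′ ∸ (M + z)) 0 1) (choose ((M + z) ∸ M′) 0 1) 0) ⇔ (M′ ≡ M + 2 ^ c))
          (sym (pow2-eval c (<⇒≤ c<B))) eq⇔)
        (and⇔ eq⇔ (and⇔ eq⇔ (and⇔ eq⇔ (and⇔ eq⇔ (and⇔ eq⇔ eq⇔)))))))
      close⇔ : True (eval closeᵀ args) ⇔ Close (decode p) (decode q)
      close⇔ = and⇔ eq⇔ (and⇔ ⇔-refl (and⇔ eq⇔ (and⇔ eq⇔ (and⇔ eq⇔ (and⇔ eq⇔ (and⇔ eq⇔ eq⇔))))))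

    init⇔ : ∀ p → True (eval initᵀ (p ∷ [])) ⇔ Init (decode p)
    init⇔ p = and⇔ ⇔-refl (and⇔ eq⇔ (and⇔ eq⇔ (and⇔ eq⇔ (and⇔ eq⇔ (and⇔ eq⇔ eq⇔)))))

    final⇔ : ∀ p → True (eval finalᵀ (p ∷ [])) ⇔ Final (decode p)
    final⇔ p = and⇔ eq⇔ (and⇔ le⇔ (and⇔
      (subst (λ z → True (choose ((suc (digit 5 p) + z) ∸ (k + digit 6 p)) 0 1) ⇔ (suc (digit 5 p) + sum n X ≤ k + digit 6 p)) (sym ΣX-eval) le⇔)
      (subst (λ z → True (choose (z ∸ digit 7 p) 0 1) ⇔ (sum n Y ≤ digit 7 p)) (sym ΣY-eval) le⇔)))

    reachable⇔ : ∀ {p q} → p < N → q < N → True (eval (reachᵀ stepᵀ) (p ∷ q ∷ [])) ⇔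
      Star (λ p q → p < N × q < N × Step (decode p) (decode q)) p q
    reachable⇔ p<N q<N = ⇔-trans (Closure.reach⇔ stepᵀ N*N≡B p<N q<N)
      (mk⇔ (gmap id (λ (a , b , t) → a , b , to (step⇔ _ _) t)) (gmap id (λ (a , b , t) → a , b , from (step⇔ _ _) t)))

    Found : ℕ → ℕ → Set
    Found p q = p < N × q < N × Init (decode p) ×
      Star (λ p q → p < N × q < N × Step (decode p) (decode q)) p q × Final (decode q)

    main⇔ : True (eval mainᵀ []) ⇔ ((sum n X ≤ k × sum n Y ≤ 0) ⊎ (∃[ p ] p < B × ∃[ q ] q < B × Found p q))
    main⇔ = ⇔-trans True-bitOf (or⇔
      (and⇔ (subst (λ z → True (choose (z ∸ k) 0 1) ⇔ (sum n X ≤ k)) (sym ΣX-eval) le⇔)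
            (subst (λ z → True (choose (z ∸ 0) 0 1) ⇔ (sum n Y ≤ 0)) (sym ΣY-eval) le⇔))
      (any⇔ B (λ p _ → any⇔ B (λ q _ → and⇔-dep (lt⇔ {p} {N}) λ p<N → and⇔-dep (lt⇔ {q} {N}) λ q<N →
        and⇔ (init⇔ p) (and⇔ (reachable⇔ p<N q<N) (final⇔ q))))))

    main≤1 : eval mainᵀ [] ≤ 1
    main≤1 = bitOf≤1 _

    sound : True (eval mainᵀ []) → Accepts
    sound t with to main⇔ t
    ... | inj₁ h = inj₁ h
    ... | inj₂ (p , _ , q , _ , _ , _ , init , steps , final) =
      inj₂ (decode p , decode q , init , gmap decode (λ (_ , _ , s) → s) steps , final)

    complete : SmallAccepts → True (eval mainᵀ [])
    complete (inj₁ h) = from main⇔ (inj₁ h)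
    complete (inj₂ (c , c′ , small , small′ , init , steps , final)) with encoding small′
    ... | q , q<N , refl with follow small steps
      where
      follow : ∀ {c} → Small c → Star SmallStep c (decode q) → ∃[ p ] p < N × decode p ≡ c ×
        Star (λ p q → p < N × q < N × Step (decode p) (decode q)) p q
      follow _ ε = q , q<N , refl , ε
      follow small ((_ , small′ , step) ◅ steps) with encoding small | follow small′ steps
      ... | p , p<N , refl | p′ , p′<N , refl , path = p , p<N , refl , (p<N , p′<N , step) ◅ path
    ... | p , p<N , refl , path = from main⇔ (inj₂ (p , ≤-trans p<N N≤B , q , ≤-trans q<N N≤B ,
            p<N , q<N , init , path , final))

  decides : eval mainᵀ [] ≡ 1 ⇔ (Σ[ R ∈ Instance.Routing I ] Instance.weight I R ≤ r)
  decides = mk⇔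
    (λ e → cover⇒routing Zero? (accepts⇒cover (sound (subst True (sym e) tt))))
    (λ (R , l) → one main≤1 (complete (cover⇒accepts (routing⇒cover R l))))
    where
    open Conversion r
    one : ∀ {x} → x ≤ 1 → True x → x ≡ 1
    one {suc zero} _ _ = refl
    one {suc (suc _)} (s≤s ()) _

-- The complete program and its running time

program : Program
program = prelude 1 ⨾ compile mainᵀ [] 6 ⨾ 0 ≔ reg 6

opaque
  -- The 11 is the exponent of the prelude and the last 1 that of the final copy to register 0,
  -- joined to `κ mainᵀ` as in `+-bound`. The factor 16 passes from `B` to `Q`.
  degree exponent : ℕ
  degree   = suc (11 + suc (κ mainᵀ + 1))
  exponent = 16 * degree

  degree-bound : ∀ {B t} → t ≤ B ^ suc (11 + suc (κ mainᵀ + 1)) → t ≤ B ^ degree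
  degree-bound p = p

  program-time : ∀ {Q t} → t ≤ (Q ^ 16) ^ degree → t ≤ Q ^ exponent
  program-time {Q} p = ≤-trans p (≤-reflexive (^-*-assoc Q 16 degree))

-- Separates the part in `r` from the part in `n`. The power of the tower is a tower again:
-- `e ≤ 2 ^ e` moves the factor `e` into the inner exponent.
time-bound : ∀ n r e → (n * tower 1 r) ^ e ≤ tower (1 + e) r * n ^ e
time-bound n r e = begin
  (n * tower 1 r) ^ e             ≡⟨ ^-distrib-* n (tower 1 r) e ⟩
  n ^ e * tower 1 r ^ e           ≡⟨ *-comm (n ^ e) _ ⟩
  tower 1 r ^ e * n ^ e           ≡⟨ cong (_* n ^ e) (^-*-assoc 2 (2 ^ (r + r + 1)) e) ⟩
  2 ^ (2 ^ (r + r + 1) * e) * n ^ e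
    ≤⟨ *-monoˡ-≤ (n ^ e) (^-monoʳ-≤ 2 (begin
         2 ^ (r + r + 1) * e          ≤⟨ *-monoʳ-≤ (2 ^ (r + r + 1)) (<⇒≤ (n<2^n e)) ⟩
         2 ^ (r + r + 1) * 2 ^ e      ≡⟨ sym (^-distribˡ-+-* 2 (r + r + 1) e) ⟩
         2 ^ (r + r + 1 + e)          ≡⟨ cong (2 ^_) (+-assoc (r + r) 1 e) ⟩
         2 ^ (r + r + (1 + e))        ∎)) ⟩
  tower (1 + e) r * n ^ e         ∎
  where
  open ≤-Reasoning
  ^-distrib-* : ∀ a b e → (a * b) ^ e ≡ a ^ e * b ^ e
  ^-distrib-* a b zero    = refl
  ^-distrib-* a b (suc e) = trans (cong (a * b *_) (^-distrib-* a b e)) ([m*n]*[o*p]≡[m*o]*[n*p] a b (a ^ e) (b ^ e))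

module Run (I : Instance) (r : ℕ) where

  open Instance I using (n; k)

  -- Large enough for every field of a configuration: masks are below `2 * n`, vertices below `n`,
  -- leader counts at most `n`, weights and numbers of closed walks at most `r`, colour sets below
  -- `2 ^ (2 ^ (r + r))`. The 1 in `tower 1 r` makes the tower at least 2 with room to spare.
  Q : ℕ
  Q = n * tower 1 r

  n≥1 : 1 ≤ n
  n≥1 = ≤-trans (s≤s z≤n) (toℕ<n (proj₁ (Instance.nonempty I)))

  tower≤Q : tower 1 r ≤ Q
  tower≤Q = m≤n*m (tower 1 r) n {{>-nonZero n≥1}}

  2≤tower : 2 ≤ tower 1 r
  2≤tower = ^-monoʳ-≤ 2 {1} (m^n>0 2 (r + r + 1))

  2n≤Q : 2 * n ≤ Q
  2n≤Q = ≤-trans (*-monoˡ-≤ n 2≤tower) (≤-reflexive (*-comm (tower 1 r) n))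

  2^K≤Q : 2 ^ (2 ^ (r + r)) ≤ Q
  2^K≤Q = ≤-trans (^-monoʳ-≤ 2 (^-monoʳ-≤ 2 (m≤m+n (r + r) 1))) tower≤Q

  r<Q : r < Q
  r<Q = begin-strict
    r                   ≤⟨ m≤m+n r r ⟩
    r + r               <⟨ n<2^n (r + r) ⟩
    2 ^ (r + r)         <⟨ n<2^n (2 ^ (r + r)) ⟩
    2 ^ (2 ^ (r + r))   ≤⟨ 2^K≤Q ⟩
    Q                   ∎
    where open ≤-Reasoning

  Outcome : ℕ → Set
  Outcome b = ∃[ s ] ∃[ t ] ⟨ program , load I r ⟩⇓⟨ s , t ⟩ × t ≤ b ×
    (output s ≡ 1 ⇔ (Σ[ R ∈ Instance.Routing I ] Instance.weight I R ≤ r))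

  module Main (Q N B : ℕ) (Q≡ : Q ≡ n * tower 1 r) (N≡ : N ≡ Q ^ 8) (B≡ : B ≡ Q ^ 16) where

    N*N≡B : N * N ≡ B
    N*N≡B = trans (cong₂ _*_ N≡ N≡) (trans (sym (^-distribˡ-+-* Q 8 8)) (sym B≡))

    open Algorithm I r Q N B N≡ N*N≡B n≥1 (subst (2 * n ≤_) (sym Q≡) 2n≤Q)
      (subst (r <_) (sym Q≡) r<Q) (subst (2 ^ (2 ^ (r + r)) ≤_) (sym Q≡) 2^K≤Q)

    2≤B : 2 ≤ B
    2≤B = ≤-trans (≤-trans 2≤tower (subst (tower 1 r ≤_) (sym Q≡) tower≤Q)) Q≤B

    open Compile g α 2≤B hiding (B)
    open Eval g α using (eval)

    globals≡ : ∀ {s₁} → Inputs (load I r) s₁ →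
      register s₁ 3 ≡ Q → register s₁ 4 ≡ Q ^ 8 → register s₁ 5 ≡ Q ^ 16 → Ok s₁
    globals≡ {s₁} (n≡ , k≡ , r≡ , arr≡) Q′≡ N′≡ B′≡ = ok same arr≡
      where
      same : ∀ i → i < 6 → register s₁ i ≡ g i
      same 0 _ = n≡
      same 1 _ = k≡
      same 2 _ = r≡
      same 3 _ = Q′≡
      same 4 _ = trans N′≡ (sym N≡)
      same 5 _ = trans B′≡ (sym B≡)
      same (suc (suc (suc (suc (suc (suc i)))))) (s≤s (s≤s (s≤s (s≤s (s≤s (s≤s ()))))))

    finish : ∀ {s₁ t₁} → ⟨ prelude 1 , load I r ⟩⇓⟨ s₁ , t₁ ⟩ → t₁ ≤ B ^ 11 →
      Exec (compile mainᵀ [] 6) s₁ 6 (eval mainᵀ []) (κ mainᵀ) → Outcome (B ^ degree)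
    finish run₁ t₁≤ (exec {s₂} {t₂} run₂ t₂≤ value _) =
      setRegister 0 (register s₂ 6) s₂ , _ , seq run₁ (seq run₂ assign) ,
      degree-bound (+-bound 11 (suc (κ mainᵀ + 1)) t₁≤ (+-bound (κ mainᵀ) 1 t₂≤ (2^≤ 1))) ,
      subst (λ z → (z ≡ 1) ⇔ (Σ[ R ∈ Instance.Routing I ] Instance.weight I R ≤ r)) (sym value) decides

    outcome : Outcome (B ^ degree)
    outcome =
      let s₁ , t₁ , run₁ , t₁≤ , inputs , Q′≡ , N′≡ , B′≡ = prelude-runs 1 (load I r) Q n≥1 Q≡ in
      finish run₁ (subst (λ z → t₁ ≤ z ^ 11) (sym B≡) t₁≤) (correct mainᵀ (globals≡ inputs Q′≡ N′≡ B′≡) ≤-refl [])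

  in-time : Outcome (tower (1 + exponent) r * n ^ exponent)
  in-time = let s , t , run , t≤ , correct = Main.outcome Q (Q ^ 8) (Q ^ 16) refl refl refl in
    s , t , run , ≤-trans (program-time t≤) (time-bound n r exponent) , correct

corollary3p3 :
    Σ[ P ∈ Program ] Σ[ f ∈ (ℕ → ℕ) ] Σ[ c ∈ ℕ ]
      Computable f ×
      ((I : Instance) (r : ℕ) →
        ∃[ s ] ∃[ t ]
          ⟨ P , load I r ⟩⇓⟨ s , t ⟩ ×
          t ≤ f r * Instance.n I ^ c ×
          (output s ≡ 1 ⇔ (Σ[ R ∈ Instance.Routing I ] Instance.weight I R ≤ r)))
corollary3p3 = program , tower (1 + exponent) , exponent , tower-computable (1 + exponent) , Run.in-time
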